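{- Let $\eta>0$ and let $H$ be a graph with at least one edge and chromatic number $\chi(H)=r$ (so $r\ge2$). Let $h:=|H|$, $\sigma:=\sigma(H)$ and $\omega:=(h-\sigma)/(r-1)$. Then there exists $n_0=n_0(\eta,H)\in\mathbb{N}$ such that the following holds: if $G$ is a graph on $n\ge n_0$ vertices with degree sequence $d_1\le d_2\le\dots\le d_n$ such that \[d_i\ge\left(1-\frac{\omega+\sigma}{h}\right)n+\frac{\sigma}{\omega}i+\eta n\quad\text{for all } 1\le i\le\frac{\omega n}{h},\] then $G$ has an $H$-tiling covering all but at most $\eta n$ vertices.
   Context: For a graph $H$, $\sigma(H)$ denotes the smallest possible size of a colour class over all proper colourings of $H$ with $\chi(H)$ colours. An $H$-tiling in $G$ is a collection of vertex-disjoint copies of $H$ in $G$. The degree sequence is the list of vertex degrees in non-decreasing order. -}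

module Defs where

open import Data.Nat as ℕ using (ℕ; zero; suc; _∸_)
open import Data.Bool using (Bool; true; false; if_then_else_)
open import Data.Fin as Fin using (Fin; toℕ)
open import Data.Fin.Properties using () renaming (_≟_ to _≟ᶠ_)
open import Data.List using (List; map; allFin)
open import Data.Nat.ListAction using (sum)
open import Data.Integer using (+_)
open import Data.Rational as ℚ using (ℚ; 0ℚ; 1ℚ; _+_; _*_; _-_; _≤_; _<_)
open import Data.Rational.Properties using () renaming (_≟_ to _≟ℚ_)
open import Data.Product using (Σ; ∃; _×_; _,_)
open import Relation.Nullary using (¬_; yes; no; does)
open import Relation.Binary.PropositionalEquality using (_≡_; _≢_)
open import Function.Definitions using (Injective; Bijective)

record Graph (n : ℕ) : Set where
  field
    adj    : Fin n → Fin n → Bool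
    sym    : ∀ u v → adj u v ≡ adj v u
    irrefl : ∀ v → adj v v ≡ false
open Graph public

countᵇ : ∀ {n} → (Fin n → Bool) → ℕ
countᵇ {n} P = sum (map (λ v → if P v then 1 else 0) (allFin n))

degree : ∀ {n} → Graph n → Fin n → ℕ
degree G v = countᵇ (adj G v)

HasEdge : ∀ {n} → Graph n → Set
HasEdge G = ∃ λ u → ∃ λ v → adj G u v ≡ true

ProperColouring : ∀ {n} → Graph n → (k : ℕ) → (Fin n → Fin k) → Set
ProperColouring G k c = ∀ u v → adj G u v ≡ true → c u ≢ c v

Colourable : ∀ {n} → Graph n → ℕ → Set
Colourable G k = Σ (_ → Fin k) (ProperColouring G k)

ChromaticNumber : ∀ {n} → Graph n → ℕ → Set
ChromaticNumber G r = Colourable G r × (∀ k → k ℕ.< r → ¬ Colourable G k)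

classSize : ∀ {n k} → (Fin n → Fin k) → Fin k → ℕ
classSize c j = countᵇ (λ v → does (c v ≟ᶠ j))

IsSigma : ∀ {n} → Graph n → (r s : ℕ) → Set
IsSigma G r s =
  (∃ λ (c : _ → Fin r) → ProperColouring G r c × ∃ λ j → classSize c j ≡ s)
  × (∀ (c : _ → Fin r) → ProperColouring G r c → ∀ j → s ℕ.≤ classSize c j)

ℕ→ℚ : ℕ → ℚ
ℕ→ℚ n = + n ℚ./ 1

-- total division (returns 0 when dividing by 0); only ever applied to
-- nonzero denominators in the theorem
_÷₀_ : ℚ → ℚ → ℚ
p ÷₀ q with q ≟ℚ 0ℚ
... | yes _  = 0ℚ
... | no q≢0 = ℚ._÷_ p q {{ℚ.≢-nonZero q≢0}}

-- Degree sequence: d_i = degree (ord (i-1)) where ord enumerates the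
-- vertices bijectively in non-decreasing order of degree

DegreeOrdering : ∀ {n} → Graph n → (Fin n → Fin n) → Set
DegreeOrdering G ord =
  Bijective _≡_ _≡_ ord
  × (∀ i j → i Fin.≤ j → degree G (ord i) ℕ.≤ degree G (ord j))

DegreeCondition : ∀ {n} → Graph n → (η ω : ℚ) → (h σ : ℕ) → Set
DegreeCondition {n} G η ω h σ =
  ∃ λ ord → DegreeOrdering G ord ×
    (∀ (i : Fin n) →
      let d = degree G (ord i)
          i′ = ℕ→ℚ (suc (toℕ i))
      in i′ ≤ ((ω * ℕ→ℚ n) ÷₀ ℕ→ℚ h) →
         ((1ℚ - ((ω + ℕ→ℚ σ) ÷₀ ℕ→ℚ h)) * ℕ→ℚ n
           + (ℕ→ℚ σ ÷₀ ω) * i′ + η * ℕ→ℚ n) ≤ ℕ→ℚ d)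

Copy : ∀ {h n} → Graph h → Graph n → Set
Copy {h} {n} H G =
  Σ (Fin h → Fin n) λ f →
    Injective _≡_ _≡_ f × (∀ u v → adj H u v ≡ true → adj G (f u) (f v) ≡ true)

record Tiling {h n} (H : Graph h) (G : Graph n) : Set where
  field
    size     : ℕ
    copy     : Fin size → Copy H G
    disjoint : ∀ a b → a ≢ b → ∀ u v →
               Data.Product.proj₁ (copy a) u ≢ Data.Product.proj₁ (copy b) v
open Tiling public

Covered : ∀ {h n} {H : Graph h} {G : Graph n} → Tiling H G → Fin n → Set
Covered T v = ∃ λ a → ∃ λ u → Data.Product.proj₁ (copy T a) u ≡ v

CoversAllBut : ∀ {h n} {H : Graph h} {G : Graph n} → Tiling H G → ℚ → Set
CoversAllBut {n = n} T m =
  ∃ λ (U : Fin n → Bool) →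
    (∀ v → ¬ Covered T v → U v ≡ true) × ℕ→ℚ (countᵇ U) ≤ m

{-# OPTIONS --safe #-}
module Submission where

-- Blow up the bottle graph of H: an s-bottle is a complete r-partite graph with a neck of size a s
-- and r - 1 bodies of size b s, where a : b is a hair below σ : ω.  Up to a negligible remainder an
-- s-bottle is tiled by H, so it suffices to cover G by bottles.  This is done by local search without
-- the regularity lemma.  Vertices are ranked by degree.  If the uncovered set L is large, then either
-- (1) many x in L see a positive proportion of every body of a positive proportion of the bottles, or
-- (2) they do so except for one body which contains many vertices of larger rank than x, or
-- (3) nearly all of L inherits the degree sequence condition inside G[L].
-- In case (3) a greedy choice finds a bottle inside L.  In cases (1) and (2) pigeonhole over the
-- boundedly many adjacency patterns gives a set A of such x with a common pattern to one bottle, and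
-- a sub-bottle of smaller scale is rebuilt with A: in (1) all of A becomes covered, because a < b lets
-- A join the neck; in (2) A is exchanged for vertices of larger rank.  Each move decreases a potential.
-- Since moves shrink the scale by a factor ρ, they are grouped into phases, in each of which a bottle is
-- used at most once; a phase ends only after the potential has dropped by a fixed proportion, which
-- bounds the number of phases independently of n.

-- The three cases are exhaustive because of an upper bound. In a bottle of scale `s` that offers
-- `x` no move, `x` has at most `p * b * s` neighbours, plus `a / b` times its low vertices there
-- (capped at `b * s`), plus an error of `2 / e` of the bottle. This is the share that the degree
-- condition assigns to such a set. Subtracting it over all bottles leaves the same condition for
-- the uncovered set: of the slack `n / E`, the tile errors, the useful and used tiles, and the
-- margin in comparing ranks cost at most a quarter each, so a quarter remains.
--
-- Inside the uncovered set the vertices whose rank there is at least the proportion `b / m`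
-- suffice. Each of them that is not useful for a move misses less than `b / m` of the set, and
-- those of smaller rank make up at most `b / m` of it. So `suc p` parts can be chosen among them
-- one after another, and the last part may contain any vertex.
--
-- Ranks are capped where the condition stops, at `ω n / h`, just as the low vertices of one bottle
-- are capped at the size of a body. If `σ = ω`, the exact ratio would make the covering move gain
-- nothing; hence the extra vertex in each body.

-- Clearing denominators in the degree condition

module Rationals where

  open import Defs hiding (sym)
  open import Data.Nat as ℕ using (ℕ; zero; suc; _∸_)
  import Data.Nat.Properties as ℕₚ
  open import Data.Integer as ℤ using (+_; -[1+_])
  import Data.Integer.Properties as ℤₚ
  open import Data.Rational as ℚ using (ℚ; mkℚ; 0ℚ; 1ℚ; _+_; _*_; _-_; _≤_; _<_; toℚᵘ; ↧ₙ_)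
  open import Data.Rational.Properties
  open import Data.Rational.Unnormalised as ℚᵘ using (mkℚᵘ; *≤*; *≡*)
  import Data.Rational.Unnormalised.Properties as ℚᵘₚ
  open import Data.Rational.Solver using (module +-*-Solver)
  open import Data.Empty using (⊥-elim)
  open import Relation.Nullary using (yes; no)
  open import Relation.Binary.PropositionalEquality
  open import Function using (case_of_)

  toℚᵘ-ℕ : ∀ n → toℚᵘ (ℕ→ℚ n) ℚᵘ.≃ mkℚᵘ (+ n) 0
  toℚᵘ-ℕ n = toℚᵘ-fromℚᵘ (mkℚᵘ (+ n) 0)

  ℕ→ℚ-+ : ∀ m n → ℕ→ℚ (m ℕ.+ n) ≡ ℕ→ℚ m + ℕ→ℚ n
  ℕ→ℚ-+ m n = toℚᵘ-injective (begin
    toℚᵘ (ℕ→ℚ (m ℕ.+ n))                ≈⟨ toℚᵘ-ℕ (m ℕ.+ n) ⟩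
    mkℚᵘ (+ (m ℕ.+ n)) 0                ≈⟨ *≡* (cong (ℤ._* + 1) (trans (ℤₚ.pos-+ m n) (sym (cong₂ ℤ._+_ (ℤₚ.*-identityʳ (+ m)) (ℤₚ.*-identityʳ (+ n)))))) ⟩
    mkℚᵘ (+ m) 0 ℚᵘ.+ mkℚᵘ (+ n) 0      ≈⟨ ℚᵘₚ.+-cong (toℚᵘ-ℕ m) (toℚᵘ-ℕ n) ⟨
    toℚᵘ (ℕ→ℚ m) ℚᵘ.+ toℚᵘ (ℕ→ℚ n)      ≈⟨ toℚᵘ-homo-+ (ℕ→ℚ m) (ℕ→ℚ n) ⟨
    toℚᵘ (ℕ→ℚ m + ℕ→ℚ n)                ∎)
    where open ℚᵘₚ.≃-Reasoning

  ℕ→ℚ-* : ∀ m n → ℕ→ℚ (m ℕ.* n) ≡ ℕ→ℚ m * ℕ→ℚ n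
  ℕ→ℚ-* m n = toℚᵘ-injective (begin
    toℚᵘ (ℕ→ℚ (m ℕ.* n))                ≈⟨ toℚᵘ-ℕ (m ℕ.* n) ⟩
    mkℚᵘ (+ (m ℕ.* n)) 0                ≈⟨ *≡* (cong (ℤ._* + 1) (ℤₚ.pos-* m n)) ⟩
    mkℚᵘ (+ m) 0 ℚᵘ.* mkℚᵘ (+ n) 0      ≈⟨ ℚᵘₚ.*-cong (toℚᵘ-ℕ m) (toℚᵘ-ℕ n) ⟨
    toℚᵘ (ℕ→ℚ m) ℚᵘ.* toℚᵘ (ℕ→ℚ n)      ≈⟨ toℚᵘ-homo-* (ℕ→ℚ m) (ℕ→ℚ n) ⟨
    toℚᵘ (ℕ→ℚ m * ℕ→ℚ n)                ∎)
    where open ℚᵘₚ.≃-Reasoning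

  ℕ→ℚ-mono : ∀ {m n} → m ℕ.≤ n → ℕ→ℚ m ≤ ℕ→ℚ n
  ℕ→ℚ-mono {m} {n} m≤n = toℚᵘ-cancel-≤ (begin
    toℚᵘ (ℕ→ℚ m)  ≃⟨ toℚᵘ-ℕ m ⟩
    mkℚᵘ (+ m) 0  ≤⟨ *≤* (ℤₚ.*-monoʳ-≤-nonNeg (+ 1) (ℤ.+≤+ m≤n)) ⟩
    mkℚᵘ (+ n) 0  ≃⟨ toℚᵘ-ℕ n ⟨
    toℚᵘ (ℕ→ℚ n)  ∎)
    where open ℚᵘₚ.≤-Reasoning

  ℕ→ℚ-cancel : ∀ {m n} → ℕ→ℚ m ≤ ℕ→ℚ n → m ℕ.≤ n
  ℕ→ℚ-cancel {m} {n} h = from (begin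
    mkℚᵘ (+ m) 0  ≃⟨ toℚᵘ-ℕ m ⟨
    toℚᵘ (ℕ→ℚ m)  ≤⟨ toℚᵘ-mono-≤ h ⟩
    toℚᵘ (ℕ→ℚ n)  ≃⟨ toℚᵘ-ℕ n ⟩
    mkℚᵘ (+ n) 0  ∎)
    where
    open ℚᵘₚ.≤-Reasoning
    from : mkℚᵘ (+ m) 0 ℚᵘ.≤ mkℚᵘ (+ n) 0 → m ℕ.≤ n
    from (*≤* h) = ℤₚ.drop‿+≤+ (subst₂ ℤ._≤_ (ℤₚ.*-identityʳ (+ m)) (ℤₚ.*-identityʳ (+ n)) h)

  ℕ→ℚ-nonNeg : ∀ n → ℚ.NonNegative (ℕ→ℚ n)
  ℕ→ℚ-nonNeg n = ℚ.nonNegative (ℕ→ℚ-mono {0} {n} ℕ.z≤n)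

  0<⇒pos : ∀ {n} → 0 ℕ.< n → ℚ.Positive (ℕ→ℚ n)
  0<⇒pos {n} 0<n = ℚ.positive (≰⇒> (λ h → ℕₚ.<⇒≱ 0<n (ℕ→ℚ-cancel {n} {0} h)))

  pos⇒≢0 : ∀ {q} → ℚ.Positive q → q ≢ 0ℚ
  pos⇒≢0 {q} q>0 q≡0 = <-irrefl (sym q≡0) (positive⁻¹ q {{q>0}})

  ÷₀-* : ∀ p q → q ≢ 0ℚ → (p ÷₀ q) * q ≡ p
  ÷₀-* p q q≢0 with q ≟ 0ℚ
  ... | yes q≡0 = ⊥-elim (q≢0 q≡0)
  ... | no  q≢0′ = trans (*-assoc p _ q) (trans (cong (p *_) (*-inverseˡ q {{ℚ.≢-nonZero q≢0′}})) (*-identityʳ p))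

  -- A positive rational is `k / d` with `k ≥ 1`, so its product with `d` is `k`. From here on `η`
  -- enters only through a natural number `E` with `1 / E ≤ η`.
  1≤*denominator : ∀ η → 0ℚ < η → 1ℚ ≤ η * ℕ→ℚ (↧ₙ η)
  1≤*denominator η@(mkℚ (+ suc k) d-1 c) 0<η = toℚᵘ-cancel-≤ (begin
    toℚᵘ 1ℚ                                  ≤⟨ *≤* (ℤ.+≤+ bound) ⟩
    mkℚᵘ (+ suc k) d-1 ℚᵘ.* mkℚᵘ (+ suc d-1) 0 ≃⟨ ℚᵘₚ.*-congˡ {mkℚᵘ (+ suc k) d-1} (toℚᵘ-ℕ (suc d-1)) ⟨
    toℚᵘ η ℚᵘ.* toℚᵘ (ℕ→ℚ (suc d-1))         ≃⟨ toℚᵘ-homo-* η (ℕ→ℚ (suc d-1)) ⟨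
    toℚᵘ (η * ℕ→ℚ (suc d-1))                 ∎)
    where
    open ℚᵘₚ.≤-Reasoning
    bound : 1 ℕ.* (suc d-1 ℕ.* 1) ℕ.≤ suc k ℕ.* suc d-1 ℕ.* 1
    bound = ℕₚ.≤-trans (ℕₚ.≤-reflexive (trans (ℕₚ.*-identityˡ _) (ℕₚ.*-identityʳ (suc d-1))))
      (ℕₚ.≤-trans (ℕₚ.m≤m+n (suc d-1) (k ℕ.* suc d-1)) (ℕₚ.≤-reflexive (sym (ℕₚ.*-identityʳ (suc k ℕ.* suc d-1)))))
  1≤*denominator η@(mkℚ (+ zero) d-1 c) 0<η = ⊥-elim (<-irrefl refl (<-≤-trans 0<η (toℚᵘ-cancel-≤ (*≤* (ℤₚ.≤-reflexive refl)))))
  1≤*denominator η@(mkℚ -[1+ k ] d-1 c) 0<η = ⊥-elim (<-irrefl refl (<-≤-trans 0<η (toℚᵘ-cancel-≤ (*≤* ℤ.-≤+))))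

  scaleDown : ∀ η → 0ℚ < η → ∀ E → 1ℚ ≤ η * ℕ→ℚ E → ∀ k n → E ℕ.* k ℕ.≤ n → ℕ→ℚ k ≤ η * ℕ→ℚ n
  scaleDown η 0<η E 1≤ηE k n bound = begin
    ℕ→ℚ k                          ≡⟨ *-identityˡ (ℕ→ℚ k) ⟨
    1ℚ * ℕ→ℚ k                     ≤⟨ *-monoʳ-≤-nonNeg (ℕ→ℚ k) {{ℕ→ℚ-nonNeg k}} 1≤ηE ⟩
    η * ℕ→ℚ E * ℕ→ℚ k         ≡⟨ trans (*-assoc η _ _) (cong (η *_) (sym (ℕ→ℚ-* E k))) ⟩
    η * ℕ→ℚ (E ℕ.* k)           ≤⟨ *-monoˡ-≤-nonNeg η {{ℚ.nonNegative (<⇒≤ 0<η)}} (ℕ→ℚ-mono bound) ⟩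
    η * ℕ→ℚ n                      ∎
    where open ≤-Reasoning

  -- The degree condition cleared of denominators, and with all terms moved so that no subtraction occurs.
  module Clear (η : ℚ) (E : ℕ) (1≤ηE : 1ℚ ≤ η * ℕ→ℚ E)
    (q h σ b₀ n i d : ℕ) (W X Y Z : ℚ)
    (W-eq : W * ℕ→ℚ q ≡ ℕ→ℚ b₀) (X-eq : X * ℕ→ℚ h ≡ W + ℕ→ℚ σ)
    (Y-eq : Y * W ≡ ℕ→ℚ σ) (Z-eq : Z * ℕ→ℚ h ≡ W * ℕ→ℚ n)
    where

    private
      ι = ℕ→ℚ
      m : ℕ
      m = q ℕ.* h

    -- `Z` stands for `ω n / h`; multiplied by `m = q * h`, the range of the condition becomes a
    -- comparison of natural numbers.
    inRange : 0 ℕ.< m → m ℕ.* i ℕ.≤ b₀ ℕ.* n → ι i ≤ Z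
    inRange 0<m mi≤bn = *-cancelʳ-≤-pos (ι m) {{0<⇒pos 0<m}} (begin
      ι i * ι m         ≡⟨ trans (*-comm (ι i) (ι m)) (sym (ℕ→ℚ-* m i)) ⟩
      ι (m ℕ.* i)       ≤⟨ ℕ→ℚ-mono mi≤bn ⟩
      ι (b₀ ℕ.* n)      ≡⟨ trans (ℕ→ℚ-* b₀ n) (cong (_* ι n) (sym W-eq)) ⟩
      W * ι q * ι n     ≡⟨ solve 3 (λ w q n → w :* q :* n := w :* n :* q) refl W (ι q) (ι n) ⟩
      W * ι n * ι q     ≡⟨ cong (_* ι q) Z-eq ⟨
      Z * ι h * ι q     ≡⟨ solve 3 (λ z h q → z :* h :* q := z :* (q :* h)) refl Z (ι h) (ι q) ⟩
      Z * (ι q * ι h)   ≡⟨ cong (Z *_) (ℕ→ℚ-* q h) ⟨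
      Z * ι m           ∎)
      where
      open ≤-Reasoning
      open +-*-Solver

    cleared : (1ℚ - X) * ι n + Y * ι i + η * ι n ≤ ι d →
              E ℕ.* (m ℕ.* (b₀ ℕ.* n)) ℕ.+ E ℕ.* (m ℕ.* (q ℕ.* σ ℕ.* i)) ℕ.+ m ℕ.* (b₀ ℕ.* n)
              ℕ.≤ E ℕ.* (m ℕ.* (b₀ ℕ.* d)) ℕ.+ E ℕ.* (b₀ ℕ.* ((b₀ ℕ.+ q ℕ.* σ) ℕ.* n))
    cleared cond = ℕ→ℚ-cancel (begin
      ι (E ℕ.* (m ℕ.* (b₀ ℕ.* n)) ℕ.+ E ℕ.* (m ℕ.* (q ℕ.* σ ℕ.* i)) ℕ.+ m ℕ.* (b₀ ℕ.* n))
        ≡⟨ trans (ℕ→ℚ-+ (E ℕ.* (m ℕ.* (b₀ ℕ.* n)) ℕ.+ E ℕ.* (m ℕ.* (q ℕ.* σ ℕ.* i))) _)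
             (cong₂ _+_ (trans (ℕ→ℚ-+ (E ℕ.* (m ℕ.* (b₀ ℕ.* n))) _) (cong₂ _+_
               (trans (ℕ→ℚ-* E _) (cong (ι E *_) mbn))
               (trans (ℕ→ℚ-* E _) (cong (ι E *_) (trans (ℕ→ℚ-* m _) (cong₂ _*_ (ℕ→ℚ-* q h) (trans (ℕ→ℚ-* (q ℕ.* σ) i) (cong (_* ι i) (ℕ→ℚ-* q σ)))))))))
               (trans mbn (sym (*-identityʳ _)))) ⟩
      ι E * (Q * H * (B * N)) + ι E * (Q * H * (Q * ι σ * ι i)) + Q * H * (B * N) * 1ℚ
        -- The slack `η n` enters here, weakened to `n / E`.
        ≤⟨ +-monoʳ-≤ (ι E * (Q * H * (B * N)) + ι E * (Q * H * (Q * ι σ * ι i))) (*-monoˡ-≤-nonNeg (Q * H * (B * N)) {{subst ℚ.NonNegative mbn (ℕ→ℚ-nonNeg (m ℕ.* (b₀ ℕ.* n)))}} 1≤ηE) ⟩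
      ι E * (Q * H * (B * N)) + ι E * (Q * H * (Q * ι σ * ι i)) + Q * H * (B * N) * (η * ι E)
        ≡⟨ cong (λ s → ι E * (Q * H * (B * N)) + ι E * (Q * H * (Q * s * ι i)) + Q * H * (B * N) * (η * ι E)) Y-eq ⟨
      ι E * (Q * H * (B * N)) + ι E * (Q * H * (Q * (Y * W) * ι i)) + Q * H * (B * N) * (η * ι E)
        ≡⟨ solve 9 (λ E Q H B N Y W i η →
             E :* (Q :* H :* (B :* N)) :+ E :* (Q :* H :* (Q :* (Y :* W) :* i)) :+ Q :* H :* (B :* N) :* (η :* E)
             := E :* (Q :* H) :* (B :* N :+ W :* Q :* (Y :* i) :+ B :* (η :* N))) refl (ι E) Q H B N Y W (ι i) η ⟩
      ι E * (Q * H) * (B * N + W * Q * (Y * ι i) + B * (η * N))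
        ≡⟨ cong (λ w → ι E * (Q * H) * (B * N + w * (Y * ι i) + B * (η * N))) W-eq ⟩
      ι E * (Q * H) * (B * N + B * (Y * ι i) + B * (η * N))
        ≡⟨ solve 8 (λ E Q H B N y x h →
             E :* (Q :* H) :* (B :* N :+ B :* y :+ B :* h)
             := E :* (Q :* H) :* B :* ((con 1ℚ :- x) :* N :+ y :+ h) :+ E :* (Q :* H) :* B :* (x :* N)) refl (ι E) Q H B N (Y * ι i) X (η * N) ⟩
      ι E * (Q * H) * B * ((1ℚ - X) * N + Y * ι i + η * N) + ι E * (Q * H) * B * (X * N)
        ≤⟨ +-monoˡ-≤ (ι E * (Q * H) * B * (X * N)) (*-monoˡ-≤-nonNeg (ι E * (Q * H) * B) {{subst ℚ.NonNegative emb (ℕ→ℚ-nonNeg (E ℕ.* m ℕ.* b₀))}} cond) ⟩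
      ι E * (Q * H) * B * ι d + ι E * (Q * H) * B * (X * N)
        ≡⟨ solve 7 (λ E Q H B d X N →
             E :* (Q :* H) :* B :* d :+ E :* (Q :* H) :* B :* (X :* N)
             := E :* (Q :* H :* (B :* d)) :+ E :* (B :* (X :* H :* Q :* N))) refl (ι E) Q H B (ι d) X N ⟩
      ι E * (Q * H * (B * ι d)) + ι E * (B * (X * H * Q * N))
        ≡⟨ cong (λ x → ι E * (Q * H * (B * ι d)) + ι E * (B * (x * N)))
             (trans (cong (_* Q) X-eq) (trans (*-distribʳ-+ Q W (ι σ)) (cong₂ _+_ W-eq (*-comm (ι σ) Q)))) ⟩
      ι E * (Q * H * (B * ι d)) + ι E * (B * ((B + Q * ι σ) * N))
        ≡⟨ trans (ℕ→ℚ-+ (E ℕ.* (m ℕ.* (b₀ ℕ.* d))) _) (cong₂ _+_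
             (trans (ℕ→ℚ-* E _) (cong (ι E *_) (trans (ℕ→ℚ-* m _) (cong₂ _*_ (ℕ→ℚ-* q h) (ℕ→ℚ-* b₀ d)))))
             (trans (ℕ→ℚ-* E _) (cong (ι E *_) (trans (ℕ→ℚ-* b₀ _) (cong (B *_) (trans (ℕ→ℚ-* (b₀ ℕ.+ q ℕ.* σ) n)
               (cong (_* N) (trans (ℕ→ℚ-+ b₀ _) (cong (λ z → B + z) (ℕ→ℚ-* q σ)))))))))) ⟨
      ι (E ℕ.* (m ℕ.* (b₀ ℕ.* d)) ℕ.+ E ℕ.* (b₀ ℕ.* ((b₀ ℕ.+ q ℕ.* σ) ℕ.* n))) ∎)
      where
      open ≤-Reasoning
      open +-*-Solver
      Q = ι q
      H = ι h
      B = ι b₀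
      N = ι n
      mbn : ι (m ℕ.* (b₀ ℕ.* n)) ≡ Q * H * (B * N)
      mbn = trans (ℕ→ℚ-* m _) (cong₂ _*_ (ℕ→ℚ-* q h) (ℕ→ℚ-* b₀ n))
      emb : ι (E ℕ.* m ℕ.* b₀) ≡ ι E * (Q * H) * B
      emb = trans (ℕ→ℚ-* (E ℕ.* m) b₀) (cong (_* B) (trans (ℕ→ℚ-* E m) (cong (ι E *_) (ℕ→ℚ-* q h))))

open import Defs hiding (sym)
open import Data.Bool using (Bool; _∧_; false; if_then_else_; not; true)
open import Data.Bool.Properties using (T-≡) renaming (_≟_ to _≟ᵇ_)
open import Data.Empty using (⊥-elim)
open import Data.Fin as Fin using (Fin; combine; fromℕ<; inject≤; punchIn; punchOut; toℕ)
open import Data.Fin.Properties using (all?; any?; combine-injective; inject≤-injective; punchIn-punchOut; punchInᵢ≢i; punchOut-injective; toℕ-fromℕ<; toℕ-injective; toℕ-inject≤; toℕ<n; ¬∀⟶∃¬) renaming (_≟_ to _≟ᶠ_)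
open import Data.List using (List; []; _++_; _∷_; allFin; cartesianProduct; concatMap; filter; length; lookup; map)
open import Data.List.Membership.Propositional using (_∈_)
open import Data.List.Membership.Propositional.Properties using (∈-++⁺ʳ; ∈-++⁺ˡ; ∈-++⁻; ∈-allFin; ∈-concatMap⁺; ∈-filter⁺; ∈-lookup; ∈-map⁺; ∈-∃++)
open import Data.List.Properties using (length-++; length-map; map-tabulate)
open import Data.List.Relation.Unary.All as All using (All; []; _∷_)
open import Data.List.Relation.Unary.All.Properties as Allₚ using (++⁺)
open import Data.List.Relation.Unary.AllPairs using ([]; _∷_)
open import Data.List.Relation.Unary.Any as Any using (Any; here; index; there)
open import Data.List.Relation.Unary.Any.Properties using (lookup-index)
open import Data.List.Relation.Unary.Unique.Propositional using (Unique; []; _∷_)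
open import Data.List.Relation.Unary.Unique.Propositional.Properties using (allFin⁺; cartesianProduct⁺)
open import Data.Nat hiding (_<_)
open import Data.Nat.DivMod using (m%n<n; m/n*n≤m; m≡m%n+[m/n]*n)
open import Data.Nat.Induction using (<-wellFounded; Acc; acc)
open import Data.Nat.ListAction using (sum)
open import Data.Nat.Properties
open import Data.Nat.Tactic.RingSolver using (solve-∀)
open import Data.Product using (_,_; _×_; proj₁; proj₂; uncurry; Σ; ∃)
open import Data.Sum using ([_,_]′; _⊎_; inj₁; inj₂)
open import Function using (_∘_; case_of_; id)
open import Function.Bundles using (Equivalence)
open import Function.Definitions using (Bijective)
open import Relation.Binary.PropositionalEquality
open import Relation.Nullary using (Dec; does; no; yes; ¬_)
open import Relation.Nullary.Decidable using (_×-dec_; _→-dec_; _⊎-dec_; dec-false; dec-true; ¬?)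

-- Finite sums, counting, pigeonhole and averaging

module Sums where
  open import Data.Nat using (_<_)

  private variable
    A B : Set

  ∑ : List A → (A → ℕ) → ℕ
  ∑ []       f = 0
  ∑ (x ∷ xs) f = f x + ∑ xs f

  ∑≡sum : ∀ (xs : List A) f → ∑ xs f ≡ sum (map f xs)
  ∑≡sum []       f = refl
  ∑≡sum (x ∷ xs) f = cong (f x +_) (∑≡sum xs f)

  ∑-map : ∀ (g : A → B) xs f → ∑ (map g xs) f ≡ ∑ xs (f ∘ g)
  ∑-map g []       f = refl
  ∑-map g (x ∷ xs) f = cong (f (g x) +_) (∑-map g xs f)

  ⟦_⟧ : Bool → ℕ
  ⟦ b ⟧ = if b then 1 else 0

  # : (A → Bool) → List A → ℕ
  # P xs = ∑ xs (λ x → ⟦ P x ⟧)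

  ⟦⟧≤1 : ∀ b → ⟦ b ⟧ ≤ 1
  ⟦⟧≤1 true  = ≤-refl
  ⟦⟧≤1 false = z≤n

  ∑-++ : ∀ (xs ys : List A) f → ∑ (xs ++ ys) f ≡ ∑ xs f + ∑ ys f
  ∑-++ []       ys f = refl
  ∑-++ (x ∷ xs) ys f = trans (cong (f x +_) (∑-++ xs ys f)) (sym (+-assoc (f x) _ _))

  ∑-concatMap : ∀ (g : A → List B) xs f → ∑ (concatMap g xs) f ≡ ∑ xs (λ x → ∑ (g x) f)
  ∑-concatMap g []       f = refl
  ∑-concatMap g (x ∷ xs) f =
    trans (∑-++ (g x) (concatMap g xs) f) (cong (∑ (g x) f +_) (∑-concatMap g xs f))

  ∑-mono-∈ : ∀ (xs : List A) {f g} → (∀ {x} → x ∈ xs → f x ≤ g x) → ∑ xs f ≤ ∑ xs g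
  ∑-mono-∈ []       h = z≤n
  ∑-mono-∈ (x ∷ xs) h = +-mono-≤ (h (here refl)) (∑-mono-∈ xs (h ∘ there))

  ∑-mono : ∀ (xs : List A) {f g} → (∀ x → f x ≤ g x) → ∑ xs f ≤ ∑ xs g
  ∑-mono xs h = ∑-mono-∈ xs (λ {x} _ → h x)

  ∑-cong-∈ : ∀ (xs : List A) {f g} → (∀ {x} → x ∈ xs → f x ≡ g x) → ∑ xs f ≡ ∑ xs g
  ∑-cong-∈ []       h = refl
  ∑-cong-∈ (x ∷ xs) h = cong₂ _+_ (h (here refl)) (∑-cong-∈ xs (h ∘ there))

  ∑-cong : ∀ (xs : List A) {f g} → (∀ x → f x ≡ g x) → ∑ xs f ≡ ∑ xs g
  ∑-cong xs h = ∑-cong-∈ xs (λ {x} _ → h x)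

  ∑-+ : ∀ (xs : List A) f g → ∑ xs (λ x → f x + g x) ≡ ∑ xs f + ∑ xs g
  ∑-+ []       f g = refl
  ∑-+ (x ∷ xs) f g = trans (cong (f x + g x +_) (∑-+ xs f g)) (lemma (f x) (g x) (∑ xs f) (∑ xs g))
    where
    lemma : ∀ a b c d → a + b + (c + d) ≡ a + c + (b + d)
    lemma = solve-∀

  ∑-*ˡ : ∀ (xs : List A) c f → ∑ xs (λ x → c * f x) ≡ c * ∑ xs f
  ∑-*ˡ []       c f = sym (*-zeroʳ c)
  ∑-*ˡ (x ∷ xs) c f = trans (cong (c * f x +_) (∑-*ˡ xs c f)) (sym (*-distribˡ-+ c (f x) _))

  ∑-const : ∀ (xs : List A) c → ∑ xs (λ _ → c) ≡ length xs * c
  ∑-const []       c = refl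
  ∑-const (x ∷ xs) c = cong (c +_) (∑-const xs c)

  ∑-1 : ∀ (xs : List A) → ∑ xs (λ _ → 1) ≡ length xs
  ∑-1 xs = trans (∑-const xs 1) (*-identityʳ _)

  ∑-swap : ∀ (xs : List A) (ys : List B) (f : A → B → ℕ) →
           ∑ xs (λ x → ∑ ys (λ y → f x y)) ≡ ∑ ys (λ y → ∑ xs (λ x → f x y))
  ∑-swap []       ys f = sym (trans (∑-const ys 0) (*-zeroʳ (length ys)))
  ∑-swap (x ∷ xs) ys f =
    trans (cong (∑ ys (f x) +_) (∑-swap xs ys f)) (sym (∑-+ ys (f x) (λ y → ∑ xs (λ x → f x y))))

  ∑-≥-∈ : ∀ {xs : List A} {x} f → x ∈ xs → f x ≤ ∑ xs f
  ∑-≥-∈ f (here refl) = m≤m+n _ _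
  ∑-≥-∈ f (there p)   = ≤-trans (∑-≥-∈ f p) (m≤n+m _ _)

  ∑-allFin-suc : ∀ k f → ∑ (allFin (suc k)) f ≡ f Fin.zero + ∑ (allFin k) (f ∘ Fin.suc)
  ∑-allFin-suc k f = cong (f Fin.zero +_)
    (trans (cong (λ l → ∑ l f) (sym (map-tabulate id Fin.suc))) (∑-map Fin.suc (allFin k) f))

  ∑-remove : ∀ {k} (j : Fin (suc k)) f → ∑ (allFin (suc k)) f ≡ f j + ∑ (allFin k) (f ∘ punchIn j)
  ∑-remove {k}     Fin.zero    f = ∑-allFin-suc k f
  ∑-remove {suc k} (Fin.suc j) f = begin
    ∑ (allFin (suc (suc k))) f
      ≡⟨ ∑-allFin-suc (suc k) f ⟩
    f Fin.zero + ∑ (allFin (suc k)) (f ∘ Fin.suc)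
      ≡⟨ cong (f Fin.zero +_) (∑-remove j (f ∘ Fin.suc)) ⟩
    f Fin.zero + (f (Fin.suc j) + ∑ (allFin k) (f ∘ Fin.suc ∘ punchIn j))
      ≡⟨ lemma (f Fin.zero) (f (Fin.suc j)) _ ⟩
    f (Fin.suc j) + (f Fin.zero + ∑ (allFin k) (f ∘ Fin.suc ∘ punchIn j))
      ≡⟨ cong (f (Fin.suc j) +_) (∑-allFin-suc k (f ∘ punchIn (Fin.suc j))) ⟨
    f (Fin.suc j) + ∑ (allFin (suc k)) (f ∘ punchIn (Fin.suc j)) ∎
    where
    open ≡-Reasoning
    lemma : ∀ a b c → a + (b + c) ≡ b + (a + c)
    lemma = solve-∀

  length-allFin : ∀ k → length (allFin k) ≡ k
  length-allFin zero    = refl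
  length-allFin (suc k) = trans (sym (∑-1 (allFin (suc k))))
    (trans (∑-allFin-suc k (λ _ → 1)) (cong suc (trans (∑-1 (allFin k)) (length-allFin k))))

  ∑-allFin-const : ∀ k c → ∑ (allFin k) (λ _ → c) ≡ k * c
  ∑-allFin-const k c = trans (∑-const (allFin k) c) (cong (_* c) (length-allFin k))

  #-+-not : ∀ (P : A → Bool) xs → # P xs + # (not ∘ P) xs ≡ length xs
  #-+-not P xs = trans (sym (∑-+ xs _ _))
    (trans (∑-cong xs (λ x → lemma (P x))) (∑-1 xs))
    where
    lemma : ∀ b → ⟦ b ⟧ + ⟦ not b ⟧ ≡ 1
    lemma true  = refl
    lemma false = refl

  #≤length : ∀ (P : A → Bool) xs → # P xs ≤ length xs
  #≤length P xs = subst (# P xs ≤_) (∑-1 xs) (∑-mono xs (λ x → ⟦⟧≤1 (P x)))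

  ⟦⟧-mono : ∀ {b c} → (b ≡ true → c ≡ true) → ⟦ b ⟧ ≤ ⟦ c ⟧
  ⟦⟧-mono {false} h = z≤n
  ⟦⟧-mono {true} {true} h = ≤-refl
  ⟦⟧-mono {true} {false} h = ⊥-elim (case h refl of λ ())

  -- A split of the list as a multiset: agreement of the sums of every `f` forgets the order, and
  -- specialises to lengths (`f` constant) and to counts (`f` an indicator).
  record Pick (xs : List A) (k : ℕ) : Set where
    constructor mkPick
    field
      chosen rest   : List A
      chosen-length : length chosen ≡ k
      split         : ∀ f → ∑ xs f ≡ ∑ chosen f + ∑ rest f
      chosen⊆       : ∀ {x} → x ∈ chosen → x ∈ xs
      rest⊆         : ∀ {x} → x ∈ rest → x ∈ xs

    rest-length : length xs ≡ k + length rest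
    rest-length = begin
      length xs                               ≡⟨ ∑-1 xs ⟨
      ∑ xs (λ _ → 1)                          ≡⟨ split (λ _ → 1) ⟩
      ∑ chosen (λ _ → 1) + ∑ rest (λ _ → 1)   ≡⟨ cong₂ _+_ (trans (∑-1 chosen) chosen-length) (∑-1 rest) ⟩
      k + length rest                         ∎
      where open ≡-Reasoning

  open Pick

  pick# : ∀ (P : A → Bool) xs k → k ≤ # P xs →
          Σ (Pick xs k) λ p → ∀ {x} → x ∈ chosen p → P x ≡ true
  pick# P xs zero _ = mkPick [] xs refl (λ f → refl) (λ ()) id , λ ()
  pick# P (x ∷ xs) (suc k) h with P x in eq
  ... | true with pick# P xs k (s≤s⁻¹ h)
  ... | mkPick c r l s c⊆ r⊆ , a =
    mkPick (x ∷ c) r (cong suc l)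
      (λ f → trans (cong (f x +_) (s f)) (sym (+-assoc (f x) _ _)))
      (λ { (here e) → here e ; (there p) → there (c⊆ p) }) (there ∘ r⊆) ,
    λ { (here refl) → eq ; (there p) → a p }
  pick# P (x ∷ xs) (suc k) h | false with pick# P xs (suc k) h
  ... | mkPick c r l s c⊆ r⊆ , a =
    mkPick c (x ∷ r) l
      (λ f → trans (cong (f x +_) (s f)) (lemma (f x) (∑ c f) (∑ r f)))
      (there ∘ c⊆) (λ { (here e) → here e ; (there p) → there (r⊆ p) }) , a
    where
    lemma : ∀ a b c → a + (b + c) ≡ b + (a + c)
    lemma = solve-∀

  pickAny : ∀ (xs : List A) k → k ≤ length xs → Pick xs k
  pickAny xs k h = proj₁ (pick# (λ _ → true) xs k (subst (k ≤_) (sym (∑-1 xs)) h))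

  Constant : (A → Bool) → List A → Set
  Constant P xs = ∀ {x y} → x ∈ xs → y ∈ xs → P x ≡ P y

  ∧-trueˡ : ∀ {b c} → b ∧ c ≡ true → b ≡ true
  ∧-trueˡ {true} _ = refl

  ∧-trueʳ : ∀ {b c} → b ∧ c ≡ true → c ≡ true
  ∧-trueʳ {true} h = h

  #-∧-not : ∀ (Q P : A → Bool) xs → # (λ x → Q x ∧ P x) xs + # (λ x → Q x ∧ not (P x)) xs ≡ # Q xs
  #-∧-not Q P xs = trans (sym (∑-+ xs _ _)) (∑-cong xs (λ x → lemma (Q x) (P x)))
    where
    lemma : ∀ b c → ⟦ b ∧ c ⟧ + ⟦ b ∧ not c ⟧ ≡ ⟦ b ⟧
    lemma false _     = refl
    lemma true  true  = refl
    lemma true  false = refl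

  halves : ∀ k x y → k + k ≤ x + y → k ≤ x ⊎ k ≤ y
  halves k x y h with k ≤? x
  ... | yes p = inj₁ p
  ... | no ¬p with k ≤? y
  ... | yes q = inj₂ q
  ... | no ¬q = ⊥-elim (<⇒≱ (+-mono-< (≰⇒> ¬p) (≰⇒> ¬q)) h)

  -- Each predicate of `Ps` is settled by keeping one of its two classes, which costs a factor of
  -- two; `Q` accumulates the choices made so far.
  pigeonhole : ∀ (Ps : List (A → Bool)) (Q : A → Bool) xs k → k * 2 ^ length Ps ≤ # Q xs →
               Σ (Pick xs k) λ p → (∀ {x} → x ∈ chosen p → Q x ≡ true)
                                 × (∀ {P} → P ∈ Ps → Constant P (chosen p))
  pigeonhole [] Q xs k h with pick# Q xs k (subst (_≤ # Q xs) (*-identityʳ k) h)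
  ... | p , a = p , a , λ ()
  pigeonhole (P ∷ Ps) Q xs k h
    with halves (k * 2 ^ length Ps) (# (λ x → Q x ∧ P x) xs) (# (λ x → Q x ∧ not (P x)) xs)
           (subst₂ _≤_ (lemma k (2 ^ length Ps)) (sym (#-∧-not Q P xs)) h)
    where
    lemma : ∀ k t → k * (2 * t) ≡ k * t + k * t
    lemma = solve-∀
  ... | inj₁ h′ with pigeonhole Ps (λ x → Q x ∧ P x) xs k h′
  ... | p , a , c = p , (∧-trueˡ ∘ a) ,
    λ { (here refl) x∈ y∈ → trans (∧-trueʳ (a x∈)) (sym (∧-trueʳ (a y∈))) ; (there i) → c i }
  pigeonhole (P ∷ Ps) Q xs k h | inj₂ h′ with pigeonhole Ps (λ x → Q x ∧ not (P x)) xs k h′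
  ... | p , a , c = p , (∧-trueˡ ∘ a) ,
    λ { (here refl) x∈ y∈ → trans (lemma (∧-trueʳ (a x∈))) (sym (lemma (∧-trueʳ (a y∈)))) ; (there i) → c i }
    where
    lemma : ∀ {b} → not b ≡ true → b ≡ false
    lemma {false} _ = refl

  record Extract (xs : List A) (P : A → Set) : Set where
    constructor mkExtract
    field
      elem  : A
      prop  : P elem
      elem∈ : elem ∈ xs
      others : List A
      others⊆ : ∀ {x} → x ∈ others → x ∈ xs
      split : ∀ f → ∑ xs f ≡ f elem + ∑ others f

  extract : ∀ {P : A → Set} (xs : List A) → Any P xs → Extract xs P
  extract (x ∷ xs) (here p) = mkExtract x p (here refl) xs there (λ f → refl)
  extract (x ∷ xs) (there a) with extract xs a
  ... | mkExtract y p y∈ ys ys⊆ s = mkExtract y p (there y∈) (x ∷ ys)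
    (λ { (here e) → here e ; (there i) → there (ys⊆ i) })
    (λ f → trans (cong (f x +_) (s f)) (lemma (f x) (f y) (∑ ys f)))
    where
    lemma : ∀ a b c → a + (b + c) ≡ b + (a + c)
    lemma = solve-∀

  -- Otherwise summing `f x ≤ c * w x` contradicts the hypothesis. The weights make this an average
  -- over tiles of different sizes.
  ∑-avg : ∀ (xs : List A) (w f : A → ℕ) c → (c * ∑ xs w < ∑ xs f) →
          Any (λ x → c * w x < f x) xs
  ∑-avg []       w f c h = ⊥-elim (<⇒≱ h z≤n)
  ∑-avg (x ∷ xs) w f c h with c * w x <? f x
  ... | yes p = here p
  ... | no ¬p = there (∑-avg xs w f c
    (+-cancelˡ-< (f x) _ _ (≤-<-trans (+-monoˡ-≤ _ (≮⇒≥ ¬p))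
      (subst (_< f x + ∑ xs f) (*-distribˡ-+ c (w x) _) h))))

  ≤ᵇ-true : ∀ {x y} → x ≤ y → (x ≤ᵇ y) ≡ true
  ≤ᵇ-true h = Equivalence.to T-≡ (≤⇒≤ᵇ h)

  true-≤ : ∀ {x y} → (x ≤ᵇ y) ≡ true → x ≤ y
  true-≤ {x} h = ≤ᵇ⇒≤ x _ (Equivalence.from T-≡ h)

  ≤ᵇ-false : ∀ {x y} → (x ≤ᵇ y) ≡ false → y < x
  ≤ᵇ-false {x} {y} h with x ≤? y
  ... | yes p = case trans (sym (≤ᵇ-true p)) h of λ ()
  ... | no ¬p = ≰⇒> ¬p

  not-true : ∀ {c} → not c ≡ true → c ≡ false
  not-true {false} _ = refl

  module _ {A : Set} (μ : A → ℕ) where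

    maximal : ∀ (P : A → Bool) xs → # P xs ≡ 0 ⊎
              ∃ λ x → x ∈ xs × P x ≡ true × (∀ {y} → y ∈ xs → P y ≡ true → μ y ≤ μ x)
    maximal P [] = inj₁ refl
    maximal P (x ∷ xs) with P x in eq | maximal P xs
    ... | false | inj₁ none = inj₁ none
    ... | false | inj₂ (z , z∈ , Pz , z-max) = inj₂ (z , there z∈ , Pz ,
      λ { (here refl) Py → case trans (sym eq) Py of λ () ; (there y∈) Py → z-max y∈ Py })
    ... | true | inj₁ none = inj₂ (x , here refl , eq ,
      λ { (here refl) _ → ≤-refl
        ; (there y∈) Py → ⊥-elim (<⇒≱ (subst (λ c → 0 < ⟦ c ⟧) (sym Py) (s≤s z≤n)) (≤-trans (∑-≥-∈ (λ x → ⟦ P x ⟧) y∈) (≤-reflexive none))) })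
    ... | true | inj₂ (z , z∈ , Pz , z-max) with ≤-total (μ x) (μ z)
    ... | inj₁ x≤z = inj₂ (z , there z∈ , Pz , λ { (here refl) _ → x≤z ; (there y∈) Py → z-max y∈ Py })
    ... | inj₂ z≤x = inj₂ (x , here refl , eq , λ { (here refl) _ → ≤-refl ; (there y∈) Py → ≤-trans (z-max y∈ Py) z≤x })

  ≡true : ∀ {A : Set} (d : Dec A) → does d ≡ true → A
  ≡true (yes x) _ = x

  #-atMostOne : ∀ {A : Set} (P : A → Bool) {xs} → Unique xs → (∀ {x y} → P x ≡ true → P y ≡ true → x ≡ y) → # P xs ≤ 1
  #-atMostOne P [] h = z≤n
  #-atMostOne P {x ∷ xs} (x∉ ∷ u) h with P x in eq
  ... | false = #-atMostOne P u h
  ... | true  = s≤s (≤-reflexive (trans (∑-cong-∈ xs none) (trans (∑-const xs 0) (*-zeroʳ (length xs)))))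
    where
    none : ∀ {y} → y ∈ xs → ⟦ P y ⟧ ≡ 0
    none {y} y∈ with P y in eq′
    ... | false = refl
    ... | true  = ⊥-elim (All.lookup x∉ y∈ (h eq eq′))

  -- Every entry removes one occurrence of its image from `ys`; uniqueness and injectivity keep the
  -- images of the later entries in what is left.
  ∑-injective : ∀ {A B : Set} (f : A → B) → (∀ {x y} → f x ≡ f y → x ≡ y) → ∀ {xs} → Unique xs →
                ∀ ys → (∀ {x} → x ∈ xs → f x ∈ ys) → ∀ F → ∑ xs (F ∘ f) ≤ ∑ ys F
  ∑-injective f inj {[]}     _        ys f∈ F = z≤n
  ∑-injective f inj {x ∷ xs} (x∉ ∷ u) ys f∈ F with ∈-∃++ (f∈ (here refl))
  ... | ys₁ , ys₂ , refl = begin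
    F (f x) + ∑ xs (F ∘ f)        ≤⟨ +-monoʳ-≤ (F (f x)) (∑-injective f inj u (ys₁ ++ ys₂) others F) ⟩
    F (f x) + ∑ (ys₁ ++ ys₂) F    ≡⟨ cong (F (f x) +_) (∑-++ ys₁ ys₂ F) ⟩
    F (f x) + (∑ ys₁ F + ∑ ys₂ F) ≡⟨ lemma (F (f x)) (∑ ys₁ F) (∑ ys₂ F) ⟩
    ∑ ys₁ F + (F (f x) + ∑ ys₂ F) ≡⟨ ∑-++ ys₁ (f x ∷ ys₂) F ⟨
    ∑ (ys₁ ++ f x ∷ ys₂) F        ∎
    where
    open ≤-Reasoning
    lemma : ∀ a b c → a + (b + c) ≡ b + (a + c)
    lemma = solve-∀
    others : ∀ {y} → y ∈ xs → f y ∈ ys₁ ++ ys₂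
    others {y} y∈ with ∈-++⁻ ys₁ (f∈ (there y∈))
    ... | inj₁ p = ∈-++⁺ˡ p
    ... | inj₂ (here e) = ⊥-elim (All.lookup x∉ y∈ (sym (inj e)))
    ... | inj₂ (there p) = ∈-++⁺ʳ ys₁ p

  ∑-lookup : ∀ {A : Set} (xs : List A) F → ∑ (allFin (length xs)) (F ∘ lookup xs) ≡ ∑ xs F
  ∑-lookup []       F = refl
  ∑-lookup (x ∷ xs) F = trans (∑-allFin-suc (length xs) (F ∘ lookup (x ∷ xs))) (cong (F x +_) (∑-lookup xs F))

  ∑-filter-length : ∀ {A : Set} {P : A → Set} (P? : ∀ x → Dec (P x)) xs → length (filter P? xs) ≡ # (does ∘ P?) xs
  ∑-filter-length P? []       = refl
  ∑-filter-length P? (x ∷ xs) with P? x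
  ... | yes _ = cong suc (∑-filter-length P? xs)
  ... | no  _ = ∑-filter-length P? xs

-- Linear and polynomial inequalities behind the counting arguments

module Arith where

  -- The inequality X ≤ Y follows linearly from P ≤ Q with certificate R.
  byIdentity : ∀ {P Q X Y} R → P ≤ Q → Y + P ≡ X + Q + R → X ≤ Y
  byIdentity {P} {Q} {X} {Y} R P≤Q e = +-cancelʳ-≤ P X Y (begin
    X + P     ≤⟨ +-monoʳ-≤ X P≤Q ⟩
    X + Q     ≤⟨ m≤m+n (X + Q) R ⟩
    X + Q + R ≡⟨ e ⟨
    Y + P     ∎)
    where open ≤-Reasoning

  infixl 6 _⊕_
  infixr 7 _⊙_

  _⊕_ : ∀ {w x y z} → w ≤ x → y ≤ z → w + y ≤ x + z
  _⊕_ = +-mono-≤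

  _⊙_ : ∀ c {x y} → x ≤ y → c * x ≤ c * y
  _⊙_ = *-monoʳ-≤

  bound-full-arith : ∀ a b p e t S g →
    e * S + e * (b * t) ≤ e * ((1 + p) * (b * t)) + b * t →
    g ≤ a * t →
    e * (b * (g + S)) ≤ e * (p * b) * (b * t) + e * a * (b * t) + 2 * (b * ((a + (1 + p) * b) * t))
  bound-full-arith a b p e t S g h1 h2 =
    byIdentity (2 * a * b * t + 2 * b * b * p * t + b * b * t)
      (b ⊙ h1 ⊕ (b * e) ⊙ h2)
      (identity a b p e t S g)
    where
    identity : ∀ a b p e t S g →
      e * (p * b) * (b * t) + e * a * (b * t) + 2 * (b * ((a + (1 + p) * b) * t)) + (b * (e * S + e * (b * t)) + (b * e) * g)
      ≡ e * (b * (g + S)) + (b * (e * ((1 + p) * (b * t)) + b * t) + (b * e) * (a * t))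
        + (2 * a * b * t + 2 * b * b * p * t + b * b * t)
    identity = solve-∀

  bound-two-arith : ∀ a b p e t S g g0 B →
    e * S + e * (b * t) ≤ e * (p * (b * t)) + b * t →
    e * g0 ≤ b * t →
    g ≤ a * t →
    a ≤ b →
    e * (b * (g + (g0 + S))) ≤ e * (p * b) * (b * t) + e * a * B + 2 * (b * ((a + (1 + p) * b) * t))
  bound-two-arith a b p e t S g g0 B h1 h2 h3 h4 =
    byIdentity (B * a * e + 2 * a * b * t + 2 * b * b * p * t)
      (b ⊙ h1 ⊕ b ⊙ h2 ⊕ (b * e) ⊙ h3 ⊕ (e * t * b) ⊙ h4)
      (identity a b p e t S g g0 B)
    where
    identity : ∀ a b p e t S g g0 B →
      e * (p * b) * (b * t) + e * a * B + 2 * (b * ((a + (1 + p) * b) * t)) + (b * (e * S + e * (b * t)) + b * (e * g0) + (b * e) * g + (e * t * b) * a)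
      ≡ e * (b * (g + (g0 + S))) + (b * (e * (p * (b * t)) + b * t) + b * (b * t) + (b * e) * (a * t) + (e * t * b) * b)
        + (B * a * e + 2 * a * b * t + 2 * b * b * p * t)
    identity = solve-∀

  bound-neck-arith : ∀ a b p e t S g B →
    e * S + e * (b * t) ≤ e * ((1 + p) * (b * t)) + b * t →
    e * g ≤ a * t →
    e * (b * (g + S)) ≤ e * (p * b) * (b * t) + e * a * B + 2 * (b * ((a + (1 + p) * b) * t))
  bound-neck-arith a b p e t S g B h1 h2 =
    byIdentity (B * a * e + a * b * t + 2 * b * b * p * t + b * b * t)
      (b ⊙ h1 ⊕ b ⊙ h2)
      (identity a b p e t S g B)
    where
    identity : ∀ a b p e t S g B →
      e * (p * b) * (b * t) + e * a * B + 2 * (b * ((a + (1 + p) * b) * t)) + (b * (e * S + e * (b * t)) + b * (e * g))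
      ≡ e * (b * (g + S)) + (b * (e * ((1 + p) * (b * t)) + b * t) + b * (a * t))
        + (B * a * e + a * b * t + 2 * b * b * p * t + b * b * t)
    identity = solve-∀

  bound-low-arith : ∀ a b p e t S g H L B →
    e * S + e * (b * t) ≤ e * ((1 + p) * (b * t)) + b * t →
    g ≤ a * t →
    e * H ≤ b * t →
    b * t ≤ H + L →
    L ≤ B →
    e * (b * (g + S)) ≤ e * (p * b) * (b * t) + e * a * B + 2 * (b * ((a + (1 + p) * b) * t))
  bound-low-arith a b p e t S g H L B h1 h2 h3 h4 h5 =
    byIdentity (a * b * t + 2 * b * b * p * t + b * b * t)
      (b ⊙ h1 ⊕ (b * e) ⊙ h2 ⊕ a ⊙ h3 ⊕ (a * e) ⊙ h4 ⊕ (a * e) ⊙ h5)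
      (identity a b p e t S g H L B)
    where
    identity : ∀ a b p e t S g H L B →
      e * (p * b) * (b * t) + e * a * B + 2 * (b * ((a + (1 + p) * b) * t)) + (b * (e * S + e * (b * t)) + (b * e) * g + a * (e * H) + (a * e) * (b * t) + (a * e) * L)
      ≡ e * (b * (g + S)) + (b * (e * ((1 + p) * (b * t)) + b * t) + (b * e) * (a * t) + a * (b * t)
        + (a * e) * (H + L) + (a * e) * B)
        + (a * b * t + 2 * b * b * p * t + b * b * t)
    identity = solve-∀

  -- In units of `n / E`, after division by the common factors: `T ≤ n` turns the error
  -- `2 * T / (8 * E)` into a quarter, the bounds on `u` and `f` cost an eighth each, and the error
  -- in the hypothesis on `Z` and `M`, multiplied by `a / (b * m) ≤ 1` with `m = a + (1 + p) * b`,
  -- costs another quarter.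
  stuck-arith : ∀ a b p E n T l μ d d2 D f u Z M →
    E * (p * b * (b * n) + a * μ) + (a + (1 + p) * b) * (b * n) ≤ E * ((a + (1 + p) * b) * (b * d)) →
    d ≤ d2 + D →
    (8 * E) * (b * ((a + (1 + p) * b) * D)) ≤ (8 * E) * (p * b) * (b * T) + (8 * E) * a * ((a + (1 + p) * b) * Z) + 2 * (b * ((a + (1 + p) * b) * T)) + (8 * E) * (b * ((a + (1 + p) * b) * (u + f))) →
    (4 * E) * ((a + (1 + p) * b) * Z + M) ≤ (4 * E) * μ + n →
    T + l ≤ n →
    T + l ≤ n →
    (8 * E) * u ≤ n →
    (8 * E) * f ≤ n →
    1 ≤ b →
    2 * ((4 * E) * (p * b * (b * l) + a * M) + (a + (1 + p) * b) * (b * n)) ≤ 2 * ((4 * E) * ((a + (1 + p) * b) * (b * d2)))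
  stuck-arith a b p E n T l μ d d2 D f u Z M h1 h2 h3 h4 h5 h6 h7 h8 h9 =
    byIdentity (2 * a * b * l + 2 * b * b * l + 2 * b * b * l * p + 2 * b * b * n + 2 * b * b * n * p)
      (8 ⊙ h1 ⊕ (8 * E * (a + (1 + p) * b) * b) ⊙ h2 ⊕ h3 ⊕ (2 * a) ⊙ h4
       ⊕ (8 * E * p * b * b) ⊙ h5 ⊕ (2 * b * (a + (1 + p) * b)) ⊙ h6
       ⊕ (b * (a + (1 + p) * b)) ⊙ h7 ⊕ (b * (a + (1 + p) * b)) ⊙ h8 ⊕ (2 * n * a) ⊙ h9)
      (identity a b p E n T l μ d d2 D f u Z M)
    where
    identity : ∀ a b p E n T l μ d d2 D f u Z M →
      2 * ((4 * E) * ((a + (1 + p) * b) * (b * d2))) + (8 * (E * (p * b * (b * n) + a * μ) + (a + (1 + p) * b) * (b * n))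
        + (8 * E * (a + (1 + p) * b) * b) * d + ((8 * E) * (b * ((a + (1 + p) * b) * D)))
        + (2 * a) * ((4 * E) * ((a + (1 + p) * b) * Z + M)) + (8 * E * p * b * b) * (T + l)
        + (2 * b * (a + (1 + p) * b)) * (T + l) + (b * (a + (1 + p) * b)) * ((8 * E) * u)
        + (b * (a + (1 + p) * b)) * ((8 * E) * f) + (2 * n * a) * 1)
      ≡ 2 * ((4 * E) * (p * b * (b * l) + a * M) + (a + (1 + p) * b) * (b * n)) + (8 * (E * ((a + (1 + p) * b) * (b * d))) + (8 * E * (a + (1 + p) * b) * b) * (d2 + D)
        + ((8 * E) * (p * b) * (b * T) + (8 * E) * a * ((a + (1 + p) * b) * Z) + 2 * (b * ((a + (1 + p) * b) * T)) + (8 * E) * (b * ((a + (1 + p) * b) * (u + f))))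
        + (2 * a) * ((4 * E) * μ + n) + (8 * E * p * b * b) * n + (2 * b * (a + (1 + p) * b)) * n
        + (b * (a + (1 + p) * b)) * n + (b * (a + (1 + p) * b)) * n + (2 * n * a) * b)
        + (2 * a * b * l + 2 * b * b * l + 2 * b * b * l * p + 2 * b * b * n + 2 * b * b * n * p)
    identity = solve-∀

  sparse-arith : ∀ a b p E τ l S d →
    (8 * E) * S + (8 * E) * τ * d ≤ (8 * E) * τ * l + τ * d →
    τ * ((4 * E) * ((a + p * b) * l) + (a + (1 + p) * b) * l) ≤ (4 * E) * ((a + (1 + p) * b) * S) →
    d ≤ l →
    (32 * E * E * τ) * ((a + (1 + p) * b) * d) ≤ (32 * E * E * τ) * (b * l)
  sparse-arith a b p E τ l S d h1 h2 h3 =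
    byIdentity (4 * E * a * l * τ + 4 * E * b * l * p * τ + 4 * E * b * l * τ)
      (((4 * E) * (a + (1 + p) * b)) ⊙ h1 ⊕ (8 * E) ⊙ h2 ⊕ (4 * E * (a + (1 + p) * b) * τ) ⊙ h3)
      (identity a b p E τ l S d)
    where
    identity : ∀ a b p E τ l S d →
      (32 * E * E * τ) * (b * l) + (((4 * E) * (a + (1 + p) * b)) * ((8 * E) * S + (8 * E) * τ * d)
        + (8 * E) * (τ * ((4 * E) * ((a + p * b) * l) + (a + (1 + p) * b) * l))
        + (4 * E * (a + (1 + p) * b) * τ) * d)
      ≡ (32 * E * E * τ) * ((a + (1 + p) * b) * d) + (((4 * E) * (a + (1 + p) * b)) * ((8 * E) * τ * l + τ * d)
        + (8 * E) * ((4 * E) * ((a + (1 + p) * b) * S)) + (4 * E * (a + (1 + p) * b) * τ) * l)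
        + (4 * E * a * l * τ + 4 * E * b * l * p * τ + 4 * E * b * l * τ)
    identity = solve-∀

  candidates-arith : ∀ m i b a l t c C W r →
    2 * (m * t) + 2 * (i * (b * l)) + a * l ≤ 2 * (m * l) →
    l ≤ C + (t + c) →
    m * c ≤ i * (b * l) →
    2 * (m * (W + r)) ≤ a * l →
    2 * (m * (W + r)) ≤ 2 * (m * C)
  candidates-arith m i b a l t c C W r h1 h2 h3 h4 =
    byIdentity (0)
      (h1 ⊕ (2 * m) ⊙ h2 ⊕ 2 ⊙ h3 ⊕ h4)
      (identity m i b a l t c C W r)
    where
    identity : ∀ m i b a l t c C W r →
      2 * (m * C) + ((2 * (m * t) + 2 * (i * (b * l)) + a * l) + (2 * m) * l + 2 * (m * c)
        + (2 * (m * (W + r))))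
      ≡ 2 * (m * (W + r)) + ((2 * (m * l)) + (2 * m) * (C + (t + c)) + 2 * (i * (b * l)) + (a * l))
        + (0)
    identity = solve-∀

  -- The potential drops by at least `n * c * t`, while the used weight rises by at most
  -- `(M0 + c) * t`. As `1 ≤ c ≤ d`, the factor `1 + M0 + d` makes the drop outweigh `n` times the
  -- rise.
  progress-arith : ∀ A Z R n c t d M0 u v →
    Z + n * (c * t) ≤ A →
    v ≤ u + (M0 * t + c * t) →
    1 ≤ c →
    1 ≤ c →
    c ≤ d →
    1 ≤ n * t →
    1 + ((1 + M0 + d) * (Z + R) + n * v) ≤ (1 + M0 + d) * (A + R) + n * u
  progress-arith A Z R n c t d M0 u v h1 h2 h3 h4 h5 h6 =
    byIdentity (0)
      ((1 + M0 + d) ⊙ h1 ⊕ n ⊙ h2 ⊕ (n * t * (M0 + d)) ⊙ h3 ⊕ (n * t) ⊙ h4 ⊕ (n * t) ⊙ h5 ⊕ h6)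
      (identity A Z R n c t d M0 u v)
    where
    identity : ∀ A Z R n c t d M0 u v →
      (1 + M0 + d) * (A + R) + n * u + ((1 + M0 + d) * (Z + n * (c * t)) + n * v + (n * t * (M0 + d)) * 1 + (n * t) * 1
        + (n * t) * c + 1)
      ≡ 1 + ((1 + M0 + d) * (Z + R) + n * v) + ((1 + M0 + d) * A + n * (u + (M0 * t + c * t)) + (n * t * (M0 + d)) * c + (n * t) * c
        + (n * t) * d + (n * t))
        + (0)
    identity = solve-∀

  good-degree-arith : ∀ a b p E n l d M →
    (4 * E) * (p * b * (b * l) + a * M) + (a + (1 + p) * b) * (b * n) ≤ (4 * E) * ((a + (1 + p) * b) * (b * d)) →
    b * l ≤ M →
    l ≤ n →
    b * ((4 * E) * ((a + p * b) * l) + (a + (1 + p) * b) * l) ≤ b * ((4 * E) * ((a + (1 + p) * b) * d))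
  good-degree-arith a b p E n l d M h1 h2 h3 =
    byIdentity (0)
      (h1 ⊕ (4 * E * a) ⊙ h2 ⊕ ((a + (1 + p) * b) * b) ⊙ h3)
      (identity a b p E n l d M)
    where
    identity : ∀ a b p E n l d M →
      b * ((4 * E) * ((a + (1 + p) * b) * d)) + (((4 * E) * (p * b * (b * l) + a * M) + (a + (1 + p) * b) * (b * n))
        + (4 * E * a) * (b * l) + ((a + (1 + p) * b) * b) * l)
      ≡ b * ((4 * E) * ((a + p * b) * l) + (a + (1 + p) * b) * l) + (((4 * E) * ((a + (1 + p) * b) * (b * d))) + (4 * E * a) * M
        + ((a + (1 + p) * b) * b) * n)
        + (0)
    identity = solve-∀

  few-bad-arith : ∀ m b a l x y z →
    z ≤ x + y →
    2 * (m * x) ≤ a * l →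
    m * y ≤ b * l →
    2 * (m * z) ≤ 2 * (b * l) + a * l
  few-bad-arith m b a l x y z h1 h2 h3 =
    byIdentity (0)
      ((2 * m) ⊙ h1 ⊕ h2 ⊕ 2 ⊙ h3)
      (identity m b a l x y z)
    where
    identity : ∀ m b a l x y z →
      2 * (b * l) + a * l + ((2 * m) * z + (2 * (m * x)) + 2 * (m * y))
      ≡ 2 * (m * z) + ((2 * m) * (x + y) + (a * l) + 2 * (b * l))
        + (0)
    identity = solve-∀

  need-arith : ∀ a m E K n l x c r →
    K * (16 * m * E * r) ≤ n →
    n ≤ K * l →
    l ≤ a * l →
    a * l ≤ 2 * (m * x) →
    x ≤ (8 * E) * c →
    K * (16 * m * E * r) ≤ K * (16 * m * E * c)
  need-arith a m E K n l x c r h1 h2 h3 h4 h5 =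
    byIdentity (0)
      (h1 ⊕ h2 ⊕ K ⊙ h3 ⊕ K ⊙ h4 ⊕ (2 * m * K) ⊙ h5)
      (identity a m E K n l x c r)
    where
    identity : ∀ a m E K n l x c r →
      K * (16 * m * E * c) + ((K * (16 * m * E * r)) + n + K * l + K * (a * l) + (2 * m * K) * x)
      ≡ K * (16 * m * E * r) + (n + (K * l) + K * (a * l) + K * (2 * (m * x)) + (2 * m * K) * ((8 * E) * c))
        + (0)
    identity = solve-∀

  -- The slack falls from `n / E0` to `n / (4 * E0)`. Half of the old slack absorbs the rounding
  -- term `a0 / b0 ≤ 1`, since `2 * E0 ≤ n`; a further quarter absorbs the growth of `b / m` over
  -- `b0 / m0`, which is `a0 / (m * m0)` and gets multiplied by `p`. Here `m` and `m0` are the total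
  -- sizes of the new and old bottle.
  perturb-arith : ∀ a0 b0 p E0 n d μ c →
    E0 * (p * b0 * (b0 * n) + a0 * c) + (a0 + (1 + p) * b0) * (b0 * n) ≤ E0 * ((a0 + (1 + p) * b0) * (b0 * d)) + E0 * (a0 * (a0 + (1 + p) * b0)) →
    (a0 + (1 + p) * b0) * b0 * ((4 * E0 * a0) * μ) ≤ ((4 * E0 * a0) + (1 + p) * (1 + 4 * E0 * b0)) * (1 + 4 * E0 * b0) * (a0 * c) →
    1 ≤ b0 →
    2 * E0 ≤ n →
    a0 ≤ b0 →
    ((a0 + (1 + p) * b0) * b0) * ((4 * E0) * (p * (1 + 4 * E0 * b0) * ((1 + 4 * E0 * b0) * n) + (4 * E0 * a0) * μ) + ((4 * E0 * a0) + (1 + p) * (1 + 4 * E0 * b0)) * ((1 + 4 * E0 * b0) * n)) ≤ ((a0 + (1 + p) * b0) * b0) * ((4 * E0) * (((4 * E0 * a0) + (1 + p) * (1 + 4 * E0 * b0)) * ((1 + 4 * E0 * b0) * d)))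
  perturb-arith a0 b0 p E0 n d μ c h1 h2 h3 h4 h5 =
    byIdentity (16 * E0 * E0 * a0 * a0 * b0 * b0 * n + 32 * E0 * E0 * a0 * b0 * b0 * b0 * n
      + 16 * E0 * E0 * a0 * b0 * b0 * b0 * n * p + 16 * E0 * E0 * b0 * b0 * b0 * b0 * n
      + 32 * E0 * E0 * b0 * b0 * b0 * b0 * n * p + 16 * E0 * E0 * b0 * b0 * b0 * b0 * n * p * p
      + 4 * E0 * a0 * a0 * b0 * n + 12 * E0 * a0 * b0 * b0 * n + 8 * E0 * a0 * b0 * b0 * n * p
      + 8 * E0 * b0 * b0 * b0 * n + 16 * E0 * b0 * b0 * b0 * n * p
      + 8 * E0 * b0 * b0 * b0 * n * p * p + a0 * b0 * n + a0 * b0 * n * p + b0 * b0 * n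
      + 2 * b0 * b0 * n * p + b0 * b0 * n * p * p)
      ((4 * ((4 * E0 * a0) + (1 + p) * (1 + 4 * E0 * b0)) * (1 + 4 * E0 * b0)) ⊙ h1
       ⊕ (4 * E0) ⊙ h2 ⊕ (4 * E0 * (1 + 4 * E0 * b0) * b0 * n * a0 * p) ⊙ h3
       ⊕ (2 * ((4 * E0 * a0) + (1 + p) * (1 + 4 * E0 * b0)) * (1 + 4 * E0 * b0) * (a0 + (1 + p) * b0) * a0) ⊙ h4
       ⊕ (2 * ((4 * E0 * a0) + (1 + p) * (1 + 4 * E0 * b0)) * (1 + 4 * E0 * b0) * (a0 + (1 + p) * b0) * n) ⊙ h5)
      (identity a0 b0 p E0 n d μ c)
    where
    identity : ∀ a0 b0 p E0 n d μ c →
      ((a0 + (1 + p) * b0) * b0) * ((4 * E0) * (((4 * E0 * a0) + (1 + p) * (1 + 4 * E0 * b0)) * ((1 + 4 * E0 * b0) * d))) + ((4 * ((4 * E0 * a0) + (1 + p) * (1 + 4 * E0 * b0)) * (1 + 4 * E0 * b0)) * (E0 * (p * b0 * (b0 * n) + a0 * c) + (a0 + (1 + p) * b0) * (b0 * n))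
        + (4 * E0) * ((a0 + (1 + p) * b0) * b0 * ((4 * E0 * a0) * μ))
        + (4 * E0 * (1 + 4 * E0 * b0) * b0 * n * a0 * p) * 1
        + (2 * ((4 * E0 * a0) + (1 + p) * (1 + 4 * E0 * b0)) * (1 + 4 * E0 * b0) * (a0 + (1 + p) * b0) * a0) * (2 * E0)
        + (2 * ((4 * E0 * a0) + (1 + p) * (1 + 4 * E0 * b0)) * (1 + 4 * E0 * b0) * (a0 + (1 + p) * b0) * n) * a0)
      ≡ ((a0 + (1 + p) * b0) * b0) * ((4 * E0) * (p * (1 + 4 * E0 * b0) * ((1 + 4 * E0 * b0) * n) + (4 * E0 * a0) * μ) + ((4 * E0 * a0) + (1 + p) * (1 + 4 * E0 * b0)) * ((1 + 4 * E0 * b0) * n)) + ((4 * ((4 * E0 * a0) + (1 + p) * (1 + 4 * E0 * b0)) * (1 + 4 * E0 * b0)) * (E0 * ((a0 + (1 + p) * b0) * (b0 * d)) + E0 * (a0 * (a0 + (1 + p) * b0)))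
        + (4 * E0) * (((4 * E0 * a0) + (1 + p) * (1 + 4 * E0 * b0)) * (1 + 4 * E0 * b0) * (a0 * c))
        + (4 * E0 * (1 + 4 * E0 * b0) * b0 * n * a0 * p) * b0
        + (2 * ((4 * E0 * a0) + (1 + p) * (1 + 4 * E0 * b0)) * (1 + 4 * E0 * b0) * (a0 + (1 + p) * b0) * a0) * n
        + (2 * ((4 * E0 * a0) + (1 + p) * (1 + 4 * E0 * b0)) * (1 + 4 * E0 * b0) * (a0 + (1 + p) * b0) * n) * b0)
        + (16 * E0 * E0 * a0 * a0 * b0 * b0 * n + 32 * E0 * E0 * a0 * b0 * b0 * b0 * n
          + 16 * E0 * E0 * a0 * b0 * b0 * b0 * n * p + 16 * E0 * E0 * b0 * b0 * b0 * b0 * n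
          + 32 * E0 * E0 * b0 * b0 * b0 * b0 * n * p
          + 16 * E0 * E0 * b0 * b0 * b0 * b0 * n * p * p + 4 * E0 * a0 * a0 * b0 * n
          + 12 * E0 * a0 * b0 * b0 * n + 8 * E0 * a0 * b0 * b0 * n * p + 8 * E0 * b0 * b0 * b0 * n
          + 16 * E0 * b0 * b0 * b0 * n * p + 8 * E0 * b0 * b0 * b0 * n * p * p + a0 * b0 * n
          + a0 * b0 * n * p + b0 * b0 * n + 2 * b0 * b0 * n * p + b0 * b0 * n * p * p)
    identity = solve-∀

  cap-linear-arith : ∀ a0 b0 p E0 i μ →
    μ ≤ ((4 * E0 * a0) + (1 + p) * (1 + 4 * E0 * b0)) * i →
    (a0 + (1 + p) * b0) * b0 * ((4 * E0 * a0) * μ) ≤ ((4 * E0 * a0) + (1 + p) * (1 + 4 * E0 * b0)) * (1 + 4 * E0 * b0) * (a0 * ((a0 + (1 + p) * b0) * i))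
  cap-linear-arith a0 b0 p E0 i μ h1 =
    byIdentity (4 * E0 * a0 * a0 * a0 * i + 8 * E0 * a0 * a0 * b0 * i + 8 * E0 * a0 * a0 * b0 * i * p
      + 4 * E0 * a0 * b0 * b0 * i + 8 * E0 * a0 * b0 * b0 * i * p
      + 4 * E0 * a0 * b0 * b0 * i * p * p + a0 * a0 * i + a0 * a0 * i * p + a0 * b0 * i
      + 2 * a0 * b0 * i * p + a0 * b0 * i * p * p)
      (((a0 + (1 + p) * b0) * b0 * (4 * E0 * a0)) ⊙ h1)
      (identity a0 b0 p E0 i μ)
    where
    identity : ∀ a0 b0 p E0 i μ →
      ((4 * E0 * a0) + (1 + p) * (1 + 4 * E0 * b0)) * (1 + 4 * E0 * b0) * (a0 * ((a0 + (1 + p) * b0) * i)) + (((a0 + (1 + p) * b0) * b0 * (4 * E0 * a0)) * μ)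
      ≡ (a0 + (1 + p) * b0) * b0 * ((4 * E0 * a0) * μ) + (((a0 + (1 + p) * b0) * b0 * (4 * E0 * a0)) * (((4 * E0 * a0) + (1 + p) * (1 + 4 * E0 * b0)) * i))
        + (4 * E0 * a0 * a0 * a0 * i + 8 * E0 * a0 * a0 * b0 * i + 8 * E0 * a0 * a0 * b0 * i * p
          + 4 * E0 * a0 * b0 * b0 * i + 8 * E0 * a0 * b0 * b0 * i * p
          + 4 * E0 * a0 * b0 * b0 * i * p * p + a0 * a0 * i + a0 * a0 * i * p + a0 * b0 * i
          + 2 * a0 * b0 * i * p + a0 * b0 * i * p * p)
    identity = solve-∀

  cap-constant-arith : ∀ a0 b0 p E0 n μ →
    μ ≤ (1 + 4 * E0 * b0) * n →
    (a0 + (1 + p) * b0) * b0 * ((4 * E0 * a0) * μ) ≤ ((4 * E0 * a0) + (1 + p) * (1 + 4 * E0 * b0)) * (1 + 4 * E0 * b0) * (a0 * (b0 * n))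
  cap-constant-arith a0 b0 p E0 n μ h1 =
    byIdentity (4 * E0 * a0 * b0 * b0 * n + 4 * E0 * a0 * b0 * b0 * n * p + a0 * b0 * n + a0 * b0 * n * p)
      (((a0 + (1 + p) * b0) * b0 * (4 * E0 * a0)) ⊙ h1)
      (identity a0 b0 p E0 n μ)
    where
    identity : ∀ a0 b0 p E0 n μ →
      ((4 * E0 * a0) + (1 + p) * (1 + 4 * E0 * b0)) * (1 + 4 * E0 * b0) * (a0 * (b0 * n)) + (((a0 + (1 + p) * b0) * b0 * (4 * E0 * a0)) * μ)
      ≡ (a0 + (1 + p) * b0) * b0 * ((4 * E0 * a0) * μ) + (((a0 + (1 + p) * b0) * b0 * (4 * E0 * a0)) * ((1 + 4 * E0 * b0) * n))
        + (4 * E0 * a0 * b0 * b0 * n + 4 * E0 * a0 * b0 * b0 * n * p + a0 * b0 * n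
          + a0 * b0 * n * p)
    identity = solve-∀

  clear-arith : ∀ a0 b0 p E0 n i d →
    E0 * ((a0 + (1 + p) * b0) * (b0 * n)) + E0 * ((a0 + (1 + p) * b0) * (a0 * i)) + (a0 + (1 + p) * b0) * (b0 * n) ≤ E0 * ((a0 + (1 + p) * b0) * (b0 * d)) + E0 * (b0 * ((b0 + a0) * n)) →
    E0 * (p * b0 * (b0 * n) + a0 * ((a0 + (1 + p) * b0) * i)) + (a0 + (1 + p) * b0) * (b0 * n) ≤ E0 * ((a0 + (1 + p) * b0) * (b0 * d))
  clear-arith a0 b0 p E0 n i d h1 =
    byIdentity (0)
      (h1)
      (identity a0 b0 p E0 n i d)
    where
    identity : ∀ a0 b0 p E0 n i d →
      E0 * ((a0 + (1 + p) * b0) * (b0 * d)) + (E0 * ((a0 + (1 + p) * b0) * (b0 * n)) + E0 * ((a0 + (1 + p) * b0) * (a0 * i)) + (a0 + (1 + p) * b0) * (b0 * n))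
      ≡ E0 * (p * b0 * (b0 * n) + a0 * ((a0 + (1 + p) * b0) * i)) + (a0 + (1 + p) * b0) * (b0 * n) + ((E0 * ((a0 + (1 + p) * b0) * (b0 * d)) + E0 * (b0 * ((b0 + a0) * n))))
        + (0)
    identity = solve-∀

  degree-linear-arith : ∀ a0 b0 p E0 n i d c →
    E0 * (p * b0 * (b0 * n) + a0 * ((a0 + (1 + p) * b0) * i)) + (a0 + (1 + p) * b0) * (b0 * n) ≤ E0 * ((a0 + (1 + p) * b0) * (b0 * d)) →
    c ≤ (a0 + (1 + p) * b0) * i + (a0 + (1 + p) * b0) →
    E0 * (p * b0 * (b0 * n) + a0 * c) + (a0 + (1 + p) * b0) * (b0 * n) ≤ E0 * ((a0 + (1 + p) * b0) * (b0 * d)) + E0 * (a0 * (a0 + (1 + p) * b0))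
  degree-linear-arith a0 b0 p E0 n i d c h1 h2 =
    byIdentity (0)
      (h1 ⊕ (E0 * a0) ⊙ h2)
      (identity a0 b0 p E0 n i d c)
    where
    identity : ∀ a0 b0 p E0 n i d c →
      E0 * ((a0 + (1 + p) * b0) * (b0 * d)) + E0 * (a0 * (a0 + (1 + p) * b0)) + ((E0 * (p * b0 * (b0 * n) + a0 * ((a0 + (1 + p) * b0) * i)) + (a0 + (1 + p) * b0) * (b0 * n))
        + (E0 * a0) * c)
      ≡ E0 * (p * b0 * (b0 * n) + a0 * c) + (a0 + (1 + p) * b0) * (b0 * n) + ((E0 * ((a0 + (1 + p) * b0) * (b0 * d)))
        + (E0 * a0) * ((a0 + (1 + p) * b0) * i + (a0 + (1 + p) * b0)))
        + (0)
    identity = solve-∀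

  -- Each unit of scale wastes one vertex in each of the `1 + p` bodies. A body has more than
  -- `4 * E0 * b0` vertices per unit, so at most `n / (4 * E0)` vertices are wasted; the uncovered
  -- set adds at most `n / (2 * E0)`.
  leftover-arith : ∀ a0 b0 p E0 n U T l →
    U + 4 * E0 * (a0 + (1 + p) * b0) * T ≤ n →
    n ≤ ((4 * E0 * a0) + (1 + p) * (1 + 4 * E0 * b0)) * T + l →
    2 * E0 * l ≤ n →
    ((4 * E0 * a0) + (1 + p) * (1 + 4 * E0 * b0)) * T + l ≤ n →
    1 ≤ b0 →
    2 * (E0 * U) ≤ 2 * n
  leftover-arith a0 b0 p E0 n U T l h1 h2 h3 h4 h5 =
    byIdentity (4 * E0 * T * a0 + 2 * E0 * T * b0 + 2 * E0 * T * b0 * p + T + T * p + l)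
      ((2 * E0) ⊙ h1 ⊕ (2 * E0) ⊙ h2 ⊕ h3 ⊕ h4 ⊕ (2 * E0 * (1 + p) * T) ⊙ h5)
      (identity a0 b0 p E0 n U T l)
    where
    identity : ∀ a0 b0 p E0 n U T l →
      2 * n + ((2 * E0) * (U + 4 * E0 * (a0 + (1 + p) * b0) * T) + (2 * E0) * n + (2 * E0 * l)
        + (((4 * E0 * a0) + (1 + p) * (1 + 4 * E0 * b0)) * T + l) + (2 * E0 * (1 + p) * T) * 1)
      ≡ 2 * (E0 * U) + ((2 * E0) * n + (2 * E0) * (((4 * E0 * a0) + (1 + p) * (1 + 4 * E0 * b0)) * T + l) + n + n
        + (2 * E0 * (1 + p) * T) * b0)
        + (4 * E0 * T * a0 + 2 * E0 * T * b0 + 2 * E0 * T * b0 * p + T + T * p + l)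
    identity = solve-∀

-- Set sizes in the greedy construction

module Width where

  width : ℕ → ℕ → ℕ → ℕ
  width e k zero    = k
  width e k (suc d) = e * width e k d

  -- Bounds the demand of every step at once: candidates enough for a pigeonhole over all patterns
  -- to at most `suc p` members of the largest width, plus the vertices which these members occupy.
  cost : ℕ → ℕ → ℕ → ℕ
  cost e p k = width e k (2 + p) * 2 ^ (suc p * width e k (2 + p)) + suc p * width e k (2 + p)

-- Bottles, cutting them, and the two exchange moves

module Bottles {n : ℕ} (G : Graph n) (p a b : ℕ) where

  open Sums

  open Pick

  V : Set
  V = Fin n

  Adj : V → V → Set
  Adj x y = adj G x y ≡ true

  Adj-sym : ∀ {x y} → Adj x y → Adj y x
  Adj-sym {x} {y} h = trans (Graph.sym G y x) h

  consF : ∀ {A : Set} {k} → A → (Fin k → A) → Fin (suc k) → A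
  consF x g Fin.zero    = x
  consF x g (Fin.suc i) = g i

  Chunks : ∀ {A : Set} k → (Fin k → ℕ) → List A → Set
  Chunks {A} k len xs =
    Σ (Fin k → List A) λ c → (∀ j → length (c j) ≡ len j)
      × (∀ j {x} → x ∈ c j → x ∈ xs)
      × (∀ f → ∑ xs f ≡ ∑ (allFin k) (λ j → ∑ (c j) f))

  chunks : ∀ {A : Set} k (len : Fin k → ℕ) (xs : List A) → length xs ≡ ∑ (allFin k) len → Chunks k len xs
  chunks zero    len [] h = (λ ()) , (λ ()) , (λ ()) , λ f → refl
  chunks (suc k) len xs h
    with pickAny xs (len Fin.zero) (subst (len Fin.zero ≤_) (sym (trans h (∑-allFin-suc k len))) (m≤m+n _ _))
  ... | P with chunks k (len ∘ Fin.suc) (rest P)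
               (+-cancelˡ-≡ (len Fin.zero) _ _ (trans (sym (rest-length P)) (trans h (∑-allFin-suc k len))))
  ... | c , l , c⊆ , s = consF (chosen P) c
    , (λ { Fin.zero → chosen-length P ; (Fin.suc j) → l j })
    , (λ { Fin.zero → chosen⊆ P ; (Fin.suc j) → rest⊆ P ∘ c⊆ j })
    , λ f → trans (split P f) (trans (cong (∑ (chosen P) f +_) (s f))
        (sym (∑-allFin-suc k (λ j → ∑ (consF (chosen P) c j) f))))

  record Parts : Set where
    constructor parts
    field
      neck : List V
      body : Fin (suc p) → List V

  open Parts public

  bodies : List (Fin (suc p))
  bodies = allFin (suc p)

  -- The multiset of vertices of a tile is represented by the functional f ↦ ∑∑ K f, so that rearranging
  -- vertices between tiles amounts to equations between sums.
  ∑∑ : Parts → (V → ℕ) → ℕ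
  ∑∑ K f = ∑ (neck K) f + ∑ bodies (λ j → ∑ (body K j) f)

  verts : Parts → List V
  verts K = neck K ++ concatMap (body K) bodies

  ∑-verts : ∀ K f → ∑ (verts K) f ≡ ∑∑ K f
  ∑-verts K f = trans (∑-++ (neck K) _ f) (cong (∑ (neck K) f +_) (∑-concatMap (body K) bodies f))

  neck⊆verts : ∀ K {x} → x ∈ neck K → x ∈ verts K
  neck⊆verts K = ∈-++⁺ˡ

  body⊆verts : ∀ K j {x} → x ∈ body K j → x ∈ verts K
  body⊆verts K j x∈ = ∈-++⁺ʳ (neck K) (∈-concatMap⁺ (body K) (Any.map (λ { refl → x∈ }) (∈-allFin j)))

  record Bottle (s : ℕ) (K : Parts) : Set where
    constructor bottle
    field
      neck-length : length (neck K) ≡ a * s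
      body-length : ∀ j → length (body K j) ≡ b * s
      neck-body   : ∀ j {x y} → x ∈ neck K → y ∈ body K j → Adj x y
      body-body   : ∀ {i j x y} → i ≢ j → x ∈ body K i → y ∈ body K j → Adj x y

  open Bottle public

  -- Different parts are completely joined, so any subsets of proportional sizes span a bottle, and
  -- so do their complements.
  cut : ∀ {s t K} → Bottle (s + t) K → (N : Pick (neck K) (a * s)) (B : ∀ j → Pick (body K j) (b * s)) →
        Bottle s (parts (chosen N) (chosen ∘ B)) × Bottle t (parts (rest N) (rest ∘ B))
        × (∀ f → ∑∑ K f ≡ ∑∑ (parts (chosen N) (chosen ∘ B)) f + ∑∑ (parts (rest N) (rest ∘ B)) f)
  cut {s} {t} {K} BK N B =
    bottle (chosen-length N) (chosen-length ∘ B)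
      (λ j x∈ y∈ → neck-body BK j (chosen⊆ N x∈) (chosen⊆ (B j) y∈))
      (λ i≢j x∈ y∈ → body-body BK i≢j (chosen⊆ (B _) x∈) (chosen⊆ (B _) y∈))
    , bottle (remaining a (rest-length N) (neck-length BK))
      (λ j → remaining b (rest-length (B j)) (body-length BK j))
      (λ j x∈ y∈ → neck-body BK j (rest⊆ N x∈) (rest⊆ (B j) y∈))
      (λ i≢j x∈ y∈ → body-body BK i≢j (rest⊆ (B _) x∈) (rest⊆ (B _) y∈))
    , λ f → trans (cong₂ _+_ (split N f)
        (trans (∑-cong bodies (λ j → split (B j) f)) (∑-+ bodies (λ j → ∑ (chosen (B j)) f) (λ j → ∑ (rest (B j)) f))))
        (lemma (∑ (chosen N) f) (∑ (rest N) f) _ _)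
    where
    lemma : ∀ a b c d → a + b + (c + d) ≡ a + c + (b + d)
    lemma = solve-∀
    remaining : ∀ c {l r} → l ≡ c * s + r → l ≡ c * (s + t) → r ≡ c * t
    remaining c {l} {r} e e′ = +-cancelˡ-≡ (c * s) _ _ (trans (sym e) (trans e′ (*-distribˡ-+ c s t)))

  cutAny : ∀ {s t K} → Bottle (s + t) K → Pick (neck K) (a * s) × (∀ j → Pick (body K j) (b * s))
  cutAny {s} {t} {K} BK =
    pickAny (neck K) (a * s) (subst (a * s ≤_) (sym (neck-length BK)) (*-monoʳ-≤ a (m≤m+n s t))) ,
    λ j → pickAny (body K j) (b * s) (subst (b * s ≤_) (sym (body-length BK j)) (*-monoʳ-≤ b (m≤m+n s t)))

  ∑-length0 : ∀ {A : Set} c (xs : List A) f → length xs ≡ c * 0 → ∑ xs f ≡ 0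
  ∑-length0 c []       f _ = refl
  ∑-length0 c (x ∷ xs) f h = case trans h (*-zeroʳ c) of λ ()

  chop : ∀ k {s K} → Bottle (k * s) K →
         Σ (List Parts) λ Ks → All (Bottle s) Ks × (∀ f → ∑ Ks (λ K → ∑∑ K f) ≡ ∑∑ K f)
  chop zero {K = K} BK = [] , [] , λ f → sym (cong₂ _+_ (∑-length0 a (neck K) f (neck-length BK))
    (trans (∑-cong bodies (λ j → ∑-length0 b (body K j) f (body-length BK j)))
           (trans (∑-const bodies 0) (*-zeroʳ (length bodies)))))
  chop (suc k) {s} BK with cutAny {s} BK
  ... | N , B with cut BK N B
  ... | BQ , BR , e with chop k BR
  ... | Ks , BKs , e′ = _ ∷ Ks , BQ ∷ BKs , λ f → trans (cong (_ +_) (e′ f)) (sym (e f))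

  Chopped : ℕ → ((V → ℕ) → ℕ) → Set
  Chopped s w = Σ (List Parts) λ Ks → All (Bottle s) Ks × (∀ f → ∑ Ks (λ K → ∑∑ K f) ≡ w f)

  chopped-++ : ∀ {s w w′} → Chopped s w → Chopped s w′ → Chopped s (λ f → w f + w′ f)
  chopped-++ (Ks , BKs , e) (Ks′ , BKs′ , e′) =
    Ks ++ Ks′ , ++⁺ BKs BKs′ , λ f → trans (∑-++ Ks Ks′ _) (cong₂ _+_ (e f) (e′ f))

  chopped-∑ : ∀ {s} {A : Set} (xs : List A) (w : A → (V → ℕ) → ℕ) → (∀ x → Chopped s (w x)) →
              Chopped s (λ f → ∑ xs (λ x → w x f))
  chopped-∑ []       w h = [] , [] , λ f → refl
  chopped-∑ (x ∷ xs) w h = chopped-++ (h x) (chopped-∑ xs w h)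

  chopped-cong : ∀ {s w w′} → (∀ f → w f ≡ w′ f) → Chopped s w → Chopped s w′
  chopped-cong h (Ks , BKs , e) = Ks , BKs , λ f → trans (e f) (h f)

  update : ∀ {A : Set} {k} → (Fin k → A) → Fin k → A → Fin k → A
  update g j x i with i ≟ᶠ j
  ... | yes _ = x
  ... | no  _ = g i

  update-≡ : ∀ {A : Set} {k} (g : Fin k → A) j x → update g j x j ≡ x
  update-≡ g j x with j ≟ᶠ j
  ... | yes _ = refl
  ... | no ¬e = ⊥-elim (¬e refl)

  update-≢ : ∀ {A : Set} {k} (g : Fin k → A) j x {i} → i ≢ j → update g j x i ≡ g i
  update-≢ g j x {i} i≢j with i ≟ᶠ j
  ... | yes e = ⊥-elim (i≢j e)
  ... | no _  = refl

  ∑-update : ∀ {k} (g : Fin (suc k) → List V) j x f →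
             ∑ (allFin (suc k)) (λ i → ∑ (update g j x i) f) + ∑ (g j) f
             ≡ ∑ (allFin (suc k)) (λ i → ∑ (g i) f) + ∑ x f
  ∑-update {k} g j x f = begin
    ∑ (allFin (suc k)) (λ i → ∑ (update g j x i) f) + ∑ (g j) f
      ≡⟨ cong (_+ ∑ (g j) f) (∑-remove j (λ i → ∑ (update g j x i) f)) ⟩
    ∑ (update g j x j) f + ∑ (allFin k) (λ i → ∑ (update g j x (punchIn j i)) f) + ∑ (g j) f
      ≡⟨ cong (_+ ∑ (g j) f) (cong₂ _+_ (cong (λ l → ∑ l f) (update-≡ g j x))
           (∑-cong (allFin k) (λ i → cong (λ l → ∑ l f) (update-≢ g j x (punchInᵢ≢i j i))))) ⟩
    ∑ x f + ∑ (allFin k) (λ i → ∑ (g (punchIn j i)) f) + ∑ (g j) f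
      ≡⟨ lemma (∑ x f) _ (∑ (g j) f) ⟩
    ∑ (g j) f + ∑ (allFin k) (λ i → ∑ (g (punchIn j i)) f) + ∑ x f
      ≡⟨ cong (_+ ∑ x f) (∑-remove j (λ i → ∑ (g i) f)) ⟨
    ∑ (allFin (suc k)) (λ i → ∑ (g i) f) + ∑ x f ∎
    where
    open ≡-Reasoning
    lemma : ∀ a b c → a + b + c ≡ c + b + a
    lemma = solve-∀

  -- A replaces, as the j-th body of a sub-bottle, the set chosen (B j), which is released.
  swap : ∀ {ρ t K} → Bottle (t + ρ * t) K → ∀ j
         (N : Pick (neck K) (a * t)) (B : ∀ i → Pick (body K i) (b * t))
         (A : List V) → length A ≡ b * t →
         (∀ {x y} → x ∈ A → y ∈ chosen N → Adj x y) →
         (∀ {i x y} → i ≢ j → x ∈ A → y ∈ chosen (B i) → Adj x y) →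
         Σ (List Parts) λ Ks → All (Bottle t) Ks ×
           (∀ f → ∑ Ks (λ K → ∑∑ K f) + ∑ (chosen (B j)) f ≡ ∑∑ K f + ∑ A f)
  swap {ρ} {t} {K} BK j N B A lA AN AB with cut BK N B
  ... | BQ , BR , e with chop ρ BR
  ... | Ks , BKs , e′ = parts (chosen N) body′ ∷ Ks , B′ ∷ BKs , total
    where
    body′ : Fin (suc p) → List V
    body′ = update (chosen ∘ B) j A
    nb : ∀ i {x y} → x ∈ chosen N → y ∈ body′ i → Adj x y
    nb i x∈ y∈ with i ≟ᶠ j
    ... | yes _ = Adj-sym (AN y∈ x∈)
    ... | no  _ = neck-body BQ i x∈ y∈
    bb : ∀ {i i′ x y} → i ≢ i′ → x ∈ body′ i → y ∈ body′ i′ → Adj x y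
    bb {i} {i′} ne x∈ y∈ with i ≟ᶠ j | i′ ≟ᶠ j
    ... | yes e | yes e′ = ⊥-elim (ne (trans e (sym e′)))
    ... | yes _ | no ¬e  = AB ¬e x∈ y∈
    ... | no ¬e | yes _  = Adj-sym (AB ¬e y∈ x∈)
    ... | no _  | no _   = body-body BQ ne x∈ y∈
    lb : ∀ i → length (body′ i) ≡ b * t
    lb i with i ≟ᶠ j
    ... | yes _ = lA
    ... | no _  = chosen-length (B i)
    B′ : Bottle t (parts (chosen N) body′)
    B′ = bottle (chosen-length N) lb nb bb
    total : ∀ f → ∑ (chosen N) f + ∑ bodies (λ i → ∑ (body′ i) f) + ∑ Ks (λ K → ∑∑ K f) + ∑ (chosen (B j)) f ≡ ∑∑ K f + ∑ A f
    total f = begin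
      ∑ (chosen N) f + ∑ bodies (λ i → ∑ (body′ i) f) + ∑ Ks (λ K → ∑∑ K f) + ∑ (chosen (B j)) f
        ≡⟨ lemma (∑ (chosen N) f) _ _ _ ⟩
      ∑ (chosen N) f + (∑ bodies (λ i → ∑ (body′ i) f) + ∑ (chosen (B j)) f) + ∑ Ks (λ K → ∑∑ K f)
        ≡⟨ cong₂ (λ u v → ∑ (chosen N) f + u + v) (∑-update (chosen ∘ B) j A f) (e′ f) ⟩
      ∑ (chosen N) f + (∑ bodies (λ i → ∑ (chosen (B i)) f) + ∑ A f) + ∑∑ (parts (rest N) (rest ∘ B)) f
        ≡⟨ lemma′ (∑ (chosen N) f) (∑ bodies (λ i → ∑ (chosen (B i)) f)) (∑ A f) (∑∑ (parts (rest N) (rest ∘ B)) f) ⟩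
      ∑∑ (parts (chosen N) (chosen ∘ B)) f + ∑∑ (parts (rest N) (rest ∘ B)) f + ∑ A f
        ≡⟨ cong (_+ ∑ A f) (e f) ⟨
      ∑∑ K f + ∑ A f ∎
      where
      open ≡-Reasoning
      lemma : ∀ a b c d → a + b + c + d ≡ a + (b + d) + c
      lemma = solve-∀
      lemma′ : ∀ a b c d → a + (b + c) + d ≡ a + b + d + c
      lemma′ = solve-∀

  -- Body `i` gives its own tile a neck and each of the other `p` tiles a body, all of scale
  -- `b * t`. This uses `b * ((a + p * b) * t)` vertices, whence the scale `(a + p * b) * t` of the
  -- bottle that is rewoven.
  pieceLength : ℕ → Fin (suc p) → Fin (suc p) → ℕ
  pieceLength t i = update (λ _ → b * (b * t)) i (a * (b * t))

  ∑-pieceLength : ∀ t i → b * ((a + p * b) * t) ≡ ∑ bodies (pieceLength t i)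
  ∑-pieceLength t i = begin
    b * ((a + p * b) * t)           ≡⟨ lemma a b p t ⟩
    a * (b * t) + p * (b * (b * t)) ≡⟨ cong₂ _+_ (update-≡ (λ _ → b * (b * t)) i (a * (b * t)))
        (trans (∑-cong (allFin p) (λ j → update-≢ (λ _ → b * (b * t)) i (a * (b * t)) (punchInᵢ≢i i j)))
               (∑-allFin-const p _)) ⟨
    pieceLength t i i + ∑ (allFin p) (pieceLength t i ∘ punchIn i) ≡⟨ ∑-remove i (pieceLength t i) ⟨
    ∑ bodies (pieceLength t i)      ∎
    where
    open ≡-Reasoning
    lemma : ∀ a b p t → b * ((a + p * b) * t) ≡ a * (b * t) + p * (b * (b * t))
    lemma = solve-∀

  -- The j-th woven tile uses a piece of body j as its neck and a part of the pool as its body j.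
  module Weave {s t} {K : Parts} (BK : Bottle s K) (A : List V)
    (pool : Fin (suc p) → List V) (piece : Fin (suc p) → Fin (suc p) → List V)
    (pool-length  : ∀ j → length (pool j) ≡ b * (b * t))
    (piece-length : ∀ i j → length (piece i j) ≡ pieceLength t i j)
    (pool⊆  : ∀ j {x} → x ∈ pool j → x ∈ A ⊎ x ∈ neck K)
    (piece⊆ : ∀ i j {x} → x ∈ piece i j → x ∈ body K i)
    (AB : ∀ {i x y} → x ∈ A → y ∈ body K i → Adj x y)
    where

    tile : Fin (suc p) → Parts
    tile j = parts (piece j j) (update (λ i → piece i j) j (pool j))

    pool-adj : ∀ i j {x y} → x ∈ pool j → y ∈ body K i → Adj x y
    pool-adj i j x∈ y∈ with pool⊆ j x∈
    ... | inj₁ x∈A = AB x∈A y∈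
    ... | inj₂ x∈N = neck-body BK i x∈N y∈

    tile-bottle : ∀ j → Bottle (b * t) (tile j)
    tile-bottle j = bottle
      (trans (piece-length j j) (update-≡ (λ _ → b * (b * t)) j (a * (b * t))))
      lb nb bb
      where
      lb : ∀ i → length (update (λ i → piece i j) j (pool j) i) ≡ b * (b * t)
      lb i with i ≟ᶠ j
      ... | yes _ = pool-length j
      ... | no ¬e = trans (piece-length i j) (update-≢ (λ _ → b * (b * t)) i (a * (b * t)) (¬e ∘ sym))
      nb : ∀ i {x y} → x ∈ piece j j → y ∈ update (λ i → piece i j) j (pool j) i → Adj x y
      nb i x∈ y∈ with i ≟ᶠ j
      ... | yes _ = Adj-sym (pool-adj j j y∈ (piece⊆ j j x∈))
      ... | no ¬e = body-body BK (¬e ∘ sym) (piece⊆ j j x∈) (piece⊆ i j y∈)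
      bb : ∀ {i i′ x y} → i ≢ i′ → x ∈ update (λ i → piece i j) j (pool j) i →
           y ∈ update (λ i → piece i j) j (pool j) i′ → Adj x y
      bb {i} {i′} ne x∈ y∈ with i ≟ᶠ j | i′ ≟ᶠ j
      ... | yes e | yes e′ = ⊥-elim (ne (trans e (sym e′)))
      ... | yes _ | no _   = pool-adj i′ j x∈ (piece⊆ i′ j y∈)
      ... | no _  | yes _  = Adj-sym (pool-adj i j y∈ (piece⊆ i j x∈))
      ... | no ¬e | no _   = body-body BK ne (piece⊆ i j x∈) (piece⊆ i′ j y∈)

    tile-sum : ∀ f → ∑ bodies (λ j → ∑∑ (tile j) f)
                   ≡ ∑ bodies (λ i → ∑ bodies (λ j → ∑ (piece i j) f)) + ∑ bodies (λ j → ∑ (pool j) f)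
    tile-sum f = begin
      ∑ bodies (λ j → ∑∑ (tile j) f)
        ≡⟨ ∑-cong bodies (λ j → trans (+-comm (∑ (piece j j) f) _) (∑-update (λ i → piece i j) j (pool j) f)) ⟩
      ∑ bodies (λ j → ∑ bodies (λ i → ∑ (piece i j) f) + ∑ (pool j) f)
        ≡⟨ ∑-+ bodies (λ j → ∑ bodies (λ i → ∑ (piece i j) f)) (λ j → ∑ (pool j) f) ⟩
      ∑ bodies (λ j → ∑ bodies (λ i → ∑ (piece i j) f)) + ∑ bodies (λ j → ∑ (pool j) f)
        ≡⟨ cong (_+ ∑ bodies (λ j → ∑ (pool j) f)) (∑-swap bodies bodies (λ j i → ∑ (piece i j) f)) ⟩
      ∑ bodies (λ i → ∑ bodies (λ j → ∑ (piece i j) f)) + ∑ bodies (λ j → ∑ (pool j) f) ∎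
      where open ≡-Reasoning

  weaveChunks : ∀ {s t K} → Bottle s K → (A : List V) →
                (∀ {i x y} → x ∈ A → y ∈ body K i → Adj x y) →
                Chunks (suc p) (λ _ → b * (b * t)) (A ++ neck K) →
                (∀ i → Chunks (suc p) (pieceLength t i) (body K i)) →
                Chopped t (λ f → ∑∑ K f + ∑ A f)
  weaveChunks {K = K} BK A AB (pool , pool-length , pool⊆ , pool-sum) M =
    chopped-cong total (chopped-∑ bodies (λ j f → ∑∑ (tile j) f) (λ j → chop b (tile-bottle j)))
    where
    open Weave BK A pool (λ i → proj₁ (M i)) pool-length (λ i → proj₁ (proj₂ (M i)))
      (λ j x∈ → ∈-++⁻ A (pool⊆ j x∈)) (λ i → proj₁ (proj₂ (proj₂ (M i)))) AB
    total : ∀ f → ∑ bodies (λ j → ∑∑ (tile j) f) ≡ ∑∑ K f + ∑ A f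
    total f = begin
      ∑ bodies (λ j → ∑∑ (tile j) f) ≡⟨ tile-sum f ⟩
      ∑ bodies (λ i → ∑ bodies (λ j → ∑ (proj₁ (M i) j) f)) + ∑ bodies (λ j → ∑ (pool j) f)
        ≡⟨ cong₂ _+_ (∑-cong bodies (λ i → proj₂ (proj₂ (proj₂ (M i))) f)) (trans (sym (∑-++ A (neck K) f)) (pool-sum f)) ⟨
      ∑ bodies (λ i → ∑ (body K i) f) + (∑ A f + ∑ (neck K) f)
        ≡⟨ lemma (∑ bodies (λ i → ∑ (body K i) f)) (∑ A f) (∑ (neck K) f) ⟩
      ∑∑ K f + ∑ A f ∎
      where
      open ≡-Reasoning
      lemma : ∀ a b c → a + (b + c) ≡ c + a + b
      lemma = solve-∀

  -- The equation for `α` says that `A` and the neck together are exactly as large as `suc p` bodies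
  -- of scale `b * t`, one for each woven tile.
  weave : ∀ {t K α} → Bottle ((a + p * b) * t) K → (A : List V) → length A ≡ α * t →
          α + a * (a + p * b) ≡ suc p * (b * b) →
          (∀ {i x y} → x ∈ A → y ∈ body K i → Adj x y) →
          Chopped t (λ f → ∑∑ K f + ∑ A f)
  weave {t} {K} {α} BK A lA αa AB = weaveChunks BK A AB
    (chunks (suc p) (λ _ → b * (b * t)) (A ++ neck K) pool-length)
    (λ i → chunks (suc p) (pieceLength t i) (body K i) (trans (body-length BK i) (∑-pieceLength t i)))
    where
    pool-length : length (A ++ neck K) ≡ ∑ bodies (λ _ → b * (b * t))
    pool-length = begin
      length (A ++ neck K)         ≡⟨ length-++ A ⟩
      length A + length (neck K)   ≡⟨ cong₂ _+_ lA (neck-length BK) ⟩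
      α * t + a * ((a + p * b) * t) ≡⟨ lemma α a (a + p * b) t ⟩
      (α + a * (a + p * b)) * t    ≡⟨ cong (_* t) αa ⟩
      suc p * (b * b) * t          ≡⟨ lemma′ p b t ⟩
      suc p * (b * (b * t))        ≡⟨ ∑-allFin-const (suc p) (b * (b * t)) ⟨
      ∑ bodies (λ _ → b * (b * t)) ∎
      where
      open ≡-Reasoning
      lemma : ∀ α a u t → α * t + a * (u * t) ≡ (α + a * u) * t
      lemma = solve-∀
      lemma′ : ∀ p b t → (1 + p) * (b * b) * t ≡ (1 + p) * (b * (b * t))
      lemma′ = solve-∀

  -- A and the neck of a sub-bottle form one part of a complete multipartite graph.  Splitting it into
  -- bottles whose necks rotate through the bodies uses up A; the value of α balances the part sizes.
  gain : ∀ {ρ t K α} → Bottle ((a + p * b) * t + ρ * t) K →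
         (N : Pick (neck K) (a * ((a + p * b) * t))) (B : ∀ i → Pick (body K i) (b * ((a + p * b) * t)))
         (A : List V) → length A ≡ α * t → α + a * (a + p * b) ≡ suc p * (b * b) →
         (∀ {i x y} → x ∈ A → y ∈ chosen (B i) → Adj x y) →
         Chopped t (λ f → ∑∑ K f + ∑ A f)
  gain {ρ} {K = K} BK N B A lA αa AB with cut BK N B
  ... | BQ , BR , e = chopped-cong total (chopped-++ (weave BQ A lA αa AB) (chop ρ BR))
    where
    Q R : Parts
    Q = parts (chosen N) (chosen ∘ B)
    R = parts (rest N) (rest ∘ B)
    total : ∀ f → ∑∑ Q f + ∑ A f + ∑∑ R f ≡ ∑∑ K f + ∑ A f
    total f = trans (lemma (∑∑ Q f) (∑ A f) (∑∑ R f)) (cong (_+ ∑ A f) (sym (e f)))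
      where
      lemma : ∀ a b c → a + b + c ≡ a + c + b
      lemma = solve-∀

-- A new bottle inside the uncovered set

module Builder {n : ℕ} (G : Graph n) (p a b E : ℕ) (L : List (Fin n)) where
  open import Data.Nat using (_<_)

  open Sums
  open Bottles G p a b
  open Arith
  open Width

  open Pick

  m e ℓ : ℕ
  m = a + suc p * b
  e = 8 * E
  ℓ = length L

  allᶠ : ∀ {k} → (Fin k → Bool) → Bool
  allᶠ {zero}  P = true
  allᶠ {suc k} P = P Fin.zero ∧ allᶠ (P ∘ Fin.suc)

  allᶠ-elim : ∀ {k} (P : Fin k → Bool) → allᶠ P ≡ true → ∀ j → P j ≡ true
  allᶠ-elim P h Fin.zero    = ∧-trueˡ h
  allᶠ-elim P h (Fin.suc j) = allᶠ-elim (P ∘ Fin.suc) (∧-trueʳ {P Fin.zero} h) j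

  not-∧≤ : ∀ x y → ⟦ not (x ∧ y) ⟧ ≤ ⟦ not x ⟧ + ⟦ not y ⟧
  not-∧≤ true  y = ≤-refl
  not-∧≤ false y = s≤s z≤n

  not-allᶠ≤ : ∀ {k} (P : Fin k → Bool) → ⟦ not (allᶠ P) ⟧ ≤ ∑ (allFin k) (λ j → ⟦ not (P j) ⟧)
  not-allᶠ≤ {zero}  P = z≤n
  not-allᶠ≤ {suc k} P = ≤-trans (not-∧≤ (P Fin.zero) _)
    (≤-trans (+-monoʳ-≤ _ (not-allᶠ≤ (P ∘ Fin.suc))) (≤-reflexive (sym (∑-allFin-suc k (λ j → ⟦ not (P j) ⟧)))))

  dense : List V → V → Bool
  dense A y = length A ≤ᵇ e * # (adj G y) A

  -- Count the pairs between `A` and `L`. Every vertex of `A` misses at most `b / m - 1 / (4 * E)`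
  -- of `L`, while a vertex that is not dense misses all but `1 / e` of `A`. Since `e = 8 * E`, the
  -- surplus `1 / (4 * E)` pays for that last proportion.
  sparse-count : 0 < E → (A : List V) → 0 < length A →
    (∀ {x} → x ∈ A → (4 * E) * ((a + p * b) * ℓ) + m * ℓ ≤ (4 * E) * (m * # (adj G x) L)) →
    m * # (not ∘ dense A) L ≤ b * ℓ
  sparse-count 0<E A 0<τ degree = *-cancelˡ-≤ (32 * E * E * τ) {{nz}}
    (sparse-arith a b p E τ ℓ S (# (not ∘ dense A) L) summed degrees (#≤length _ L))
    where
    τ S : ℕ
    τ = length A
    S = ∑ L (λ y → # (adj G y) A)
    nz : NonZero (32 * E * E * τ)
    nz = >-nonZero (*-mono-< (*-mono-< (*-mono-< (s≤s (z≤n {31})) 0<E) 0<E) 0<τ)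
    pointwise : ∀ y → e * # (adj G y) A + e * τ * ⟦ not (dense A y) ⟧ ≤ e * τ + τ * ⟦ not (dense A y) ⟧
    pointwise y with τ ≤ᵇ e * # (adj G y) A in eq
    ... | true  = +-mono-≤ (*-monoʳ-≤ e (#≤length (adj G y) A)) (≤-reflexive (trans (*-zeroʳ (e * τ)) (sym (*-zeroʳ τ))))
    ... | false = ≤-trans (≤-reflexive (+-comm (e * # (adj G y) A) _)) (+-mono-≤ (≤-reflexive (*-identityʳ (e * τ))) (≤-trans sparse (≤-reflexive (sym (*-identityʳ τ)))))
      where
      sparse : e * # (adj G y) A ≤ τ
      sparse with τ ≤? e * # (adj G y) A
      ... | yes h = case trans (sym (≤ᵇ-true h)) eq of λ ()
      ... | no ¬h = <⇒≤ (≰⇒> ¬h)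
    summed : e * S + e * τ * # (not ∘ dense A) L ≤ e * τ * ℓ + τ * # (not ∘ dense A) L
    summed = subst₂ _≤_
      (trans (∑-+ L _ _) (cong₂ _+_ (∑-*ˡ L e _) (∑-*ˡ L (e * τ) _)))
      (trans (∑-+ L _ _) (cong₂ _+_ (trans (∑-const L (e * τ)) (*-comm ℓ (e * τ))) (∑-*ˡ L τ _)))
      (∑-mono L pointwise)
    S-swap : S ≡ ∑ A (λ x → # (adj G x) L)
    S-swap = trans (∑-swap L A (λ y x → ⟦ adj G y x ⟧)) (∑-cong A (λ x → ∑-cong L (λ y → cong ⟦_⟧ (Graph.sym G y x))))
    degrees : τ * ((4 * E) * ((a + p * b) * ℓ) + m * ℓ) ≤ (4 * E) * (m * S)
    degrees = subst₂ _≤_ (∑-const A _)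
      (trans (∑-*ˡ A (4 * E) _) (cong ((4 * E) *_) (trans (∑-*ˡ A m _) (cong (m *_) (sym S-swap)))))
      (∑-mono-∈ A degree)

  record Family (i τ : ℕ) : Set where
    constructor family
    field
      member   : Fin i → List V
      pool     : List V
      lengths  : ∀ j → length (member j) ≡ τ
      adjacent : ∀ {j k x y} → j ≢ k → x ∈ member j → y ∈ member k → Adj x y
      total    : ∀ f → ∑ L f ≡ ∑ (allFin i) (λ j → ∑ (member j) f) + ∑ pool f

  open Family

  candidate : ∀ {i τ} → Family i τ → (V → Bool) → V → Bool
  candidate F T y = T y ∧ allᶠ (λ j → dense (member F j) y)

  adjacencies : ∀ {i τ} → Family i τ → List (V → Bool)
  adjacencies {i} F = concatMap (λ j → map (adj G) (member F j)) (allFin i)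

  length-∑ : ∀ {A B : Set} (g : A → List B) xs → length (concatMap g xs) ≡ ∑ xs (length ∘ g)
  length-∑ g []       = refl
  length-∑ g (x ∷ xs) = trans (length-++ (g x)) (cong (length (g x) +_) (length-∑ g xs))

  length-adjacencies : ∀ {i τ} (F : Family i τ) → length (adjacencies F) ≡ i * τ
  length-adjacencies {i} {τ} F = trans (length-∑ (λ j → map (adj G) (member F j)) (allFin i))
    (trans (∑-cong (allFin i) (λ j → trans (length-map (adj G) (member F j)) (lengths F j))) (∑-allFin-const i τ))

  adjacencies∋ : ∀ {i τ} (F : Family i τ) j {x} → x ∈ member F j → adj G x ∈ adjacencies F
  adjacencies∋ F j x∈ = ∈-concatMap⁺ _ (Any.map (λ { refl → ∈-map⁺ (adj G) x∈ }) (∈-allFin j))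

  Extension : ∀ {i τ} → Family i τ → (V → Bool) → ℕ → Set
  Extension {i} F T k = Σ (Family (suc i) k) λ F′ →
    (∀ {x} → x ∈ member F′ Fin.zero → T x ≡ true) × (∀ j {x} → x ∈ member F′ (Fin.suc j) → x ∈ member F j)

  -- The Kővári–Sós–Turán step: vertices that see a proportion 1/e of each member, and see it in the same
  -- way, form a new member, at the cost of shrinking the others by a factor e.
  extend : 0 < E → ∀ {i k} (F : Family i (e * k)) → 0 < k → (T : V → Bool) →
    k * 2 ^ (i * (e * k)) ≤ # (candidate F T) (pool F) → Extension F T k
  extend 0<E {i} {k} F 0<k T enough = step
    (pigeonhole (adjacencies F) (candidate F T) (pool F) k
      (subst (λ z → k * 2 ^ z ≤ # (candidate F T) (pool F)) (sym (length-adjacencies F)) enough))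
    where
    head-∈ : ∀ {xs : List V} → length xs ≡ k → ∃ λ x → x ∈ xs
    head-∈ {[]}    h = ⊥-elim (<⇒≱ 0<k (≤-reflexive (sym h)))
    head-∈ {x ∷ _} h = x , here refl
    instance
      e≢0 : NonZero e
      e≢0 = >-nonZero (*-mono-< (s≤s (z≤n {7})) 0<E)
    step : (Σ (Pick (pool F) k) λ P → (∀ {x} → x ∈ chosen P → candidate F T x ≡ true)
             × (∀ {Q} → Q ∈ adjacencies F → Constant Q (chosen P))) → Extension F T k
    step (P , cand , const) = finish (head-∈ (chosen-length P))
      where
      finish : (∃ λ y → y ∈ chosen P) → Extension F T k
      finish (y₀ , y₀∈) =
        family mem pool′ len adj′ tot , (λ x∈ → ∧-trueˡ (cand x∈)) , (λ j → chosen⊆ (proj₁ (Q j)))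
        where
        enough-nbrs : ∀ j → k ≤ # (adj G y₀) (member F j)
        enough-nbrs j = *-cancelˡ-≤ e (subst (_≤ e * # (adj G y₀) (member F j)) (lengths F j)
          (true-≤ (allᶠ-elim (λ j → dense (member F j) y₀) (∧-trueʳ {T y₀} (cand y₀∈)) j)))
        Q : ∀ j → Σ (Pick (member F j) k) λ Q → ∀ {x} → x ∈ chosen Q → Adj y₀ x
        Q j = pick# (adj G y₀) (member F j) k (enough-nbrs j)
        mem : Fin (suc i) → List V
        mem = consF (chosen P) (λ j → chosen (proj₁ (Q j)))
        pool′ : List V
        pool′ = rest P ++ concatMap (λ j → rest (proj₁ (Q j))) (allFin i)
        len : ∀ j → length (mem j) ≡ k
        len Fin.zero    = chosen-length P
        len (Fin.suc j) = chosen-length (proj₁ (Q j))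
        new-adj : ∀ j {x y} → x ∈ chosen P → y ∈ chosen (proj₁ (Q j)) → Adj x y
        new-adj j {x} {y} x∈ y∈ = Adj-sym (trans
          (const (adjacencies∋ F j (chosen⊆ (proj₁ (Q j)) y∈)) x∈ y₀∈)
          (Adj-sym (proj₂ (Q j) y∈)))
        adj′ : ∀ {j j′ x y} → j ≢ j′ → x ∈ mem j → y ∈ mem j′ → Adj x y
        adj′ {Fin.zero}  {Fin.zero}   ne x∈ y∈ = ⊥-elim (ne refl)
        adj′ {Fin.zero}  {Fin.suc j′} ne x∈ y∈ = new-adj j′ x∈ y∈
        adj′ {Fin.suc j} {Fin.zero}   ne x∈ y∈ = Adj-sym (new-adj j y∈ x∈)
        adj′ {Fin.suc j} {Fin.suc j′} ne x∈ y∈ =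
          adjacent F (ne ∘ cong Fin.suc) (chosen⊆ (proj₁ (Q j)) x∈) (chosen⊆ (proj₁ (Q j′)) y∈)
        tot : ∀ f → ∑ L f ≡ ∑ (allFin (suc i)) (λ j → ∑ (mem j) f) + ∑ pool′ f
        tot f = begin
          ∑ L f ≡⟨ total F f ⟩
          ∑ (allFin i) (λ j → ∑ (member F j) f) + ∑ (pool F) f
            ≡⟨ cong₂ _+_ (trans (∑-cong (allFin i) (λ j → split (proj₁ (Q j)) f)) (∑-+ (allFin i) (λ j → ∑ (chosen (proj₁ (Q j))) f) (λ j → ∑ (rest (proj₁ (Q j))) f))) (split P f) ⟩
          ∑ (allFin i) (λ j → ∑ (chosen (proj₁ (Q j))) f) + ∑ (allFin i) (λ j → ∑ (rest (proj₁ (Q j))) f) + (∑ (chosen P) f + ∑ (rest P) f)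
            ≡⟨ lemma (∑ (allFin i) (λ j → ∑ (chosen (proj₁ (Q j))) f)) _ (∑ (chosen P) f) (∑ (rest P) f) ⟩
          ∑ (chosen P) f + ∑ (allFin i) (λ j → ∑ (chosen (proj₁ (Q j))) f) + (∑ (rest P) f + ∑ (allFin i) (λ j → ∑ (rest (proj₁ (Q j))) f))
            ≡⟨ cong₂ _+_ (∑-allFin-suc i (λ j → ∑ (mem j) f)) (trans (∑-++ (rest P) _ f) (cong (∑ (rest P) f +_) (∑-concatMap (λ j → rest (proj₁ (Q j))) (allFin i) f))) ⟨
          ∑ (allFin (suc i)) (λ j → ∑ (mem j) f) + ∑ pool′ f ∎
          where
          open ≡-Reasoning
          lemma : ∀ a b c d → a + b + (c + d) ≡ c + a + (d + b)
          lemma = solve-∀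

  module _ (0<E : 0 < E) (0<m : 0 < m) (0<a : 0 < a) (good : V → Bool)
    (good-degree : ∀ {x} → good x ≡ true → (4 * E) * ((a + p * b) * ℓ) + m * ℓ ≤ (4 * E) * (m * # (adj G x) L))
    where

    private instance
      m≢0 : NonZero m
      m≢0 = >-nonZero 0<m

    AllGood : ∀ {i τ} → Family i τ → Set
    AllGood {i} F = ∀ j {x} → x ∈ member F j → good x ≡ true

    -- A vertex is excluded if `T` fails or if some member is sparse for it, the latter for at most
    -- `b * ℓ / m` vertices per member. The first hypothesis leaves `a * ℓ / (2 * m)` vertices; the
    -- term `i * τ` accounts for those that already lie in a member.
    candidates : ∀ {i τ} (F : Family i τ) → 0 < τ → AllGood F → (T : V → Bool) → ∀ W →
      2 * (m * # (not ∘ T) L) + 2 * (i * (b * ℓ)) + a * ℓ ≤ 2 * (m * ℓ) →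
      2 * (m * (W + i * τ)) ≤ a * ℓ →
      W ≤ # (candidate F T) (pool F)
    candidates {i} {τ} F 0<τ allGood T W few enough =
      +-cancelʳ-≤ (i * τ) W _ (begin
        W + i * τ ≤⟨ *-cancelˡ-≤ m (*-cancelˡ-≤ 2 (candidates-arith m i b a ℓ (# (not ∘ T) L) sparse (# (candidate F T) L) W (i * τ)
                       few covered sparse≤ enough)) ⟩
        # (candidate F T) L ≡⟨ trans (total F _) (+-comm _ (# (candidate F T) (pool F))) ⟩
        # (candidate F T) (pool F) + ∑ (allFin i) (λ j → # (candidate F T) (member F j))
          ≤⟨ +-monoʳ-≤ _ (≤-trans (∑-mono (allFin i) (λ j → ≤-trans (#≤length (candidate F T) (member F j)) (≤-reflexive (lengths F j))))
               (≤-reflexive (∑-allFin-const i τ))) ⟩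
        # (candidate F T) (pool F) + i * τ ∎)
      where
      open ≤-Reasoning
      sparse : ℕ
      sparse = ∑ (allFin i) (λ j → # (not ∘ dense (member F j)) L)
      sparse≤ : m * sparse ≤ i * (b * ℓ)
      sparse≤ = subst₂ _≤_ (∑-*ˡ (allFin i) m _) (∑-allFin-const i (b * ℓ))
        (∑-mono (allFin i) (λ j → sparse-count 0<E (member F j) (subst (0 <_) (sym (lengths F j)) 0<τ)
          (λ x∈ → good-degree (allGood j x∈))))
      covered : ℓ ≤ # (candidate F T) L + (# (not ∘ T) L + sparse)
      covered = begin
        ℓ ≡⟨ #-+-not (candidate F T) L ⟨
        # (candidate F T) L + # (not ∘ candidate F T) L
          ≤⟨ +-monoʳ-≤ (# (candidate F T) L) (∑-mono L (λ y → ≤-trans (not-∧≤ (T y) _) (+-monoʳ-≤ ⟦ not (T y) ⟧ (not-allᶠ≤ (λ j → dense (member F j) y))))) ⟩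
        # (candidate F T) L + ∑ L (λ y → ⟦ not (T y) ⟧ + ∑ (allFin i) (λ j → ⟦ not (dense (member F j) y) ⟧))
          ≡⟨ cong (# (candidate F T) L +_) (trans (∑-+ L _ _) (cong (# (not ∘ T) L +_) (∑-swap L (allFin i) (λ y j → ⟦ not (dense (member F j) y) ⟧)))) ⟩
        # (candidate F T) L + (# (not ∘ T) L + sparse) ∎

    module _ (k : ℕ) (0<k : 0 < k) where

      width-suc : ∀ d → width e k d ≤ width e k (suc d)
      width-suc d = ≤-trans (≤-reflexive (sym (*-identityˡ (width e k d)))) (*-monoˡ-≤ (width e k d) (*-mono-≤ (s≤s (z≤n {7})) 0<E))

      width-mono : ∀ {d d′} → d ≤′ d′ → width e k d ≤ width e k d′
      width-mono ≤′-refl       = ≤-refl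
      width-mono (≤′-step {d″} d≤d″) = ≤-trans (width-mono d≤d″) (width-suc d″)

      0<width : ∀ d → 0 < width e k d
      0<width d = ≤-trans 0<k (width-mono (z≤′n {d}))

      module _ (enough : 2 * (m * cost e p k) ≤ a * ℓ) (few-bad : 2 * (m * # (not ∘ good) L) ≤ 2 * (b * ℓ) + a * ℓ) where

        cost-bound : ∀ i d → i ≤ suc p → d ≤ suc p →
          2 * (m * (width e k d * 2 ^ (i * width e k (suc d)) + i * width e k (suc d))) ≤ a * ℓ
        cost-bound i d i≤ d≤ = ≤-trans (*-monoʳ-≤ 2 (*-monoʳ-≤ m (+-mono-≤
          (*-mono-≤ (≤-trans (width-suc d) s≤) (^-monoʳ-≤ 2 i*s≤)) i*s≤))) enough
          where
          s≤ : width e k (suc d) ≤ width e k (2 + p)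
          s≤ = width-mono (≤⇒≤′ (s≤s d≤))
          i*s≤ : i * width e k (suc d) ≤ suc p * width e k (2 + p)
          i*s≤ = *-mono-≤ i≤ s≤

        extendBy : ∀ {i} d (F : Family i (width e k (suc d))) → AllGood F → i ≤ suc p → d ≤ suc p → (T : V → Bool) →
          2 * (m * # (not ∘ T) L) + 2 * (i * (b * ℓ)) + a * ℓ ≤ 2 * (m * ℓ) → Extension F T (width e k d)
        extendBy {i} d F allGood i≤ d≤ T few = extend 0<E F (0<width d) T
          (candidates F (0<width (suc d)) allGood T _ few (cost-bound i d i≤ d≤))

        -- The bad vertices use up one share `b * ℓ` of `m * ℓ` and half of the share `a * ℓ`, and
        -- at most `p` members use one share `b * ℓ` each. The other half of `a * ℓ` remains.
        few-good : ∀ i → i ≤ p → 2 * (m * # (not ∘ good) L) + 2 * (i * (b * ℓ)) + a * ℓ ≤ 2 * (m * ℓ)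
        few-good i i≤p = ≤-trans (+-monoˡ-≤ (a * ℓ) (+-mono-≤ few-bad (*-monoʳ-≤ 2 (*-monoˡ-≤ (b * ℓ) i≤p))))
          (≤-reflexive (lemma a b p ℓ))
          where
          lemma : ∀ a b p l → 2 * (b * l) + a * l + 2 * (p * (b * l)) + a * l ≡ 2 * ((a + (1 + p) * b) * l)
          lemma = solve-∀

        -- The last part is chosen without regard to `good`: the share `b * ℓ` reserved for bad
        -- vertices is spent on the member number `suc p` instead.
        few-last : 2 * (m * # (not ∘ (λ _ → true)) L) + 2 * (suc p * (b * ℓ)) + a * ℓ ≤ 2 * (m * ℓ)
        few-last = subst (λ z → 2 * (m * z) + 2 * (suc p * (b * ℓ)) + a * ℓ ≤ 2 * (m * ℓ))
          (sym (trans (∑-const L 0) (*-zeroʳ ℓ))) (≤-trans (m≤m+n _ (a * ℓ)) (≤-reflexive (lemma a b p m ℓ)))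
          where
          lemma : ∀ a b p m l → 2 * (m * 0) + 2 * ((1 + p) * (b * l)) + a * l + a * l ≡ 2 * ((a + (1 + p) * b) * l)
          lemma = solve-∀

        grow : ∀ d i → d + i ≡ suc p → (F : Family i (width e k (suc d))) → AllGood F → Family (2 + p) k
        grow zero    i refl F allGood = proj₁ (extendBy 0 F allGood ≤-refl z≤n (λ _ → true) few-last)
        grow (suc d) i eq   F allGood = next (extendBy (suc d) F allGood (≤-trans (m≤n+m i (suc d)) (≤-reflexive eq))
            (≤-trans (m≤m+n (suc d) i) (≤-reflexive eq)) good
            (few-good i (≤-trans (m≤n+m i d) (≤-reflexive (suc-injective eq)))))
          where
          next : Extension F good (width e k (suc d)) → Family (2 + p) k
          next (F′ , new , old) = grow d (suc i) (trans (+-suc d i) eq) F′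
            λ { Fin.zero → new ; (Fin.suc j) x∈ → allGood j (old j x∈) }

        multipartite : Family (2 + p) k
        multipartite = grow (suc p) 0 (+-identityʳ (suc p))
          (family (λ ()) L (λ ()) (λ { {()} }) (λ f → refl)) (λ ())

  trim : ∀ {t} → a ≤ b → Family (2 + p) (b * t) →
    Σ Parts λ K → Bottle t K × Σ (List V) λ R → ∀ f → ∑ L f ≡ ∑∑ K f + ∑ R f
  trim {t} a≤b F = parts (chosen N) B ,
    bottle (chosen-length N) (λ j → lengths F (Fin.suc j))
      (λ j x∈ y∈ → adjacent F (λ ()) (chosen⊆ N x∈) y∈)
      (λ i≢j → adjacent F (λ { refl → i≢j refl })) ,
    rest N ++ pool F , tot
    where
    B : Fin (suc p) → List V
    B = member F ∘ Fin.suc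
    N : Pick (member F Fin.zero) (a * t)
    N = pickAny (member F Fin.zero) (a * t) (≤-trans (*-monoˡ-≤ t a≤b) (≤-reflexive (sym (lengths F Fin.zero))))
    tot : ∀ f → ∑ L f ≡ ∑∑ (parts (chosen N) B) f + ∑ (rest N ++ pool F) f
    tot f = begin
      ∑ L f ≡⟨ total F f ⟩
      ∑ (allFin (2 + p)) (λ j → ∑ (member F j) f) + ∑ (pool F) f
        ≡⟨ cong (_+ ∑ (pool F) f) (trans (∑-allFin-suc (suc p) (λ j → ∑ (member F j) f)) (cong (_+ ∑ bodies (λ j → ∑ (B j) f)) (split N f))) ⟩
      ∑ (chosen N) f + ∑ (rest N) f + ∑ bodies (λ j → ∑ (B j) f) + ∑ (pool F) f
        ≡⟨ lemma (∑ (chosen N) f) (∑ (rest N) f) (∑ bodies (λ j → ∑ (B j) f)) (∑ (pool F) f) ⟩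
      ∑∑ (parts (chosen N) B) f + (∑ (rest N) f + ∑ (pool F) f)
        ≡⟨ cong (∑∑ (parts (chosen N) B) f +_) (∑-++ (rest N) (pool F) f) ⟨
      ∑∑ (parts (chosen N) B) f + ∑ (rest N ++ pool F) f ∎
      where
      open ≡-Reasoning
      lemma : ∀ a b c d → a + b + c + d ≡ a + c + (b + d)
      lemma = solve-∀

-- Degrees into bottles that offer no move

module Counting {n : ℕ} (G : Graph n) (p a b E : ℕ) (μ : Fin n → ℕ) (ρ t : ℕ) where

  open Sums
  open Bottles G p a b
  open Arith

  m e : ℕ
  m = a + suc p * b
  e = 8 * E

  -- The margin `n / (4 * E)` between the values of `μ` guarantees that replacing `x` by `z` lowers
  -- the potential by at least `n`.
  high : V → V → Bool
  high x z = (4 * E) * μ x + n ≤ᵇ (4 * E) * μ z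

  low : V → V → Bool
  low x z = not (high x z)

  NeckDense : ℕ → V → Parts → Set
  NeckDense t x K = a * t ≤ e * # (adj G x) (neck K)

  BodyDense HighDense : ℕ → V → Parts → Fin (suc p) → Set
  BodyDense t x K j = b * t ≤ e * # (adj G x) (body K j)
  HighDense t x K j = b * t ≤ e * # (high x) (body K j)

  -- `Useful` collects the two kinds of moves: all bodies dense allows `gain`, `Swappable` allows `swap`.
  Swappable : ℕ → V → Parts → Set
  Swappable t x K = NeckDense t x K × ∃ λ j → (∀ i → i ≢ j → BodyDense t x K i) × HighDense t x K j

  Useful : ℕ → V → Parts → Set
  Useful t x K = (∀ j → BodyDense t x K j) ⊎ Swappable t x K

  abstract
   useful? : ∀ t x K → Dec (Useful t x K)
   useful? t x K =
     all? (λ j → b * t ≤? _) ⊎-dec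
    ((a * t ≤? _) ×-dec any? λ j → all? (λ i → ¬? (i ≟ᶠ j) →-dec (b * t ≤? _)) ×-dec (b * t ≤? _))

  ∑-oneSparse : ∀ k (g : Fin k → ℕ) i B c → (∀ j → g j ≤ B) → c * g i ≤ B →
                c * ∑ (allFin k) g + c * B ≤ c * (k * B) + B
  ∑-oneSparse (suc k) g i B c h s = begin
    c * ∑ (allFin (suc k)) g + c * B
      ≡⟨ cong (λ z → c * z + c * B) (∑-remove i g) ⟩
    c * (g i + ∑ (allFin k) (g ∘ punchIn i)) + c * B
      ≤⟨ +-monoˡ-≤ (c * B) (*-monoʳ-≤ c (+-monoʳ-≤ (g i) (≤-trans (∑-mono (allFin k) (h ∘ punchIn i)) (≤-reflexive (∑-allFin-const k B))))) ⟩
    c * (g i + k * B) + c * B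
      ≡⟨ lemma c (g i) k B ⟩
    c * (suc k * B) + c * g i
      ≤⟨ +-monoʳ-≤ _ s ⟩
    c * (suc k * B) + B ∎
    where
    open ≤-Reasoning
    lemma : ∀ c g k B → c * (g + k * B) + c * B ≡ c * ((1 + k) * B) + c * g
    lemma = solve-∀

  degᴷ lowᴷ : V → Parts → ℕ
  degᴷ x K = ∑∑ K (λ v → ⟦ adj G x v ⟧)
  lowᴷ x K = ∑∑ K (λ v → ⟦ low x v ⟧)

  module UselessBound {t x K} (BK : Bottle t K) (a≤b : a ≤ b) (useless : ¬ Useful t x K) where

    gN : ℕ
    gN = # (adj G x) (neck K)
    gB : Fin (suc p) → ℕ
    gB j = # (adj G x) (body K j)

    gN≤ : gN ≤ a * t
    gN≤ = ≤-trans (#≤length (adj G x) (neck K)) (≤-reflexive (neck-length BK))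
    gB≤ : ∀ j → gB j ≤ b * t
    gB≤ j = ≤-trans (#≤length (adj G x) (body K j)) (≤-reflexive (body-length BK j))

    sparseBody : ∃ λ j → ¬ BodyDense t x K j
    sparseBody = ¬∀⟶∃¬ (suc p) (BodyDense t x K) (λ j → b * t ≤? _) (useless ∘ inj₁)

    j₀ : Fin (suc p)
    j₀ = proj₁ sparseBody
    sparse₀ : e * gB j₀ ≤ b * t
    sparse₀ = <⇒≤ (≰⇒> (proj₂ sparseBody))

    sparse : e * ∑ bodies gB + e * (b * t) ≤ e * (suc p * (b * t)) + b * t
    sparse = ∑-oneSparse (suc p) gB j₀ (b * t) e gB≤ sparse₀

    -- Divided by `e * b` this is `p * b * t + (a / b) * B + 2 * m * t / e`: the part of the degree
    -- condition that falls on `m * t` vertices of which `B` are low, and an error.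
    bound : ℕ → ℕ
    bound B = e * (p * b) * (b * t) + e * a * B + 2 * (b * (m * t))

    -- As `gain` does not apply, one body is sparse. The other `p` bodies may be full, and the full
    -- neck has `a * t`, that is `a / b` times `b * t`.
    bound-full : e * (b * degᴷ x K) ≤ bound (b * t)
    bound-full = bound-full-arith a b p e t (∑ bodies gB) gN sparse gN≤

    -- Besides `j₀` one more obstacle prevents a swap. A second sparse body makes room for the neck,
    -- because `a ≤ b`; a sparse neck contributes nothing substantial; otherwise few vertices of
    -- body `j₀` are high, so nearly `b * t` of them are low and account for the neck.
    bound-low : e * (b * degᴷ x K) ≤ bound (lowᴷ x K)
    bound-low with all? (λ i → ¬? (i ≟ᶠ j₀) →-dec (b * t ≤? e * gB i))
    ... | no ¬others with ¬∀⟶∃¬ (suc p) _ (λ i → ¬? (i ≟ᶠ j₀) →-dec (b * t ≤? e * gB i)) ¬others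
    ... | i , i-sparse = subst (λ S → e * (b * (gN + S)) ≤ bound (lowᴷ x K)) (sym (∑-remove j₀ gB))
      (bound-two-arith a b p e t (∑ (allFin p) (gB ∘ punchIn j₀)) gN (gB j₀) (lowᴷ x K)
        (∑-oneSparse p (gB ∘ punchIn j₀) (punchOut j₀≢i) (b * t) e (gB≤ ∘ punchIn j₀)
          (subst (λ z → e * gB z ≤ b * t) (sym (punchIn-punchOut j₀≢i)) sparseᵢ))
        sparse₀ gN≤ a≤b)
      where
      j₀≢i : j₀ ≢ i
      j₀≢i j₀≡i = i-sparse (λ i≢j₀ → ⊥-elim (i≢j₀ (sym j₀≡i)))
      sparseᵢ : e * gB i ≤ b * t
      sparseᵢ with b * t ≤? e * gB i
      ... | yes d = ⊥-elim (i-sparse (λ _ → d))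
      ... | no ¬d = <⇒≤ (≰⇒> ¬d)
    bound-low | yes others with a * t ≤? e * gN
    ... | no sparseN = bound-neck-arith a b p e t (∑ bodies gB) gN (lowᴷ x K) sparse (<⇒≤ (≰⇒> sparseN))
    ... | yes denseN = bound-low-arith a b p e t (∑ bodies gB) gN (# (high x) (body K j₀)) (# (low x) (body K j₀)) (lowᴷ x K)
      sparse gN≤ (<⇒≤ (≰⇒> (λ h → useless (inj₂ (denseN , j₀ , others , h)))))
      (≤-reflexive (sym (trans (#-+-not (high x) (body K j₀)) (body-length BK j₀))))
      (≤-trans (∑-≥-∈ (λ j → # (low x) (body K j)) (∈-allFin j₀)) (m≤n+m _ (# (low x) (neck K))))

    bound-⊓ : e * (b * degᴷ x K) ≤ bound (lowᴷ x K ⊓ (b * t))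
    bound-⊓ with ⊓-sel (lowᴷ x K) (b * t)
    ... | inj₁ eq = subst (λ z → e * (b * degᴷ x K) ≤ bound z) (sym eq) bound-low
    ... | inj₂ eq = subst (λ z → e * (b * degᴷ x K) ≤ bound z) (sym eq) bound-full

  -- `used` marks the tiles produced by a move in the current phase. Moves touch only the others,
  -- all of scale `ρ * t`, so one bound on the number of patterns serves the whole phase.
  record Tile : Set where
    constructor tile
    field
      used  : Bool
      shape : Parts

  open Tile public

  scale : Tile → ℕ
  scale K = if used K then t else ρ * t

  Valid : Tile → Set
  Valid K = Bottle (scale K) (shape K)

  UsefulTile : V → Tile → Set
  UsefulTile x K = used K ≡ false × Useful (ρ * t) x (shape K)

  usefulTile? : ∀ x K → Dec (UsefulTile x K)
  usefulTile? x K = (used K ≟ᵇ false) ×-dec useful? (ρ * t) x (shape K)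

  weight : Tile → ℕ
  weight K = m * scale K

  usedWeight : Tile → ℕ
  usedWeight K = ⟦ used K ⟧ * weight K

  usefulWeight : V → Tile → ℕ
  usefulWeight x K = ⟦ does (usefulTile? x K) ⟧ * weight K

  ∑∑≤ : ∀ {t K} → Bottle t K → (P : V → Bool) → ∑∑ K (λ v → ⟦ P v ⟧) ≤ m * t
  ∑∑≤ {t} {K} BK P = begin
    # P (neck K) + ∑ bodies (λ j → # P (body K j))
      ≤⟨ +-mono-≤ (≤-trans (#≤length P (neck K)) (≤-reflexive (neck-length BK)))
          (∑-mono bodies (λ j → ≤-trans (#≤length P (body K j)) (≤-reflexive (body-length BK j)))) ⟩
    a * t + ∑ bodies (λ _ → b * t)  ≡⟨ cong (a * t +_) (∑-allFin-const (suc p) (b * t)) ⟩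
    a * t + suc p * (b * t)         ≡⟨ lemma a p b t ⟩
    m * t                           ∎
    where
    open ≤-Reasoning
    lemma : ∀ a p b t → a * t + (1 + p) * (b * t) ≡ (a + (1 + p) * b) * t
    lemma = solve-∀

  bottle-size : ∀ {t K} → Bottle t K → ∑∑ K (λ _ → 1) ≡ m * t
  bottle-size {t} {K} BK = begin
    ∑ (neck K) (λ _ → 1) + ∑ bodies (λ j → ∑ (body K j) (λ _ → 1))
      ≡⟨ cong₂ _+_ (trans (∑-1 (neck K)) (neck-length BK))
          (trans (∑-cong bodies (λ j → trans (∑-1 (body K j)) (body-length BK j))) (∑-allFin-const (suc p) (b * t))) ⟩
    a * t + suc p * (b * t)         ≡⟨ lemma a p b t ⟩
    m * t                           ∎
    where
    open ≡-Reasoning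
    lemma : ∀ a p b t → a * t + (1 + p) * (b * t) ≡ (a + (1 + p) * b) * t
    lemma = solve-∀

  -- Useful and used tiles are charged with their whole weight, as `x` may be adjacent to all of
  -- such a tile; for every other tile `bound-⊓` applies.
  tile-bound : a ≤ b → ∀ x {K} → Valid K →
    e * (b * degᴷ x (shape K)) ≤
      e * (p * b) * (b * scale K) + e * a * (lowᴷ x (shape K) ⊓ (b * scale K)) + 2 * (b * weight K)
      + e * (b * (usefulWeight x K + usedWeight K))
  tile-bound a≤b x {K} BK = cases (usefulTile? x K) BK
    where
    whole : ∀ {s w} y → Bottle s (shape K) → m * s ≤ w → e * (b * degᴷ x (shape K)) ≤ y + e * (b * w)
    whole y BK h = ≤-trans (*-monoʳ-≤ e (*-monoʳ-≤ b (≤-trans (∑∑≤ BK (adj G x)) h))) (m≤n+m _ y)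
    cases : ∀ {u} (d : Dec (u ≡ false × Useful (ρ * t) x (shape K))) → let s = if u then t else ρ * t in
      Bottle s (shape K) →
      e * (b * degᴷ x (shape K)) ≤
        e * (p * b) * (b * s) + e * a * (lowᴷ x (shape K) ⊓ (b * s)) + 2 * (b * (m * s))
        + e * (b * (⟦ does d ⟧ * (m * s) + ⟦ u ⟧ * (m * s)))
    cases (yes _)         BK = whole _ BK (≤-trans (≤-reflexive (sym (*-identityˡ _))) (m≤m+n _ _))
    cases {true}  (no _)  BK = whole _ BK (≤-reflexive (sym (*-identityˡ (m * t))))
    cases {false} (no ¬u) BK = ≤-trans (UselessBound.bound-⊓ BK a≤b (λ u → ¬u (refl , u))) (m≤m+n _ _)

  totalWeight usedTotal : List Tile → ℕ
  totalWeight tiles = ∑ tiles weight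
  usedTotal tiles = ∑ tiles usedWeight

  useful capped : V → List Tile → ℕ
  useful x tiles = ∑ tiles (usefulWeight x)
  capped x tiles = ∑ tiles (λ K → lowᴷ x (shape K) ⊓ (b * scale K))

  module _ (tiles : List Tile) (x : V) where

    capped≤low : capped x tiles ≤ ∑ tiles (λ K → lowᴷ x (shape K))
    capped≤low = ∑-mono tiles (λ K → m⊓n≤m _ _)

    m*capped≤ : m * capped x tiles ≤ b * totalWeight tiles
    m*capped≤ = begin
      m * capped x tiles ≡⟨ ∑-*ˡ tiles m _ ⟨
      ∑ tiles (λ K → m * (lowᴷ x (shape K) ⊓ (b * scale K)))
        ≤⟨ ∑-mono tiles (λ K → ≤-trans (*-monoʳ-≤ m (m⊓n≤n (lowᴷ x (shape K)) _)) (≤-reflexive (lemma m b (scale K)))) ⟩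
      ∑ tiles (λ K → b * weight K) ≡⟨ ∑-*ˡ tiles b weight ⟩
      b * totalWeight tiles ∎
      where
      open ≤-Reasoning
      lemma : ∀ m b t → m * (b * t) ≡ b * (m * t)
      lemma = solve-∀

    tiles-bound : a ≤ b → All Valid tiles →
      e * (b * (m * ∑ tiles (λ K → degᴷ x (shape K)))) ≤
        e * (p * b) * (b * totalWeight tiles) + e * a * (m * capped x tiles) + 2 * (b * (m * totalWeight tiles))
        + e * (b * (m * (useful x tiles + usedTotal tiles)))
    tiles-bound a≤b valid = subst₂ _≤_ (eqˡ tiles) (eqʳ tiles) (∑-mono-∈ tiles (λ K∈ → *-monoʳ-≤ m (tile-bound a≤b x (All.lookup valid K∈))))
      where
      D Z : Tile → ℕ
      D K = degᴷ x (shape K)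
      Z K = lowᴷ x (shape K) ⊓ (b * scale K)
      rhs : ℕ → ℕ → ℕ → ℕ → ℕ → ℕ
      rhs w z v u f = e * (p * b) * (b * w) + e * a * (m * z) + 2 * (b * (m * v)) + e * (b * (m * (u + f)))
      eqˡ : ∀ xs → ∑ xs (λ K → m * (e * (b * D K))) ≡ e * (b * (m * ∑ xs D))
      eqˡ xs = trans (∑-cong xs (λ K → lemma m e b (D K))) (trans (∑-*ˡ xs (e * b * m) D) (lemma′ m e b (∑ xs D)))
        where
        lemma : ∀ m e b d → m * (e * (b * d)) ≡ e * b * m * d
        lemma = solve-∀
        lemma′ : ∀ m e b d → e * b * m * d ≡ e * (b * (m * d))
        lemma′ = solve-∀
      eqʳ : ∀ xs → ∑ xs (λ K → m * (e * (p * b) * (b * scale K) + e * a * Z K + 2 * (b * weight K)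
                                   + e * (b * (usefulWeight x K + usedWeight K))))
          ≡ rhs (∑ xs weight) (∑ xs Z) (∑ xs weight) (∑ xs (usefulWeight x)) (∑ xs usedWeight)
      eqʳ []       = lemma a b p e m
        where
        lemma : ∀ a b p e m → 0 ≡ e * (p * b) * (b * 0) + e * a * (m * 0) + 2 * (b * (m * 0)) + e * (b * (m * (0 + 0)))
        lemma = solve-∀
      eqʳ (K ∷ xs) = trans (cong (_ +_) (eqʳ xs))
        (lemma a b p e m (scale K) (Z K) (usefulWeight x K) (usedWeight K)
          (∑ xs weight) (∑ xs Z) (∑ xs (usefulWeight x)) (∑ xs usedWeight))
        where
        lemma : ∀ a b p e m s z u f w′ z′ u′ f′ →
          m * (e * (p * b) * (b * s) + e * a * z + 2 * (b * (m * s)) + e * (b * (u + f)))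
          + (e * (p * b) * (b * w′) + e * a * (m * z′) + 2 * (b * (m * w′)) + e * (b * (m * (u′ + f′))))
          ≡ e * (p * b) * (b * (m * s + w′)) + e * a * (m * (z + z′)) + 2 * (b * (m * (m * s + w′)))
          + e * (b * (m * (u + u′ + (f + f′))))
        lemma = solve-∀

-- Partial tilings and the degree condition left for the uncovered set

module States {n : ℕ} (G : Graph n) (p a b E : ℕ) (μ : Fin n → ℕ) (ρ t : ℕ) where
  open import Data.Nat using (_<_)

  open Sums
  open Bottles G p a b
  open Arith
  open Counting G p a b E μ ρ t

  vertices : List V
  vertices = allFin n

  record State : Set where
    constructor state
    field
      tiles     : List Tile
      uncovered : List V
      valid     : All Valid tiles
      partition : ∀ f → ∑ tiles (λ K → ∑∑ (shape K) f) + ∑ uncovered f ≡ ∑ vertices f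

  open State public

  <⇒low : ∀ x v → (4 * E) * μ v < (4 * E) * μ x + n → low x v ≡ true
  <⇒low x v h with high x v in eq
  ... | false = refl
  ... | true  = ⊥-elim (<⇒≱ h (true-≤ eq))

  low⇒< : ∀ x v → low x v ≡ true → (4 * E) * μ v < (4 * E) * μ x + n
  low⇒< x v h = ≤ᵇ-false (not-true h)

  below : V → V → Bool
  below x v = μ v ≤ᵇ μ x

  below⇒low : 0 < n → ∀ x v → below x v ≡ true → low x v ≡ true
  below⇒low 0<n x v h = <⇒low x v (≤-<-trans (*-monoʳ-≤ (4 * E) (true-≤ h)) (m<m+n _ 0<n))

  -- Divided by `E * m * b`, the first reads: the degree of `x` is at least `p * b * n / m + a * μ x
  -- / (m * b) + n / E`, which for `μ x = m * rank` has slope `a /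
  -- b` in the rank. The second says that `μ / m` behaves like a rank below the cap: at most
  -- `y / (c * m)` vertices have `c * μ z < y`.
  DegreeBound RankBound : Set
  DegreeBound = ∀ x → E * (p * b * (b * n) + a * μ x) + m * (b * n) ≤ E * (m * (b * # (adj G x) vertices))
  RankBound = ∀ c y → y ≤ c * (b * n) → c * (m * # (λ z → suc (c * μ z) ≤ᵇ y) vertices) ≤ y

  module _ (S : State) where

    ℓ : ℕ
    ℓ = length (uncovered S)

    rankIn degIn : V → ℕ
    rankIn x = # (below x) (uncovered S)
    degIn x = # (adj G x) (uncovered S)

    totalWeight+ℓ : totalWeight (tiles S) + ℓ ≡ n
    totalWeight+ℓ = begin
      totalWeight (tiles S) + ℓ
        ≡⟨ cong₂ _+_ (∑-cong-∈ (tiles S) (λ K∈ → bottle-size (All.lookup (valid S) K∈))) (∑-1 (uncovered S)) ⟨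
      ∑ (tiles S) (λ K → ∑∑ (shape K) (λ _ → 1)) + ∑ (uncovered S) (λ _ → 1)
        ≡⟨ partition S (λ _ → 1) ⟩
      ∑ vertices (λ _ → 1) ≡⟨ trans (∑-1 vertices) (length-allFin n) ⟩
      n ∎
      where open ≡-Reasoning

    module _ (a≤b : a ≤ b) (1≤b : 1 ≤ b) (0<n : 0 < n) (degreeBound : DegreeBound) (rankBound : RankBound) (x : V) where

      private
        T Z M : ℕ
        T = totalWeight (tiles S)
        Z = capped x (tiles S)
        M = (m * rankIn x) ⊓ (b * ℓ)

      -- The low vertices in the tiles and the vertices below `x` in the uncovered set are disjoint
      -- sets of low vertices, so `rankBound` limits their number. If the threshold exceeds the cap,
      -- the two caps add up to `b * n` and suffice.
      low-bound : (4 * E) * (m * Z + M) ≤ (4 * E) * μ x + n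
      low-bound with (4 * E) * μ x + n ≤? (4 * E) * (b * n)
      ... | yes h = begin
        (4 * E) * (m * Z + M)
          ≤⟨ *-monoʳ-≤ (4 * E) (+-mono-≤ (*-monoʳ-≤ m (capped≤low (tiles S) x))
               (≤-trans (m⊓n≤m _ _) (*-monoʳ-≤ m (∑-mono (uncovered S) (λ v → ⟦⟧-mono (below⇒low 0<n x v)))))) ⟩
        (4 * E) * (m * ∑ (tiles S) (λ K → lowᴷ x (shape K)) + m * # (low x) (uncovered S))
          ≡⟨ cong ((4 * E) *_) (trans (sym (*-distribˡ-+ m _ (# (low x) (uncovered S)))) (cong (m *_) (partition S (λ v → ⟦ low x v ⟧)))) ⟩
        (4 * E) * (m * # (low x) vertices)
          ≤⟨ *-monoʳ-≤ (4 * E) (*-monoʳ-≤ m (∑-mono vertices (λ v → ⟦⟧-mono (λ l → ≤ᵇ-true (low⇒< x v l))))) ⟩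
        (4 * E) * (m * # (λ z → suc ((4 * E) * μ z) ≤ᵇ (4 * E) * μ x + n) vertices)
          ≤⟨ rankBound (4 * E) _ h ⟩
        (4 * E) * μ x + n ∎
        where open ≤-Reasoning
      ... | no ¬h = begin
        (4 * E) * (m * Z + M)
          ≤⟨ *-monoʳ-≤ (4 * E) (+-mono-≤ (m*capped≤ (tiles S) x) (m⊓n≤n (m * rankIn x) (b * ℓ))) ⟩
        (4 * E) * (b * T + b * ℓ)  ≡⟨ cong ((4 * E) *_) (trans (sym (*-distribˡ-+ b T ℓ)) (cong (b *_) totalWeight+ℓ)) ⟩
        (4 * E) * (b * n)          ≤⟨ <⇒≤ (≰⇒> ¬h) ⟩
        (4 * E) * μ x + n          ∎
        where open ≤-Reasoning

      -- If x admits few moves, then it satisfies the degree sequence condition inside the uncovered set,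
      -- where its rank is now counted.
      stuck : e * useful x (tiles S) ≤ n → e * usedTotal (tiles S) ≤ n →
        (4 * E) * (p * b * (b * ℓ) + a * M) + m * (b * n) ≤ (4 * E) * (m * (b * degIn x))
      stuck hu hf = *-cancelˡ-≤ 2 (stuck-arith a b p E n T ℓ (μ x) (# (adj G x) vertices) (degIn x)
        (∑ (tiles S) (λ K → degᴷ x (shape K)))
        (usedTotal (tiles S)) (useful x (tiles S)) Z M
        (degreeBound x)
        (≤-reflexive (trans (sym (partition S (λ v → ⟦ adj G x v ⟧))) (+-comm (∑ (tiles S) (λ K → degᴷ x (shape K))) (degIn x))))
        (tiles-bound (tiles S) x a≤b (valid S))
        low-bound (≤-reflexive totalWeight+ℓ) (≤-reflexive totalWeight+ℓ) hu hf 1≤b)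

-- The potential and the bookkeeping of a move

module Step {n : ℕ} (G : Graph n) (p a b E : ℕ) (μ : Fin n → ℕ) (ρ t : ℕ) where
  open import Data.Nat using (_<_)

  open Sums
  open Bottles G p a b
  open Arith
  open Counting G p a b E μ ρ t
  open States G p a b E μ ρ t

  open Pick

  -- Uncovered vertices of small rank are expensive. The first summand `b * n` keeps the weight at
  -- least `n` even at the cap, so covering a vertex always pays; the factor `4 * E` turns the
  -- margin of `high` into `n`.
  wt : V → ℕ
  wt x = (4 * E) * (b * n + (b * n ∸ μ x))

  potential : State → ℕ
  potential S = ∑ (uncovered S) wt

  -- The weight of the used tiles is added so that a phase cannot end without a drop of the potential.
  progress : ℕ → State → ℕ
  progress d S = (1 + m * ρ + d) * potential S + n * usedTotal (tiles S)

  wt-gap : (∀ x → μ x ≤ b * n) → ∀ x z → high x z ≡ true → wt z + n ≤ wt x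
  wt-gap μ≤ x z h = +-cancelʳ-≤ ((4 * E) * μ x) _ _ (begin
    wt z + n + (4 * E) * μ x    ≡⟨ lemma (wt z) n _ ⟩
    wt z + ((4 * E) * μ x + n)  ≤⟨ +-monoʳ-≤ (wt z) (true-≤ h) ⟩
    wt z + (4 * E) * μ z        ≡⟨ complement z ⟩
    (4 * E) * (b * n + b * n)   ≡⟨ complement x ⟨
    wt x + (4 * E) * μ x        ∎)
    where
    open ≤-Reasoning
    lemma : ∀ x y z → x + y + z ≡ x + (z + y)
    lemma = solve-∀
    complement : ∀ v → wt v + (4 * E) * μ v ≡ (4 * E) * (b * n + b * n)
    complement v = trans (sym (*-distribˡ-+ (4 * E) _ (μ v)))
      (cong ((4 * E) *_) (trans (+-assoc (b * n) _ (μ v)) (cong (b * n +_) (m∸n+n≡m (μ≤ v)))))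

  n≤wt : 0 < E → 0 < b → ∀ x → n ≤ wt x
  n≤wt 0<E 0<b x = begin
    n           ≡⟨ trans (*-identityˡ (1 * n)) (*-identityˡ n) ⟨
    1 * (1 * n) ≤⟨ *-mono-≤ (*-mono-≤ (s≤s (z≤n {3})) 0<E) (≤-trans (*-monoˡ-≤ n 0<b) (m≤m+n (b * n) _)) ⟩
    wt x        ∎
    where open ≤-Reasoning

  ∑-gap : ∀ (A Z : List V) → length A ≡ length Z → (∀ {x z} → x ∈ A → z ∈ Z → wt z + n ≤ wt x) →
          ∑ Z wt + n * length A ≤ ∑ A wt
  ∑-gap []      []      _ h = ≤-reflexive (*-zeroʳ n)
  ∑-gap (x ∷ A) (z ∷ Z) e h = begin
    wt z + ∑ Z wt + n * suc (length A)      ≡⟨ lemma (wt z) (∑ Z wt) n (length A) ⟩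
    wt z + n + (∑ Z wt + n * length A)
      ≤⟨ +-mono-≤ (h (here refl) (here refl)) (∑-gap A Z (suc-injective e) (λ x∈ z∈ → h (there x∈) (there z∈))) ⟩
    wt x + ∑ A wt                           ∎
    where
    open ≤-Reasoning
    lemma : ∀ w s n l → w + s + n * (1 + l) ≡ w + n + (s + n * l)
    lemma = solve-∀

  module _ (S : State) {P : Tile → Set} (X : Extract (tiles S) P)
    (K-unused : used (Extract.elem X) ≡ false) where

    private
      K : Tile
      K = Extract.elem X
      others : List Tile
      others = Extract.others X

    K-valid : Bottle (ρ * t) (shape K)
    K-valid = subst (λ u → Bottle (if u then t else ρ * t) (shape K)) K-unused (All.lookup (valid S) (Extract.elem∈ X))

    -- The common end of both moves: `A` becomes covered and `Z` is released. `Z` is empty for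
    -- `gain` and a part of a body for `swap`; either way the potential falls by `n` per vertex of
    -- `A`.
    replace : ∀ {c d} (A : Pick (uncovered S) (c * t)) (Z : List V) (Ks : List Parts) → All (Bottle t) Ks →
              (∀ f → ∑ Ks (λ K → ∑∑ K f) + ∑ Z f ≡ ∑∑ (shape K) f + ∑ (chosen A) f) →
              ∑ Z wt + n * (c * t) ≤ ∑ (chosen A) wt → 0 < c → c ≤ d → 0 < n → 0 < t →
              Σ State λ S′ → progress d S′ < progress d S
    replace {c} {d} A Z Ks BKs exchange gap 0<c c≤d 0<n 0<t = S′ , decreases
      where
      new : List Tile
      new = map (tile true) Ks
      ∑-new : ∀ f → ∑ new (λ K → ∑∑ (shape K) f) ≡ ∑ Ks (λ K → ∑∑ K f)
      ∑-new f = ∑-map (tile true) Ks (λ K → ∑∑ (shape K) f)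
      S′ : State
      S′ = state (new ++ others) (Z ++ rest A)
        (Allₚ.++⁺ (Allₚ.map⁺ BKs) (All.tabulate (λ K∈ → All.lookup (valid S) (Extract.others⊆ X K∈))))
        λ f → begin
          ∑ (new ++ others) (λ K → ∑∑ (shape K) f) + ∑ (Z ++ rest A) f
            ≡⟨ cong₂ _+_ (trans (∑-++ new others _) (cong (_+ ∑ others (λ K → ∑∑ (shape K) f)) (∑-new f))) (∑-++ Z (rest A) f) ⟩
          ∑ Ks (λ K → ∑∑ K f) + ∑ others (λ K → ∑∑ (shape K) f) + (∑ Z f + ∑ (rest A) f)
            ≡⟨ shuffle (∑ Ks (λ K → ∑∑ K f)) (∑ others (λ K → ∑∑ (shape K) f)) (∑ Z f) (∑ (rest A) f) ⟩
          ∑ Ks (λ K → ∑∑ K f) + ∑ Z f + (∑ others (λ K → ∑∑ (shape K) f) + ∑ (rest A) f)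
            ≡⟨ cong (_+ (∑ others (λ K → ∑∑ (shape K) f) + ∑ (rest A) f)) (exchange f) ⟩
          ∑∑ (shape K) f + ∑ (chosen A) f + (∑ others (λ K → ∑∑ (shape K) f) + ∑ (rest A) f)
            ≡⟨ shuffle (∑∑ (shape K) f) (∑ (chosen A) f) (∑ others (λ K → ∑∑ (shape K) f)) (∑ (rest A) f) ⟩
          ∑∑ (shape K) f + ∑ others (λ K → ∑∑ (shape K) f) + (∑ (chosen A) f + ∑ (rest A) f)
            ≡⟨ cong₂ _+_ (Extract.split X (λ K → ∑∑ (shape K) f)) (split A f) ⟨
          ∑ (tiles S) (λ K → ∑∑ (shape K) f) + ∑ (uncovered S) f
            ≡⟨ partition S f ⟩
          ∑ vertices f ∎
        where
        open ≡-Reasoning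
        shuffle : ∀ a b c d → a + b + (c + d) ≡ a + c + (b + d)
        shuffle = solve-∀
      -- The weight of a tile is its number of vertices, and the new tiles consist of vertices of
      -- `K` and `A` only.
      new-weight : ∑ new usedWeight ≤ m * ρ * t + c * t
      new-weight = begin
        ∑ new usedWeight                        ≡⟨ ∑-map (tile true) Ks usedWeight ⟩
        ∑ Ks (λ K → 1 * (m * t))                ≡⟨ ∑-cong-∈ Ks (λ K∈ → trans (*-identityˡ (m * t)) (sym (bottle-size (All.lookup BKs K∈)))) ⟩
        ∑ Ks (λ K → ∑∑ K (λ _ → 1))             ≤⟨ m≤m+n _ (∑ Z (λ _ → 1)) ⟩
        ∑ Ks (λ K → ∑∑ K (λ _ → 1)) + ∑ Z (λ _ → 1) ≡⟨ exchange (λ _ → 1) ⟩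
        ∑∑ (shape K) (λ _ → 1) + ∑ (chosen A) (λ _ → 1)
          ≡⟨ cong₂ _+_ (trans (bottle-size K-valid) (sym (*-assoc m ρ t))) (trans (∑-1 (chosen A)) (chosen-length A)) ⟩
        m * ρ * t + c * t ∎
        where open ≤-Reasoning
      used-bound : usedTotal (new ++ others) ≤ usedTotal (tiles S) + (m * ρ * t + c * t)
      used-bound = begin
        usedTotal (new ++ others)           ≡⟨ ∑-++ new others usedWeight ⟩
        ∑ new usedWeight + ∑ others usedWeight ≤⟨ +-mono-≤ new-weight (≤-trans (m≤n+m (∑ others usedWeight) (usedWeight K)) (≤-reflexive (sym (Extract.split X usedWeight)))) ⟩
        m * ρ * t + c * t + usedTotal (tiles S) ≡⟨ +-comm _ (usedTotal (tiles S)) ⟩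
        usedTotal (tiles S) + (m * ρ * t + c * t) ∎
        where open ≤-Reasoning
      decreases : progress d S′ < progress d S
      decreases = subst₂ (λ x y → (1 + m * ρ + d) * x + n * usedTotal (tiles S′) < (1 + m * ρ + d) * y + n * usedTotal (tiles S))
        (sym (∑-++ Z (rest A) wt)) (sym (split A wt))
        (progress-arith (∑ (chosen A) wt) (∑ Z wt) (∑ (rest A) wt) n c t d (m * ρ) (usedTotal (tiles S)) (usedTotal (tiles S′))
          gap used-bound 0<c 0<c c≤d (*-mono-≤ 0<n 0<t))

-- Carrying out a move at one bottle

module Gadget {n : ℕ} (G : Graph n) (p a b E : ℕ) (μ : Fin n → ℕ) (ρ t : ℕ) where
  open import Data.Nat using (_<_)

  open Sums
  open Bottles G p a b
  open Arith
  open Counting G p a b E μ ρ t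
  open States G p a b E μ ρ t
  open Step G p a b E μ ρ t

  open Pick

  -- Adjacency decides whether vertices can be built into the bottle, `high` whether an exchange
  -- pays. With both constant on the chosen set, whatever one representative `x₀` satisfies holds
  -- for all of it.
  patterns : Parts → List (V → Bool)
  patterns K = map (λ v x → adj G x v) (verts K) ++ map (λ v x → high x v) (verts K)

  length-patterns : ∀ {s K} → Bottle s K → length (patterns K) ≡ m * s + m * s
  length-patterns {s} {K} BK = trans (length-++ (map (λ v x → adj G x v) (verts K)))
    (cong₂ _+_ (trans (length-map _ (verts K)) count) (trans (length-map _ (verts K)) count))
    where
    count : length (verts K) ≡ m * s
    count = trans (sym (∑-1 (verts K))) (trans (∑-verts K (λ _ → 1)) (bottle-size BK))

  module _ (0<n : 0 < n) (0<t : 0 < t) (0<E : 0 < E) (0<a : 0 < a) (0<b : 0 < b) (μ≤ : ∀ x → μ x ≤ b * n)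
    {ρ₁ ρ₂ : ℕ} (ρ≡₁ : ρ ≡ 1 + ρ₁) (ρ≡₂ : ρ ≡ (a + p * b) + ρ₂) (eu≤ρ : e * (a + p * b) ≤ ρ)
    {α : ℕ} (0<α : 0 < α) (αa : α + a * (a + p * b) ≡ suc p * (b * b))
    where

    private
      u : ℕ
      u = a + p * b
      0<u : 0 < u
      0<u = ≤-trans 0<a (m≤m+n a (p * b))
      instance
        e≢0 : NonZero e
        e≢0 = >-nonZero (*-mono-< (s≤s (z≤n {7})) 0<E)

    -- This is the origin of the condition `e * u ≤ ρ`: a proportion `1 / e` of a part of scale
    -- `ρ * t` still contains a part of any scale `s * t` with `s ≤ u`.
    dense⇒enough : ∀ c {g} s → s ≤ u → c * (ρ * t) ≤ e * g → c * (s * t) ≤ g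
    dense⇒enough c {g} s s≤u h = *-cancelˡ-≤ e (begin
      e * (c * (s * t)) ≡⟨ lemma e c s t ⟩
      c * (e * s * t)   ≤⟨ *-monoʳ-≤ c (*-monoˡ-≤ t (≤-trans (*-monoʳ-≤ e s≤u) eu≤ρ)) ⟩
      c * (ρ * t)       ≤⟨ h ⟩
      e * g             ∎)
      where
      open ≤-Reasoning
      lemma : ∀ e c s t → e * (c * (s * t)) ≡ c * (e * s * t)
      lemma = solve-∀

    dense⇒enough₁ : ∀ c {g} → c * (ρ * t) ≤ e * g → c * t ≤ g
    dense⇒enough₁ c {g} h = subst (λ z → c * z ≤ g) (*-identityˡ t) (dense⇒enough c 1 0<u h)

    module _ (S : State) {P : Tile → Set} (X : Extract (tiles S) P) (unused : used (Extract.elem X) ≡ false) where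

      private
        K : Parts
        K = shape (Extract.elem X)
        BK : Bottle (ρ * t) K
        BK = K-valid S X unused
        d : ℕ
        d = b + α
        Better : Set
        Better = Σ State λ S′ → progress d S′ < progress d S

      module _ (Q : Pick (uncovered S) (d * t))
        (same-adj  : ∀ {x y v} → v ∈ verts K → x ∈ chosen Q → y ∈ chosen Q → adj G x v ≡ adj G y v)
        (same-high : ∀ {x y v} → v ∈ verts K → x ∈ chosen Q → y ∈ chosen Q → high x v ≡ high y v)
        {x₀ : V} (x₀∈ : x₀ ∈ chosen Q)
        where

        -- Only the representative reveals which move applies, so `d = b + α` units are collected
        -- beforehand: `swap` takes `b` of them and `gain` takes `α`.
        part : ∀ c → c ≤ d → Σ (Pick (uncovered S) (c * t)) λ A → ∀ {x} → x ∈ chosen A → x ∈ chosen Q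
        part c c≤d = mkPick (chosen R) (rest R ++ rest Q) (chosen-length R)
          (λ f → trans (split Q f) (trans (cong (_+ ∑ (rest Q) f) (split R f))
            (trans (+-assoc (∑ (chosen R) f) _ _) (cong (∑ (chosen R) f +_) (sym (∑-++ (rest R) (rest Q) f))))))
          (chosen⊆ Q ∘ chosen⊆ R)
          rest′⊆ , chosen⊆ R
          where
          R : Pick (chosen Q) (c * t)
          R = pickAny (chosen Q) (c * t) (≤-trans (*-monoˡ-≤ t c≤d) (≤-reflexive (sym (chosen-length Q))))
          rest′⊆ : ∀ {x} → x ∈ rest R ++ rest Q → x ∈ uncovered S
          rest′⊆ x∈ with Data.List.Membership.Propositional.Properties.∈-++⁻ (rest R) x∈
          ... | inj₁ x∈R = chosen⊆ Q (rest⊆ R x∈R)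
          ... | inj₂ x∈Q = rest⊆ Q x∈Q

        swapStep : Swappable (ρ * t) x₀ K → Better
        swapStep (neckDense , j , bodyDense , highDense) =
          let Ks , BKs , exchange = swap {ρ₁} {t} (subst (λ r → Bottle r K) (cong (_* t) ρ≡₁) BK) j
                (proj₁ N) (proj₁ ∘ B) (chosen A) (chosen-length A)
                (λ x∈ y∈ → trans (same-adj (neck⊆verts K (chosen⊆ (proj₁ N) y∈)) (A⊆Q x∈) x₀∈) (proj₂ N y∈))
                (λ {i} i≢j x∈ y∈ → trans (same-adj (body⊆verts K i (chosen⊆ (proj₁ (B i)) y∈)) (A⊆Q x∈) x₀∈) (proj₁ (proj₂ (B i)) i≢j y∈))
          in replace S X unused {b} {d} A (chosen (proj₁ (B j))) Ks BKs exchange gap 0<b (m≤m+n b α) 0<n 0<t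
          where
          A = proj₁ (part b (m≤m+n b α))
          A⊆Q : ∀ {x} → x ∈ chosen A → x ∈ chosen Q
          A⊆Q = proj₂ (part b (m≤m+n b α))
          N = pick# (adj G x₀) (neck K) (a * t) (dense⇒enough₁ a neckDense)
          -- In body `j` the vertices to be released are selected by rank; in the other bodies
          -- neighbours of `x₀` are selected.
          B : ∀ i → Σ (Pick (body K i) (b * t)) λ B →
                (i ≢ j → ∀ {x} → x ∈ chosen B → Adj x₀ x) × (i ≡ j → ∀ {x} → x ∈ chosen B → high x₀ x ≡ true)
          B i with i ≟ᶠ j
          ... | yes refl = let B , h = pick# (high x₀) (body K i) (b * t) (dense⇒enough₁ b highDense)
                           in B , (λ i≢i → ⊥-elim (i≢i refl)) , (λ _ → h)
          ... | no i≢j   = let B , h = pick# (adj G x₀) (body K i) (b * t) (dense⇒enough₁ b (bodyDense i i≢j))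
                           in B , (λ _ → h) , (λ i≡j → ⊥-elim (i≢j i≡j))
          gap : ∑ (chosen (proj₁ (B j))) wt + n * (b * t) ≤ ∑ (chosen A) wt
          gap = subst (λ z → ∑ (chosen (proj₁ (B j))) wt + n * z ≤ ∑ (chosen A) wt) (chosen-length A)
            (∑-gap (chosen A) (chosen (proj₁ (B j))) (trans (chosen-length A) (sym (chosen-length (proj₁ (B j)))))
              λ {x} {z} x∈ z∈ → wt-gap μ≤ x z (trans (same-high (body⊆verts K j (chosen⊆ (proj₁ (B j)) z∈)) (A⊆Q x∈) x₀∈)
                (proj₂ (proj₂ (B j)) refl z∈)))

        gainStep : (∀ j → BodyDense (ρ * t) x₀ K j) → Better
        gainStep bodyDense = finish
            (gain {ρ₂} (subst (λ r → Bottle r K) (trans (cong (_* t) ρ≡₂) (*-distribʳ-+ t u ρ₂)) BK)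
              N (proj₁ ∘ B) (chosen A) (chosen-length A) αa
              (λ {i} x∈ y∈ → trans (same-adj (body⊆verts K i (chosen⊆ (proj₁ (B i)) y∈)) (A⊆Q x∈) x₀∈) (proj₂ (B i) y∈)))
          where
          A = proj₁ (part α (m≤n+m α b))
          A⊆Q : ∀ {x} → x ∈ chosen A → x ∈ chosen Q
          A⊆Q = proj₂ (part α (m≤n+m α b))
          -- The neck is going to share a part with `A`, so an arbitrary piece of it serves.
          N : Pick (neck K) (a * (u * t))
          N = pickAny (neck K) (a * (u * t)) (≤-trans (*-monoʳ-≤ a (*-monoˡ-≤ t (≤-trans (m≤m+n u ρ₂) (≤-reflexive (sym ρ≡₂)))))
                (≤-reflexive (sym (neck-length BK))))
          B : ∀ i → Σ (Pick (body K i) (b * (u * t))) λ B → ∀ {x} → x ∈ chosen B → Adj x₀ x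
          B i = pick# (adj G x₀) (body K i) (b * (u * t)) (dense⇒enough b u ≤-refl (bodyDense i))
          gap : 0 + n * (α * t) ≤ ∑ (chosen A) wt
          gap = begin
            n * (α * t)                ≡⟨ *-comm n (α * t) ⟩
            α * t * n                  ≡⟨ cong (_* n) (chosen-length A) ⟨
            length (chosen A) * n      ≡⟨ ∑-const (chosen A) n ⟨
            ∑ (chosen A) (λ _ → n)     ≤⟨ ∑-mono (chosen A) (n≤wt 0<E 0<b) ⟩
            ∑ (chosen A) wt            ∎
            where open ≤-Reasoning
          finish : Chopped t (λ f → ∑∑ K f + ∑ (chosen A) f) → Better
          finish (Ks , BKs , exchange) =
            replace S X unused {α} {d} A [] Ks BKs (λ f → trans (+-identityʳ _) (exchange f)) gap 0<α (m≤n+m α b) 0<n 0<t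

      improve : d * t * 2 ^ (m * (ρ * t) + m * (ρ * t)) ≤ # (λ x → does (usefulTile? x (Extract.elem X))) (uncovered S) → Better
      improve enough = go (pigeonhole (patterns K) (λ x → does (usefulTile? x (Extract.elem X))) (uncovered S) (d * t)
          (subst (λ z → d * t * 2 ^ z ≤ # (λ x → does (usefulTile? x (Extract.elem X))) (uncovered S)) (sym (length-patterns BK)) enough))
        where
        go : (Σ (Pick (uncovered S) (d * t)) λ Q → (∀ {x} → x ∈ chosen Q → does (usefulTile? x (Extract.elem X)) ≡ true)
               × (∀ {T} → T ∈ patterns K → Constant T (chosen Q))) → Better
        go (Q , useful , const) = step (chosen Q) refl
          where
          same-adj : ∀ {x y v} → v ∈ verts K → x ∈ chosen Q → y ∈ chosen Q → adj G x v ≡ adj G y v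
          same-adj v∈ = const (∈-++⁺ˡ (∈-map⁺ (λ v x → adj G x v) v∈))
          same-high : ∀ {x y v} → v ∈ verts K → x ∈ chosen Q → y ∈ chosen Q → high x v ≡ high y v
          same-high v∈ = const (∈-++⁺ʳ (map (λ v x → adj G x v) (verts K)) (∈-map⁺ (λ v x → high x v) v∈))
          step : ∀ xs → chosen Q ≡ xs → Better
          step [] eq = ⊥-elim (<⇒≱ (*-mono-< (≤-trans 0<b (m≤m+n b α)) 0<t)
            (≤-reflexive (trans (sym (chosen-length Q)) (cong length eq))))
          step (x₀ ∷ _) eq = [ gainStep Q same-adj same-high x₀∈ , swapStep Q same-adj same-high x₀∈ ]′
              (proj₂ (≡true (usefulTile? x₀ (Extract.elem X)) (useful x₀∈)))
            where
            x₀∈ : x₀ ∈ chosen Q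
            x₀∈ = subst (x₀ ∈_) (sym eq) (here refl)

-- Some move always exists while the uncovered set is large

module Improve {n : ℕ} (G : Graph n) (p a b E : ℕ) (μ : Fin n → ℕ) (ρ t : ℕ) where
  open import Data.Nat using (_<_)

  open Sums
  open Width
  open Bottles G p a b
  open Arith
  open Counting G p a b E μ ρ t
  open States G p a b E μ ρ t
  open Step G p a b E μ ρ t
  open Gadget G p a b E μ ρ t

  -- All vertices satisfying `P` lie below the one of largest `μ`, so the rank of that vertex in `L`
  -- bounds their number.
  rank-count : ∀ (P : V → Bool) L c → (∀ {x} → x ∈ L → P x ≡ true → m * # (below x) L ≤ c) → m * # P L ≤ c
  rank-count P L c h with maximal μ P L
  ... | inj₁ none = subst (λ z → m * z ≤ c) (sym none) (≤-trans (≤-reflexive (*-zeroʳ m)) z≤n)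
  ... | inj₂ (x , x∈ , Px , x-max) = ≤-trans
    (*-monoʳ-≤ m (∑-mono-∈ L (λ y∈ → ⟦⟧-mono (λ Py → ≤ᵇ-true (x-max y∈ Py))))) (h x∈ Px)

  module _ (0<n : 0 < n) (0<t : 0 < t) (0<E : 0 < E) (0<a : 0 < a) (a≤b : a ≤ b) (μ≤ : ∀ x → μ x ≤ b * n)
    {ρ₁ ρ₂ : ℕ} (ρ≡₁ : ρ ≡ 1 + ρ₁) (ρ≡₂ : ρ ≡ (a + p * b) + ρ₂) (eu≤ρ : e * (a + p * b) ≤ ρ)
    {α : ℕ} (0<α : 0 < α) (αa : α + a * (a + p * b) ≡ suc p * (b * b))
    (degreeBound : DegreeBound) (rankBound : RankBound)
    {c Kc : ℕ} (0<c : 0 < c)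
    (enough-tile : Kc * (2 * (m * cost e p (b * (c * (ρ * t))))) ≤ n)
    (enough-improve : Kc * (16 * m * E * ((b + α) * t * 2 ^ (m * (ρ * t) + m * (ρ * t)))) ≤ n)
    (S : State) (large : n < Kc * length (uncovered S)) (few-used : e * usedTotal (tiles S) ≤ n)
    where

    private
      L : List V
      L = uncovered S
      l d need : ℕ
      l = length L
      d = b + α
      need = (b + α) * t * 2 ^ (m * (ρ * t) + m * (ρ * t))
      0<b : 0 < b
      0<b = ≤-trans 0<a a≤b
      0<m : 0 < m
      0<m = ≤-trans 0<a (m≤m+n a _)
      l≤n : l ≤ n
      l≤n = ≤-trans (m≤n+m l (totalWeight (tiles S))) (≤-reflexive (totalWeight+ℓ S))
      instance
        Kc≢0 : NonZero Kc
        Kc≢0 = >-nonZero (lemma Kc large)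
          where
          lemma : ∀ k → n < k * l → 0 < k
          lemma (suc k) _ = s≤s z≤n
      Better : Set
      Better = Σ State λ S′ → progress d S′ < progress d S

    -- For a `top` vertex the minimum in `stuck` is `b * l`. If the vertex is also `tame`, its
    -- degree inside `L` is therefore at least `(a + p * b) * l / m` plus the remaining slack.
    tame top good : V → Bool
    tame x = e * useful x (tiles S) ≤ᵇ n
    top x = b * l ≤ᵇ m * rankIn S x
    good x = tame x ∧ top x

    good-degree : ∀ {x} → good x ≡ true → (4 * E) * ((a + p * b) * l) + m * l ≤ (4 * E) * (m * # (adj G x) L)
    good-degree {x} h = *-cancelˡ-≤ b {{>-nonZero 0<b}} (good-degree-arith a b p E n l (degIn S x) ((m * rankIn S x) ⊓ (b * l))
      (stuck S a≤b 0<b 0<n degreeBound rankBound x (true-≤ (∧-trueˡ h)) few-used)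
      (≤-reflexive (sym (m≥n⇒m⊓n≡n (true-≤ {b * l} (∧-trueʳ {tame x} h)))))
      l≤n)

    low-count : m * # (not ∘ top) L ≤ b * l
    low-count = rank-count (not ∘ top) L (b * l) (λ {x} _ h → <⇒≤ (≤ᵇ-false {b * l} (not-true h)))

    wild : ℕ
    wild = # (not ∘ tame) L

    -- The bottle is built at scale `c * (ρ * t)` and chopped into `c` fresh tiles. The factor `c`
    -- lets this scale be the same in every phase, so that one requirement `enough-tile` covers them
    -- all.
    newTile : 2 * (m * wild) ≤ a * l → Better
    newTile few-wild = insert (Builder.trim G p a b E L {c * (ρ * t)} a≤b (Builder.multipartite G p a b E L 0<E 0<m 0<a good good-degree
        (b * (c * (ρ * t))) (*-mono-< 0<b 0<ct) enough few-bad))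
      where
      0<ρ : 0 < ρ
      0<ρ = ≤-trans (s≤s z≤n) (≤-reflexive (sym ρ≡₁))
      0<ct : 0 < c * (ρ * t)
      0<ct = *-mono-< 0<c (*-mono-< 0<ρ 0<t)
      enough : 2 * (m * cost e p (b * (c * (ρ * t)))) ≤ a * l
      enough = ≤-trans (*-cancelˡ-≤ Kc (≤-trans enough-tile (<⇒≤ large)))
        (≤-trans (≤-reflexive (sym (*-identityˡ l))) (*-monoˡ-≤ l 0<a))
      few-bad : 2 * (m * # (not ∘ good) L) ≤ 2 * (b * l) + a * l
      few-bad = few-bad-arith m b a l wild (# (not ∘ top) L) (# (not ∘ good) L)
        (≤-trans (∑-mono L (λ x → Builder.not-∧≤ G p a b E L (tame x) (top x))) (≤-reflexive (∑-+ L _ _)))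
        few-wild low-count
      insert : (Σ Parts λ K → Bottle (c * (ρ * t)) K × Σ (List V) λ R → ∀ f → ∑ L f ≡ ∑∑ K f + ∑ R f) → Better
      insert (K , BK , R , total) = insert′ (chop c BK)
        where
        insert′ : Chopped (ρ * t) (∑∑ K) → Better
        insert′ (Ks , BKs , chopped) = S′ , decreases
          where
          new : List Tile
          new = map (tile false) Ks
          ∑-new : ∀ f → ∑ new (λ K → ∑∑ (shape K) f) ≡ ∑∑ K f
          ∑-new f = trans (∑-map (tile false) Ks (λ K → ∑∑ (shape K) f)) (chopped f)
          S′ : State
          S′ = state (new ++ tiles S) R (Allₚ.++⁺ (Allₚ.map⁺ BKs) (valid S)) λ f → begin
            ∑ (new ++ tiles S) (λ K → ∑∑ (shape K) f) + ∑ R f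
              ≡⟨ cong (_+ ∑ R f) (trans (∑-++ new (tiles S) _) (cong (_+ ∑ (tiles S) (λ K → ∑∑ (shape K) f)) (∑-new f))) ⟩
            ∑∑ K f + ∑ (tiles S) (λ K → ∑∑ (shape K) f) + ∑ R f
              ≡⟨ lemma (∑∑ K f) (∑ (tiles S) (λ K → ∑∑ (shape K) f)) (∑ R f) ⟩
            ∑ (tiles S) (λ K → ∑∑ (shape K) f) + (∑∑ K f + ∑ R f)
              ≡⟨ cong (∑ (tiles S) (λ K → ∑∑ (shape K) f) +_) (total f) ⟨
            ∑ (tiles S) (λ K → ∑∑ (shape K) f) + ∑ L f
              ≡⟨ partition S f ⟩
            ∑ vertices f ∎
            where
            open ≡-Reasoning
            lemma : ∀ a b c → a + b + c ≡ b + (a + c)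
            lemma = solve-∀
          used≡ : usedTotal (tiles S′) ≡ usedTotal (tiles S)
          used≡ = trans (∑-++ new (tiles S) usedWeight) (cong (_+ usedTotal (tiles S))
            (trans (∑-map (tile false) Ks usedWeight) (trans (∑-const Ks 0) (*-zeroʳ (length Ks)))))
          gained : 0 < ∑∑ K wt
          gained = begin-strict
            0                                <⟨ *-mono-< 0<m 0<ct ⟩
            m * (c * (ρ * t))                ≡⟨ bottle-size BK ⟨
            ∑∑ K (λ _ → 1)                   ≡⟨ ∑-verts K (λ _ → 1) ⟨
            ∑ (verts K) (λ _ → 1)            ≤⟨ ∑-mono (verts K) (λ x → ≤-trans 0<n (n≤wt 0<E 0<b x)) ⟩
            ∑ (verts K) wt                   ≡⟨ ∑-verts K wt ⟩
            ∑∑ K wt                          ∎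
            where open ≤-Reasoning
          decreases : progress d S′ < progress d S
          decreases = subst (λ u → (1 + m * ρ + d) * ∑ R wt + n * u < progress d S) (sym used≡)
            (+-monoˡ-< (n * usedTotal (tiles S)) (*-monoʳ-< (1 + m * ρ + d)
              (subst (∑ R wt <_) (sym (total wt)) (m<n+m (∑ R wt) gained))))

    usersOf : Tile → ℕ
    usersOf K = # (λ x → does (usefulTile? x K)) L

    module _ (many-wild : a * l < 2 * (m * wild)) where

      -- Double counting of pairs of a wild vertex and a tile useful to it: the useful tiles of such
      -- a vertex weigh more than `n / e`. The `1 +` records the strictness, which the averaging in
      -- `popular` needs.
      wild-weight : (1 + n) * wild ≤ ∑ (tiles S) (λ K → e * (weight K * usersOf K))
      wild-weight = begin
        (1 + n) * wild                              ≡⟨ ∑-*ˡ L (1 + n) _ ⟨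
        ∑ L (λ x → (1 + n) * ⟦ not (tame x) ⟧)      ≤⟨ ∑-mono L pointwise ⟩
        ∑ L (λ x → e * useful x (tiles S))          ≡⟨ ∑-*ˡ L e _ ⟩
        e * ∑ L (λ x → useful x (tiles S))          ≡⟨ cong (e *_) (∑-swap L (tiles S) usefulWeight) ⟩
        e * ∑ (tiles S) (λ K → ∑ L (λ x → usefulWeight x K)) ≡⟨ cong (e *_) (∑-cong (tiles S) (λ K →
            trans (∑-cong L (λ x → *-comm ⟦ does (usefulTile? x K) ⟧ (weight K))) (∑-*ˡ L (weight K) _))) ⟩
        e * ∑ (tiles S) (λ K → weight K * usersOf K) ≡⟨ ∑-*ˡ (tiles S) e _ ⟨
        ∑ (tiles S) (λ K → e * (weight K * usersOf K)) ∎
        where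
        open ≤-Reasoning
        pointwise : ∀ x → (1 + n) * ⟦ not (tame x) ⟧ ≤ e * useful x (tiles S)
        pointwise x with tame x in eq
        ... | true  = ≤-trans (≤-reflexive (*-zeroʳ (1 + n))) z≤n
        ... | false = ≤-trans (≤-reflexive (*-identityʳ (1 + n))) (≤ᵇ-false eq)

      0<wild : 0 < wild
      0<wild = positive wild many-wild
        where
        positive : ∀ w → a * l < 2 * (m * w) → 0 < w
        positive zero    h = ⊥-elim (<⇒≱ h (≤-trans (≤-reflexive (cong (2 *_) (*-zeroʳ m))) z≤n))
        positive (suc _) _ = s≤s z≤n

      popular : Any (λ K → wild * weight K < e * (weight K * usersOf K)) (tiles S)
      popular = ∑-avg (tiles S) weight (λ K → e * (weight K * usersOf K)) wild (begin-strict
        wild * totalWeight (tiles S) ≤⟨ *-monoʳ-≤ wild (≤-trans (m≤m+n _ l) (≤-reflexive (totalWeight+ℓ S))) ⟩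
        wild * n                     ≡⟨ *-comm wild n ⟩
        n * wild                     <⟨ m<n+m (n * wild) 0<wild ⟩
        (1 + n) * wild               ≤⟨ wild-weight ⟩
        ∑ (tiles S) (λ K → e * (weight K * usersOf K)) ∎)
        where open ≤-Reasoning

      users-bound : ∀ {K} → wild * weight K < e * (weight K * usersOf K) → need ≤ usersOf K
      users-bound {K} h = *-cancelˡ-≤ (16 * m * E) {{>-nonZero (*-mono-< (*-mono-< (s≤s (z≤n {15})) 0<m) 0<E)}}
        (*-cancelˡ-≤ Kc (need-arith a m E Kc n l wild (usersOf K) need enough-improve (<⇒≤ large)
          (≤-trans (≤-reflexive (sym (*-identityˡ l))) (*-monoˡ-≤ l 0<a)) (<⇒≤ many-wild)
          (<⇒≤ (*-cancelˡ-< (weight K) _ _ (subst₂ _<_ (*-comm wild (weight K)) (lemma e (weight K) (usersOf K)) h)))))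
        where
        lemma : ∀ e w u → e * (w * u) ≡ w * (e * u)
        lemma = solve-∀

      improveTile : Extract (tiles S) (λ K → wild * weight K < e * (weight K * usersOf K)) → Better
      improveTile X = improve 0<n 0<t 0<E 0<a 0<b μ≤ ρ≡₁ ρ≡₂ eu≤ρ 0<α αa S X unused enough
        where
        K = Extract.elem X
        enough : need ≤ usersOf K
        enough = users-bound {K} (Extract.prop X)
        0<need : 0 < need
        0<need = *-mono-< (*-mono-< (≤-trans 0<b (m≤m+n b α)) 0<t) (m^n>0 2 (m * (ρ * t) + m * (ρ * t)))
        -- `usefulTile?` accepts only tiles not yet used in this phase, and `need` is positive, so
        -- some vertex witnesses this for `K`.
        unused : used K ≡ false
        unused = find (pick# (λ x → does (usefulTile? x K)) L 1 (≤-trans 0<need enough))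
          where
          find : Σ (Pick L 1) (λ P → ∀ {x} → x ∈ Pick.chosen P → does (usefulTile? x K) ≡ true) → used K ≡ false
          find (mkPick (x ∷ []) _ _ _ _ _ , h) = proj₁ (≡true (usefulTile? x K) (h (here refl)))

    better : Better
    better with 2 * (m * wild) ≤? a * l
    ... | yes h = newTile h
    ... | no ¬h = improveTile (≰⇒> ¬h) (extract (tiles S) (popular (≰⇒> ¬h)))

-- Grouping the moves into boundedly many phases

module Phases {n : ℕ} (G : Graph n) (p a b E : ℕ) (μ : Fin n → ℕ) (ρ : ℕ) where
  open import Data.Nat using (_<_)

  open Sums
  open Width
  open Bottles G p a b
  open Arith

  module Phase (t : ℕ) where
    open Counting G p a b E μ ρ t public
    open States G p a b E μ ρ t public
    open Step G p a b E μ ρ t public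

  open Phase using (state; tile)

  m e : ℕ
  m = a + suc p * b
  e = 8 * E

  refine : ∀ {t} (tiles : List (Phase.Tile (ρ * t))) → All (Phase.Valid (ρ * t)) tiles →
           Chopped (ρ * t) (λ f → ∑ tiles (λ K → ∑∑ (Phase.shape K) f))
  refine [] [] = [] , [] , λ f → refl
  refine (tile true K ∷ tiles)  (BK ∷ valid) =
    chopped-++ (K ∷ [] , BK ∷ [] , λ f → +-identityʳ (∑∑ K f)) (refine tiles valid)
  refine (tile false K ∷ tiles) (BK ∷ valid) = chopped-++ (chop ρ BK) (refine tiles valid)

  -- Used tiles already have the scale `ρ * t` of fresh tiles in the next phase, and the others are
  -- chopped into `ρ` pieces. The uncovered set stays the same, so `progress` loses exactly its
  -- second term.
  nextPhase : ∀ {t} D (S : Phase.State (ρ * t)) → Σ (Phase.State t) λ S′ →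
              Phase.progress t D S′ + n * Phase.usedTotal (ρ * t) (Phase.tiles S) ≡ Phase.progress (ρ * t) D S
  nextPhase {t} D (state tiles L valid partition) = go (refine tiles valid)
    where
    go : Chopped (ρ * t) (λ f → ∑ tiles (λ K → ∑∑ (Phase.shape K) f)) → _
    go (Ks , BKs , chopped) =
      state (map (tile false) Ks) L (Allₚ.map⁺ BKs)
        (λ f → trans (cong (_+ ∑ L f) (trans (∑-map (tile false) Ks _) (chopped f))) (partition f)) ,
      cong (_+ n * Phase.usedTotal (ρ * t) tiles) (trans (cong ((1 + m * ρ + D) * ∑ L (Phase.wt t) +_)
        (trans (cong (n *_) (trans (∑-map (tile false) Ks _) (trans (∑-const Ks 0) (*-zeroʳ (length Ks))))) (*-zeroʳ n)))
        (+-identityʳ _))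

  Solved : ℕ → Set
  Solved Kc = Σ ℕ λ t → 0 < t × Σ (Phase.State t) λ S → Kc * length (Phase.uncovered S) ≤ n

  module _ (0<n : 0 < n) (0<ρ : 0 < ρ) (0<E : 0 < E) (0<a : 0 < a) (a≤b : a ≤ b) (μ≤ : ∀ x → μ x ≤ b * n)
    {ρ₁ ρ₂ : ℕ} (ρ≡₁ : ρ ≡ 1 + ρ₁) (ρ≡₂ : ρ ≡ (a + p * b) + ρ₂) (eu≤ρ : e * (a + p * b) ≤ ρ)
    {α : ℕ} (0<α : 0 < α) (αa : α + a * (a + p * b) ≡ suc p * (b * b))
    (degreeBound : States.DegreeBound G p a b E μ ρ 0) (rankBound : States.RankBound G p a b E μ ρ 0)
    (Kc N : ℕ) (N≡ : N ≡ e * (1 + m * ρ + (b + α)) * (8 * E * b))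
    (enough-tile : Kc * (2 * (m * cost e p (b * ρ ^ suc N))) ≤ n)
    (enough-improve : Kc * (16 * m * E * ((b + α) * ρ ^ suc N * 2 ^ (m * ρ ^ suc N + m * ρ ^ suc N))) ≤ n)
    where

    private
      D : ℕ
      D = b + α
      instance
        ρ≢0 : NonZero ρ
        ρ≢0 = >-nonZero 0<ρ

    -- `k` counts the completed phases. Each ends with used weight above `n / e`, and resetting that
    -- weight to zero frees more than `n * n / e` of `progress`.
    Invariant : ∀ {t} → ℕ → Phase.State t → Set
    Invariant {t} k S = e * Phase.progress t D S + k * (n * n) ≤ N * (n * n)

    overused : ∀ {t} (S : Phase.State t) → n < e * Phase.usedTotal t (Phase.tiles S) →
               n * n < e * (n * Phase.usedTotal t (Phase.tiles S))
    overused {t} S h = subst (n * n <_) (lemma n e (Phase.usedTotal t (Phase.tiles S))) (*-monoʳ-< n {{>-nonZero 0<n}} h)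
      where
      lemma : ∀ n e u → n * (e * u) ≡ e * (n * u)
      lemma = solve-∀

    -- Inside a phase the recursion is on `progress`, between phases on the number `d` of remaining
    -- ones. At `d = 0` the invariant leaves no room for the used weight to exceed `n / e`, so that
    -- phase can only end with a small uncovered set.
    run : ∀ d k → d + k ≡ N → (S : Phase.State (ρ ^ d)) → Invariant k S →
          Acc _<_ (Phase.progress (ρ ^ d) D S) → Solved Kc
    run d k d+k≡N S inv (acc rec) with Kc * length (Phase.uncovered S) ≤? n
    ... | yes done = ρ ^ d , m^n>0 ρ d , S , done
    ... | no large with e * Phase.usedTotal (ρ ^ d) (Phase.tiles S) ≤? n
    ... | yes few-used = continue (Improve.better G p a b E μ ρ (ρ ^ d) 0<n (m^n>0 ρ d) 0<E 0<a a≤b μ≤ ρ≡₁ ρ≡₂ eu≤ρ 0<α αa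
        degreeBound rankBound {ρ ^ k} {Kc} (m^n>0 ρ k)
        (subst (λ z → Kc * (2 * (m * cost e p (b * z))) ≤ n) (sym top-scale) enough-tile)
        (≤-trans (*-monoʳ-≤ Kc (*-monoʳ-≤ (16 * m * E) (*-mono-≤ (*-monoʳ-≤ (b + α) t≤) (^-monoʳ-≤ 2 (+-mono-≤ (*-monoʳ-≤ m ρt≤) (*-monoʳ-≤ m ρt≤)))))) enough-improve)
        S (≰⇒> large) few-used)
      where
      top-scale : ρ ^ k * (ρ * ρ ^ d) ≡ ρ ^ suc N
      top-scale = trans (sym (^-distribˡ-+-* ρ k (suc d))) (cong (ρ ^_) (trans (+-suc k d) (cong suc (trans (+-comm k d) d+k≡N))))
      ρt≤ : ρ * ρ ^ d ≤ ρ ^ suc N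
      ρt≤ = ^-monoʳ-≤ ρ (s≤s (≤-trans (m≤m+n d k) (≤-reflexive d+k≡N)))
      t≤ : ρ ^ d ≤ ρ ^ suc N
      t≤ = ^-monoʳ-≤ ρ (≤-trans (≤-trans (m≤m+n d k) (≤-reflexive d+k≡N)) (n≤1+n N))
      continue : (Σ (Phase.State (ρ ^ d)) λ S′ → Phase.progress (ρ ^ d) D S′ < Phase.progress (ρ ^ d) D S) → Solved Kc
      continue (S′ , S′<S) = run d k d+k≡N S′ (≤-trans (+-monoˡ-≤ (k * (n * n)) (*-monoʳ-≤ e (<⇒≤ S′<S))) inv) (rec S′<S)
    run zero k refl S inv (acc rec) | no _ | no over = ⊥-elim (<⇒≱ (begin-strict
        k * (n * n)                                               <⟨ m<n+m (k * (n * n)) (*-mono-< 0<n 0<n) ⟩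
        n * n + k * (n * n)                                       ≤⟨ +-monoˡ-≤ (k * (n * n)) (<⇒≤ (overused S (≰⇒> over))) ⟩
        e * (n * Phase.usedTotal 1 (Phase.tiles S)) + k * (n * n) ≤⟨ +-monoˡ-≤ (k * (n * n)) (*-monoʳ-≤ e (m≤n+m _ ((1 + m * ρ + D) * Phase.potential 1 S))) ⟩
        e * Phase.progress 1 D S + k * (n * n)                    ∎) inv)
      where open ≤-Reasoning
    run (suc d) k d+k≡N S inv (acc rec) | no _ | no over = continue (nextPhase {ρ ^ d} D S)
      where
      u : ℕ
      u = Phase.usedTotal (ρ ^ suc d) (Phase.tiles S)
      continue : (Σ (Phase.State (ρ ^ d)) λ S′ → Phase.progress (ρ ^ d) D S′ + n * u ≡ Phase.progress (ρ ^ suc d) D S) → Solved Kc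
      continue (S′ , eq) = run d (suc k) (trans (+-suc d k) d+k≡N) S′ (begin
          e * Phase.progress (ρ ^ d) D S′ + (n * n + k * (n * n))
            ≤⟨ +-monoʳ-≤ (e * Phase.progress (ρ ^ d) D S′) (+-monoˡ-≤ (k * (n * n)) (<⇒≤ (overused S (≰⇒> over)))) ⟩
          e * Phase.progress (ρ ^ d) D S′ + (e * (n * u) + k * (n * n))
            ≡⟨ lemma e (Phase.progress (ρ ^ d) D S′) (n * u) (k * (n * n)) ⟩
          e * (Phase.progress (ρ ^ d) D S′ + n * u) + k * (n * n) ≡⟨ cong (λ z → e * z + k * (n * n)) eq ⟩
          e * Phase.progress (ρ ^ suc d) D S + k * (n * n) ≤⟨ inv ⟩
          N * (n * n) ∎) (<-wellFounded _)
        where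
        open ≤-Reasoning
        lemma : ∀ e p u k → e * p + (e * u + k) ≡ e * (p + u) + k
        lemma = solve-∀

    almostTiling : Solved Kc
    almostTiling = run N 0 (+-identityʳ N) initial start (<-wellFounded _)
      where
      initial : Phase.State (ρ ^ N)
      initial = state [] (allFin n) [] (λ f → refl)
      -- Every weight is at most `8 * E * b * n`; multiplying by the `n` vertices and the factors of
      -- `progress` gives the value chosen for `N`.
      start : Invariant 0 initial
      start = begin
        e * Phase.progress (ρ ^ N) D initial + 0
          ≤⟨ +-monoˡ-≤ 0 (*-monoʳ-≤ e (+-monoˡ-≤ (n * 0) (*-monoʳ-≤ (1 + m * ρ + D)
               (∑-mono (allFin n) (λ x → *-monoʳ-≤ (4 * E) (+-monoʳ-≤ (b * n) (m∸n≤m (b * n) (μ x)))))))) ⟩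
        e * ((1 + m * ρ + D) * ∑ (allFin n) (λ _ → (4 * E) * (b * n + b * n)) + n * 0) + 0
          ≡⟨ cong (λ z → e * ((1 + m * ρ + D) * z + n * 0) + 0) (∑-allFin-const n _) ⟩
        e * ((1 + m * ρ + D) * (n * ((4 * E) * (b * n + b * n))) + n * 0) + 0
          ≡⟨ lemma e (1 + m * ρ + D) n E b ⟩
        e * (1 + m * ρ + D) * (8 * E * b) * (n * n) ≡⟨ cong (_* (n * n)) N≡ ⟨
        N * (n * n) ∎
        where
        open ≤-Reasoning
        lemma : ∀ e c n E b → e * (c * (n * ((4 * E) * (b * n + b * n))) + n * 0) + 0 ≡ e * c * (8 * E * b) * (n * n)
        lemma = solve-∀

-- Ranks from the degree sequence, and the perturbed degree condition

module Ranks {n : ℕ} (G : Graph n) (ord : Fin n → Fin n) (bij : Bijective _≡_ _≡_ ord) where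
  open import Data.Nat using (_<_)

  open Sums
  open Arith

  #-below-injective : (f : Fin n → ℕ) → (∀ {x y} → f x ≡ f y → x ≡ y) → ∀ k → # (λ v → f v <ᵇ k) (allFin n) ≤ k
  #-below-injective f inj zero    = ≤-reflexive (trans (∑-const (allFin n) 0) (*-zeroʳ (length (allFin n))))
  #-below-injective f inj (suc k) = begin
    # (λ v → f v <ᵇ suc k) (allFin n)                              ≤⟨ ∑-mono (allFin n) (λ v → pointwise (f v)) ⟩
    ∑ (allFin n) (λ v → ⟦ f v ≡ᵇ k ⟧ + ⟦ f v <ᵇ k ⟧)               ≡⟨ ∑-+ (allFin n) _ _ ⟩
    # (λ v → f v ≡ᵇ k) (allFin n) + # (λ v → f v <ᵇ k) (allFin n)
      ≤⟨ +-mono-≤ (#-atMostOne _ (allFin⁺ n) (λ p q → inj (trans (eq p) (sym (eq q))))) (#-below-injective f inj k) ⟩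
    suc k ∎
    where
    open ≤-Reasoning
    eq : ∀ {x k} → (x ≡ᵇ k) ≡ true → x ≡ k
    eq {zero}  {zero}  _ = refl
    eq {suc x} {suc k} h = cong suc (eq {x} {k} h)
    pointwise : ∀ x {k} → ⟦ x <ᵇ suc k ⟧ ≤ ⟦ x ≡ᵇ k ⟧ + ⟦ x <ᵇ k ⟧
    pointwise zero    {zero}  = s≤s z≤n
    pointwise zero    {suc k} = s≤s z≤n
    pointwise (suc x) {zero}  = z≤n
    pointwise (suc x) {suc k} = pointwise x {k}

  position : Fin n → Fin n
  position v = proj₁ (proj₂ bij v)

  ord-position : ∀ v → ord (position v) ≡ v
  ord-position v = proj₂ (proj₂ bij v) refl

  rank : Fin n → ℕ
  rank v = suc (toℕ (position v))

  rank-injective : ∀ {x y} → rank x ≡ rank y → x ≡ y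
  rank-injective {x} {y} h = trans (sym (ord-position x)) (trans (cong ord (toℕ-injective (suc-injective h))) (ord-position y))

  #-rank≤ : ∀ k → # (λ v → rank v ≤ᵇ k) (allFin n) ≤ k
  #-rank≤ k = #-below-injective (toℕ ∘ position) (rank-injective ∘ cong suc) k

  cappedRank : (m c : ℕ) → Fin n → ℕ
  cappedRank m c v = (m * rank v) ⊓ c

  -- Since `y ≤ c * k`, the vertices counted lie strictly below the cap, where the capped rank is
  -- `m` times the true rank. True ranks are distinct, so the largest among them bounds the count.
  cappedRank-count : ∀ m k c y → y ≤ c * k → c * (m * # (λ z → suc (c * cappedRank m k z) ≤ᵇ y) (allFin n)) ≤ y
  cappedRank-count m k c y y≤ck with maximal rank (λ z → suc (c * cappedRank m k z) ≤ᵇ y) (allFin n)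
  ... | inj₁ none = subst (λ z → c * (m * z) ≤ y) (sym none) (≤-trans (≤-reflexive (trans (cong (c *_) (*-zeroʳ m)) (*-zeroʳ c))) z≤n)
  ... | inj₂ (x , x∈ , x-low , x-max) = begin
    c * (m * # (λ z → suc (c * cappedRank m k z) ≤ᵇ y) (allFin n))
      ≤⟨ *-monoʳ-≤ c (*-monoʳ-≤ m (≤-trans (∑-mono-∈ (allFin n) (λ z∈ → ⟦⟧-mono (λ z-low → ≤ᵇ-true (x-max z∈ z-low)))) (#-rank≤ (rank x)))) ⟩
    c * (m * rank x)        ≡⟨ cong (c *_) (uncapped (⊓-sel (m * rank x) k)) ⟨
    c * cappedRank m k x    ≤⟨ <⇒≤ (true-≤ x-low) ⟩
    y                       ∎
    where
    open ≤-Reasoning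
    uncapped : cappedRank m k x ≡ m * rank x ⊎ cappedRank m k x ≡ k → cappedRank m k x ≡ m * rank x
    uncapped (inj₁ eq) = eq
    uncapped (inj₂ eq) = ⊥-elim (<⇒≱ (true-≤ x-low) (subst (λ z → y ≤ c * z) (sym eq) y≤ck))

  deg : Fin n → ℕ
  deg v = # (adj G v) (allFin n)

  deg≡degree : ∀ v → deg v ≡ degree G v
  deg≡degree v = ∑≡sum (allFin n) _

  module _ (mono : ∀ i j → i Fin.≤ j → degree G (ord i) ≤ degree G (ord j))
    (p a₀ b₀ E₀ : ℕ) (0<a₀ : 0 < a₀) (a₀≤b₀ : a₀ ≤ b₀)
    where

    -- The exact bottle is enlarged `4 * E₀` times and one vertex is added to each body. The neck
    -- still splits evenly among whole copies of `H`, while `a < b` becomes strict.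
    m₀ a b m : ℕ
    m₀ = a₀ + (1 + p) * b₀
    a = 4 * E₀ * a₀
    b = 1 + 4 * E₀ * b₀
    m = a + (1 + p) * b

    module _ (condition : ∀ i → m₀ * suc (toℕ i) ≤ b₀ * n →
        E₀ * (p * b₀ * (b₀ * n) + a₀ * (m₀ * suc (toℕ i))) + m₀ * (b₀ * n) ≤ E₀ * (m₀ * (b₀ * degree G (ord i))))
      (m₀≤n : m₀ ≤ n) (2E₀≤n : 2 * E₀ ≤ n)
      where

      private
        0<b₀ : 0 < b₀
        0<b₀ = ≤-trans 0<a₀ a₀≤b₀
        0<m₀ : 0 < m₀
        0<m₀ = ≤-trans 0<a₀ (m≤m+n a₀ _)
        instance
          m₀≢0 : NonZero m₀
          m₀≢0 = >-nonZero 0<m₀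
        b₀≤m₀ : b₀ ≤ m₀
        b₀≤m₀ = ≤-trans (m≤m+n b₀ (p * b₀)) (m≤n+m _ a₀)
        -- The last index in the range of the condition, because `b₀ / m₀` equals `ω / h`. The
        -- assumption `m₀ ≤ n` makes it positive, so that it really is an index.
        last : ℕ
        last = (b₀ * n) / m₀
        last-≤ : m₀ * last ≤ b₀ * n
        last-≤ = ≤-trans (≤-reflexive (*-comm m₀ last)) (m/n*n≤m (b₀ * n) m₀)
        last-≥ : b₀ * n ≤ m₀ * last + m₀
        last-≥ = begin
          b₀ * n                            ≡⟨ m≡m%n+[m/n]*n (b₀ * n) m₀ ⟩
          (b₀ * n) % m₀ + last * m₀         ≤⟨ +-monoˡ-≤ (last * m₀) (<⇒≤ (m%n<n (b₀ * n) m₀)) ⟩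
          m₀ + last * m₀                    ≡⟨ trans (+-comm m₀ _) (cong (_+ m₀) (*-comm last m₀)) ⟩
          m₀ * last + m₀                    ∎
          where open ≤-Reasoning
        0<last : 0 < last
        0<last with last in eq
        ... | suc _ = s≤s z≤n
        ... | zero  = ⊥-elim (<⇒≱ (m%n<n (b₀ * n) m₀) (begin
          m₀                        ≤⟨ ≤-trans (≤-trans m₀≤n (≤-reflexive (sym (*-identityˡ n)))) (*-monoˡ-≤ n 0<b₀) ⟩
          b₀ * n                    ≡⟨ m≡m%n+[m/n]*n (b₀ * n) m₀ ⟩
          (b₀ * n) % m₀ + last * m₀ ≡⟨ cong (λ z → (b₀ * n) % m₀ + z * m₀) eq ⟩
          (b₀ * n) % m₀ + 0         ≡⟨ +-identityʳ _ ⟩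
          (b₀ * n) % m₀             ∎))
          where open ≤-Reasoning

      -- Beyond the range of the condition, monotonicity provides at least the degree at `last`.
      -- Rounding `last` down costs less than `m₀` in `m₀ * last`, which is the extra term on the
      -- right.
      degree-rank : ∀ v → E₀ * (p * b₀ * (b₀ * n) + a₀ * ((m₀ * rank v) ⊓ (b₀ * n))) + m₀ * (b₀ * n)
                        ≤ E₀ * (m₀ * (b₀ * deg v)) + E₀ * (a₀ * m₀)
      degree-rank v with m₀ * rank v ≤? b₀ * n
      ... | yes h = degree-linear-arith a₀ b₀ p E₀ n (rank v) (deg v) ((m₀ * rank v) ⊓ (b₀ * n))
        (subst (λ z → E₀ * (p * b₀ * (b₀ * n) + a₀ * (m₀ * rank v)) + m₀ * (b₀ * n) ≤ E₀ * (m₀ * (b₀ * z)))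
          (trans (cong (degree G) (ord-position v)) (sym (deg≡degree v))) (condition (position v) h))
        (≤-trans (m⊓n≤m _ _) (m≤m+n _ m₀))
      ... | no h = degree-linear-arith a₀ b₀ p E₀ n last (deg v) ((m₀ * rank v) ⊓ (b₀ * n))
        (≤-trans (subst (λ z → E₀ * (p * b₀ * (b₀ * n) + a₀ * (m₀ * z)) + m₀ * (b₀ * n) ≤ E₀ * (m₀ * (b₀ * degree G (ord i)))) suc-i
            (condition i (subst (λ z → m₀ * z ≤ b₀ * n) (sym suc-i) last-≤)))
          (*-monoʳ-≤ E₀ (*-monoʳ-≤ m₀ (*-monoʳ-≤ b₀ (≤-trans (mono i (position v) i≤)
            (≤-reflexive (trans (cong (degree G) (ord-position v)) (sym (deg≡degree v)))))))))
        (≤-trans (m⊓n≤n (m₀ * rank v) _) last-≥)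
        where
        last≤n : last ≤ n
        last≤n = *-cancelˡ-≤ m₀ (≤-trans last-≤ (*-monoˡ-≤ n b₀≤m₀))
        pred<n : pred last < n
        pred<n = ≤-trans (≤-reflexive (suc-pred last {{>-nonZero 0<last}})) last≤n
        -- `Fin` starts at `0` but the degree sequence at `1`, hence the predecessor of `last`.
        i : Fin n
        i = fromℕ< pred<n
        suc-i : suc (toℕ i) ≡ last
        suc-i = trans (cong suc (toℕ-fromℕ< pred<n)) (suc-pred last {{>-nonZero 0<last}})
        i≤ : i Fin.≤ position v
        i≤ = s≤s⁻¹ (subst (_≤ rank v) (sym suc-i) (*-cancelˡ-≤ m₀ (≤-trans last-≤ (<⇒≤ (≰⇒> h)))))

      -- Enlarging the bodies slightly makes a < b strict, as `gain` requires, at the cost of some slack.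
      degree-perturbed : ∀ v → (4 * E₀) * (p * b * (b * n) + a * cappedRank m (b * n) v) + m * (b * n)
                             ≤ (4 * E₀) * (m * (b * deg v))
      degree-perturbed v = *-cancelˡ-≤ (m₀ * b₀) {{>-nonZero (*-mono-< 0<m₀ 0<b₀)}}
        (perturb-arith a₀ b₀ p E₀ n (deg v) (cappedRank m (b * n) v) ((m₀ * rank v) ⊓ (b₀ * n))
          (degree-rank v) (capped (⊓-sel (m₀ * rank v) (b₀ * n))) 0<b₀ 2E₀≤n a₀≤b₀)
        where
        capped : (m₀ * rank v) ⊓ (b₀ * n) ≡ m₀ * rank v ⊎ (m₀ * rank v) ⊓ (b₀ * n) ≡ b₀ * n →
                 m₀ * b₀ * (a * cappedRank m (b * n) v) ≤ m * b * (a₀ * ((m₀ * rank v) ⊓ (b₀ * n)))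
        capped (inj₁ eq) = subst (λ z → m₀ * b₀ * (a * cappedRank m (b * n) v) ≤ m * b * (a₀ * z)) (sym eq)
          (cap-linear-arith a₀ b₀ p E₀ (rank v) (cappedRank m (b * n) v) (m⊓n≤m _ _))
        capped (inj₂ eq) = subst (λ z → m₀ * b₀ * (a * cappedRank m (b * n) v) ≤ m * b * (a₀ * z)) (sym eq)
          (cap-constant-arith a₀ b₀ p E₀ n (cappedRank m (b * n) v) (m⊓n≤n (m * rank v) _))

-- Copies of H inside a bottle

module Placements {n h : ℕ} (G : Graph n) (H : Graph h) where

  -- Injectivity is not a field: it is deduced for a whole family at once from an inequality between
  -- sums.
  record Placement : Set where
    constructor placement
    field
      place : Fin h → Fin n
      preserves : ∀ u v → adj H u v ≡ true → adj G (place u) (place v) ≡ true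

  open Placement public

module Copies {n h : ℕ} (G : Graph n) (H : Graph h) (p : ℕ) (c : Fin h → Fin (2 + p)) (proper : ProperColouring H (2 + p) c) (j₀ : Fin (2 + p)) where
  open import Data.Nat using (_<_)

  open Sums
  open Placements G H

  q : ℕ
  q = suc p

  addMod : ℕ → ℕ → ℕ
  addMod x y with x + y <? q
  ... | yes _ = x + y
  ... | no  _ = x + y ∸ q

  addMod< : ∀ x y → x < q → y < q → addMod x y < q
  addMod< x y x<q y<q with x + y <? q
  ... | yes h = h
  ... | no ¬h = +-cancelʳ-< q (x + y ∸ q) q (subst (_< q + q) (sym (m∸n+n≡m (≮⇒≥ ¬h))) (+-mono-< x<q y<q))

  addMod-injective : ∀ x y z → y < q → z < q → addMod x y ≡ addMod x z → y ≡ z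
  addMod-injective x y z y<q z<q e with x + y <? q | x + z <? q
  ... | yes _  | yes _ = +-cancelˡ-≡ x y z e
  ... | no ¬s  | no ¬t = +-cancelˡ-≡ x y z (trans (sym (m∸n+n≡m (≮⇒≥ ¬s))) (trans (cong (_+ q) e) (m∸n+n≡m (≮⇒≥ ¬t))))
  ... | yes _  | no ¬t = ⊥-elim (<⇒≱ z<q (≤-trans (m≤n+m q y) (≤-reflexive
      (+-cancelˡ-≡ x (y + q) z (trans (sym (+-assoc x y q)) (trans (cong (_+ q) e) (m∸n+n≡m (≮⇒≥ ¬t))))))))
  ... | no ¬s  | yes _ = ⊥-elim (<⇒≱ y<q (≤-trans (m≤n+m q z) (≤-reflexive
      (+-cancelˡ-≡ x (z + q) y (trans (sym (+-assoc x z q)) (trans (cong (_+ q) (sym e)) (m∸n+n≡m (≮⇒≥ ¬s))))))))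

  addMod-comm : ∀ x y → addMod x y ≡ addMod y x
  addMod-comm x y with x + y <? q | y + x <? q
  ... | yes _ | yes _ = +-comm x y
  ... | no _  | no _  = cong (_∸ q) (+-comm x y)
  ... | yes s | no ¬s = ⊥-elim (¬s (subst (_< q) (+-comm x y) s))
  ... | no ¬s | yes s = ⊥-elim (¬s (subst (_< q) (+-comm y x) s))

  -- A Latin square: in its i-th copy, colour x of H is placed in body (latin i x).
  latin : Fin q → Fin q → Fin q
  latin i x = fromℕ< (addMod< (toℕ i) (toℕ x) (toℕ<n i) (toℕ<n x))

  latin-eq : ∀ {i x i′ x′} → latin i x ≡ latin i′ x′ → addMod (toℕ i) (toℕ x) ≡ addMod (toℕ i′) (toℕ x′)
  latin-eq {i} {x} {i′} {x′} e = trans (sym (toℕ-fromℕ< _)) (trans (cong toℕ e) (toℕ-fromℕ< (addMod< (toℕ i′) (toℕ x′) (toℕ<n i′) (toℕ<n x′))))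

  latin-injectiveʳ : ∀ i {x y} → latin i x ≡ latin i y → x ≡ y
  latin-injectiveʳ i {x} {y} e = toℕ-injective (addMod-injective (toℕ i) _ _ (toℕ<n x) (toℕ<n y) (latin-eq {i} {x} {i} {y} e))

  latin-injectiveˡ : ∀ {i j} x → latin i x ≡ latin j x → i ≡ j
  latin-injectiveˡ {i} {j} x e = toℕ-injective (addMod-injective (toℕ x) _ _ (toℕ<n i) (toℕ<n j)
    (trans (addMod-comm (toℕ x) (toℕ i)) (trans (latin-eq {i} {x} {j} {x} e) (addMod-comm (toℕ j) (toℕ x)))))

  neckVertices bodyVertices : List (Fin h)
  neckVertices = filter (λ u → c u ≟ᶠ j₀) (allFin h)
  bodyVertices = filter (λ u → ¬? (c u ≟ᶠ j₀)) (allFin h)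

  module _ {a b s : ℕ} where
    open Bottles G p a b

    module _ {K : Parts} (BK : Bottle s K) (M : ℕ)
      (neck-size : a * s ≡ M * (q * length neckVertices)) (body-size : M * length bodyVertices ≤ b * s)
      where

      Slot Index : Set
      Slot = Fin (length (neck K)) ⊎ Σ (Fin q) λ j → Fin (length (body K j))
      Index = Fin M × Fin q × Fin h

      neckFits : M * (q * length neckVertices) ≤ length (neck K)
      neckFits = ≤-reflexive (sym (trans (neck-length BK) neck-size))

      neckSlot : Fin (M * (q * length neckVertices)) → Slot
      neckSlot x = inj₁ (inject≤ x neckFits)

      bodyFits : ∀ j → M * length bodyVertices ≤ length (body K j)
      bodyFits j = ≤-trans body-size (≤-reflexive (sym (body-length BK j)))

      bodySlot : Fin q → Fin (M * length bodyVertices) → Slot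
      bodySlot j x = inj₂ (j , inject≤ x (bodyFits j))

      -- The copies come in `M` groups of `q`, and the class `j₀` of every copy goes to the neck. A
      -- body position records the group and the vertex `u` but not the copy `i`: the colour of `u`
      -- and the body determine `i` through the Latin square.
      slotOf : Fin M → Fin q → (u : Fin h) → Dec (c u ≡ j₀) → Slot
      slotOf g i u (yes e) = neckSlot (combine g (combine i (Any.index (∈-filter⁺ (λ u → c u ≟ᶠ j₀) (∈-allFin u) e))))
      slotOf g i u (no ¬e) = bodySlot (latin i (punchOut (¬e ∘ sym)))
        (combine g (Any.index (∈-filter⁺ (λ u → ¬? (c u ≟ᶠ j₀)) (∈-allFin u) ¬e)))

      slot : Index → Slot
      slot (g , i , u) = slotOf g i u (c u ≟ᶠ j₀)

      index-injective : ∀ {A : Set} {xs : List A} {x y} (x∈ : x ∈ xs) (y∈ : y ∈ xs) → Any.index x∈ ≡ Any.index y∈ → x ≡ y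
      index-injective {xs = xs} x∈ y∈ e = trans (lookup-index x∈) (trans (cong (lookup xs) e) (sym (lookup-index y∈)))

      bodySlot-injective : ∀ {j j′ x y} → bodySlot j x ≡ bodySlot j′ y → j ≡ j′ × x ≡ y
      bodySlot-injective {j} {j′} {x} {y} e = j≡ (toPair e) , toℕ-injective (trans (sym (toℕ-inject≤′ j x)) (trans (pos≡ (toPair e)) (toℕ-inject≤′ j′ y)))
        where
        toℕ-inject≤′ : ∀ j x → toℕ (inject≤ x (bodyFits j)) ≡ toℕ x
        toℕ-inject≤′ j x = toℕ-inject≤ x (bodyFits j)
        Pair : Set
        Pair = Σ (Fin q) λ j → Fin (length (body K j))
        toPair : ∀ {r r′ : Pair} → _≡_ {A = Slot} (inj₂ r) (inj₂ r′) → r ≡ r′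
        toPair refl = refl
        j≡ : ∀ {r r′ : Pair} → r ≡ r′ → proj₁ r ≡ proj₁ r′
        j≡ refl = refl
        pos≡ : ∀ {r r′ : Pair} → r ≡ r′ → toℕ (proj₂ r) ≡ toℕ (proj₂ r′)
        pos≡ refl = refl

      neckSlot-injective : ∀ {x y} → neckSlot x ≡ neckSlot y → x ≡ y
      neckSlot-injective {x} {y} e = inject≤-injective neckFits neckFits x y (strip e)
        where
        strip : ∀ {r r′} → _≡_ {A = Slot} (inj₁ r) (inj₁ r′) → r ≡ r′
        strip refl = refl

      slotOf-injective : ∀ g i u d g′ i′ u′ d′ → slotOf g i u d ≡ slotOf g′ i′ u′ d′ → (g , i , u) ≡ (g′ , i′ , u′)
      slotOf-injective g i u (yes e) g′ i′ u′ (yes e′) eq with combine-injective g _ g′ _ (neckSlot-injective eq)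
      ... | refl , eq′ with combine-injective i _ i′ _ eq′
      ... | refl , eq″ with index-injective (∈-filter⁺ (λ u → c u ≟ᶠ j₀) (∈-allFin u) e) (∈-filter⁺ (λ u → c u ≟ᶠ j₀) (∈-allFin u′) e′) eq″
      ... | refl = refl
      slotOf-injective g i u (no ¬e) g′ i′ u′ (no ¬e′) eq with bodySlot-injective eq
      ... | same-body , eq′ with combine-injective g _ g′ _ eq′
      ... | refl , eq″ with index-injective (∈-filter⁺ (λ u → ¬? (c u ≟ᶠ j₀)) (∈-allFin u) ¬e) (∈-filter⁺ (λ u → ¬? (c u ≟ᶠ j₀)) (∈-allFin u′) ¬e′) eq″
      ... | refl with latin-injectiveˡ {i} {i′} (punchOut (¬e ∘ sym)) same-body
      ... | refl = refl
      slotOf-injective g i u (yes _) g′ i′ u′ (no _) ()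
      slotOf-injective g i u (no _) g′ i′ u′ (yes _) ()

      slot-injective : ∀ {x y} → slot x ≡ slot y → x ≡ y
      slot-injective {g , i , u} {g′ , i′ , u′} e = slotOf-injective g i u (c u ≟ᶠ j₀) g′ i′ u′ (c u′ ≟ᶠ j₀) e

      vertex : Slot → Fin n
      vertex (inj₁ x)       = lookup (neck K) x
      vertex (inj₂ (j , x)) = lookup (body K j) x

      slots : List Slot
      slots = map inj₁ (allFin (length (neck K))) ++ concatMap (λ j → map (λ x → inj₂ (j , x)) (allFin (length (body K j)))) bodies

      slots-complete : ∀ x → x ∈ slots
      slots-complete (inj₁ x)       = ∈-++⁺ˡ (∈-map⁺ inj₁ (∈-allFin x))
      slots-complete (inj₂ (j , x)) = ∈-++⁺ʳ (map inj₁ (allFin (length (neck K))))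
        (∈-concatMap⁺ _ (Any.map (λ { refl → ∈-map⁺ (λ x → inj₂ (j , x)) (∈-allFin x) }) (∈-allFin j)))

      ∑-slots : ∀ F → ∑ slots (F ∘ vertex) ≡ ∑∑ K F
      ∑-slots F = trans (∑-++ (map inj₁ (allFin (length (neck K)))) _ (F ∘ vertex)) (cong₂ _+_
        (trans (∑-map inj₁ (allFin (length (neck K))) (F ∘ vertex)) (∑-lookup (neck K) F))
        (trans (∑-concatMap (λ j → map (λ x → inj₂ (j , x)) (allFin (length (body K j)))) bodies (F ∘ vertex)) (∑-cong bodies (λ j →
          trans (∑-map (λ x → inj₂ (j , x)) (allFin (length (body K j))) (F ∘ vertex)) (∑-lookup (body K j) F)))))

      vertex-adj : ∀ g i u v (d : Dec (c u ≡ j₀)) (d′ : Dec (c v ≡ j₀)) → c u ≢ c v →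
                   Adj (vertex (slotOf g i u d)) (vertex (slotOf g i v d′))
      vertex-adj g i u v (yes e) (yes e′) ne = ⊥-elim (ne (trans e (sym e′)))
      vertex-adj g i u v (yes e) (no ¬e)  ne = neck-body BK _ (∈-lookup _) (∈-lookup _)
      vertex-adj g i u v (no ¬e) (yes e)  ne = Adj-sym (neck-body BK _ (∈-lookup _) (∈-lookup _))
      vertex-adj g i u v (no ¬e) (no ¬e′) ne = body-body BK
        (λ eq → ne (punchOut-injective (¬e ∘ sym) (¬e′ ∘ sym) (latin-injectiveʳ i eq))) (∈-lookup _) (∈-lookup _)

      placementAt : Fin M → Fin q → Placement
      placementAt g i = placement (λ u → vertex (slot (g , i , u)))
        (λ u v uv → vertex-adj g i u v (c u ≟ᶠ j₀) (c v ≟ᶠ j₀) (proper u v uv))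

      placements : List Placement
      placements = map (uncurry placementAt) (cartesianProduct (allFin M) (allFin q))

      ∑-product : ∀ {A B : Set} (xs : List A) (ys : List B) F → ∑ (cartesianProduct xs ys) F ≡ ∑ xs (λ x → ∑ ys (λ y → F (x , y)))
      ∑-product []       ys F = refl
      ∑-product (x ∷ xs) ys F = trans (∑-++ (map (x ,_) ys) (cartesianProduct xs ys) F) (cong₂ _+_ (∑-map (x ,_) ys F) (∑-product xs ys F))

      placements-length : length placements ≡ M * q
      placements-length = begin
        length placements ≡⟨ ∑-1 placements ⟨
        ∑ placements (λ _ → 1) ≡⟨ trans (∑-map (uncurry placementAt) (cartesianProduct (allFin M) (allFin q)) (λ _ → 1)) (∑-product (allFin M) (allFin q) (λ _ → 1)) ⟩
        ∑ (allFin M) (λ _ → ∑ (allFin q) (λ _ → 1)) ≡⟨ ∑-allFin-const M _ ⟩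
        M * ∑ (allFin q) (λ _ → 1) ≡⟨ cong (M *_) (trans (∑-allFin-const q 1) (*-identityʳ q)) ⟩
        M * q ∎
        where open ≡-Reasoning

      -- Distinct triples of group, copy and vertex occupy distinct slots of the bottle. Quantified
      -- over `F`, the inequality expresses that the images are disjoint as submultisets.
      placements-fit : ∀ F → ∑ placements (λ P → ∑ (allFin h) (F ∘ place P)) ≤ ∑∑ K F
      placements-fit F = begin
        ∑ placements (λ P → ∑ (allFin h) (F ∘ place P))
          ≡⟨ trans (∑-map (uncurry placementAt) (cartesianProduct (allFin M) (allFin q)) (λ P → ∑ (allFin h) (F ∘ place P))) (∑-product (allFin M) (allFin q) _) ⟩
        ∑ (allFin M) (λ g → ∑ (allFin q) (λ i → ∑ (allFin h) (λ u → F (vertex (slot (g , i , u))))))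
          ≡⟨ trans (∑-product (allFin M) (cartesianProduct (allFin q) (allFin h)) (F ∘ vertex ∘ slot))
               (∑-cong (allFin M) (λ g → ∑-product (allFin q) (allFin h) (λ x → F (vertex (slot (g , x)))))) ⟨
        ∑ (cartesianProduct (allFin M) (cartesianProduct (allFin q) (allFin h))) (F ∘ vertex ∘ slot)
          ≤⟨ ∑-injective slot slot-injective (cartesianProduct⁺ (allFin⁺ M) (cartesianProduct⁺ (allFin⁺ q) (allFin⁺ h))) slots
               (λ _ → slots-complete _) (F ∘ vertex) ⟩
        ∑ slots (F ∘ vertex) ≡⟨ ∑-slots F ⟩
        ∑∑ K F ∎
        where open ≤-Reasoning

-- From disjointly placed copies to a tiling

module Covering {n h : ℕ} (G : Graph n) (H : Graph h) where

  open Sums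

  open Placements G H

  ∑-two : ∀ {k} f (i j : Fin k) → i ≢ j → f i + f j ≤ ∑ (allFin k) f
  ∑-two {suc k} f i j i≢j = begin
    f i + f j                              ≡⟨ cong (λ z → f i + f z) (punchIn-punchOut i≢j) ⟨
    f i + f (punchIn i (punchOut i≢j))     ≤⟨ +-monoʳ-≤ (f i) (∑-≥-∈ (f ∘ punchIn i) (∈-allFin (punchOut i≢j))) ⟩
    f i + ∑ (allFin k) (f ∘ punchIn i)     ≡⟨ ∑-remove i f ⟨
    ∑ (allFin (suc k)) f                   ∎
    where open ≤-Reasoning

  module Tiled (ps : List Placement) (fits : ∀ F → ∑ ps (λ P → ∑ (allFin h) (F ∘ place P)) ≤ ∑ (allFin n) F) where

    private
      at : Fin (length ps) → Fin h → Fin n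
      at i = place (lookup ps i)

      is : Fin n → Fin n → ℕ
      is v w = ⟦ does (w ≟ᶠ v) ⟧

      is-refl : ∀ {v w} → w ≡ v → is v w ≡ 1
      is-refl {v} {w} e = cong ⟦_⟧ (dec-true (w ≟ᶠ v) e)

      -- `fits` applied to the indicator of `v`; injectivity of each copy and disjointness of
      -- different copies both follow.
      at-most-once : ∀ v → ∑ ps (λ P → ∑ (allFin h) (is v ∘ place P)) ≤ 1
      at-most-once v = ≤-trans (fits (is v)) (Sums.#-atMostOne (λ w → does (w ≟ᶠ v)) (allFin⁺ n)
        (λ {x} {y} p q → trans (≡true (x ≟ᶠ v) p) (sym (≡true (y ≟ᶠ v) q))))

      hits : ∀ v i u → at i u ≡ v → 1 ≤ ∑ (allFin h) (is v ∘ at i)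
      hits v i u e = ≤-trans (≤-reflexive (sym (is-refl e))) (∑-≥-∈ (is v ∘ at i) (∈-allFin u))

      at-injective : ∀ i {u w} → at i u ≡ at i w → u ≡ w
      at-injective i {u} {w} e with u ≟ᶠ w
      ... | yes u≡w = u≡w
      ... | no u≢w = ⊥-elim (<⇒≱ (s≤s (s≤s z≤n)) (begin
        2                                              ≡⟨ cong₂ _+_ (is-refl e) (is-refl {at i w} refl) ⟨
        is (at i w) (at i u) + is (at i w) (at i w)    ≤⟨ ∑-two (is (at i w) ∘ at i) u w u≢w ⟩
        ∑ (allFin h) (is (at i w) ∘ at i)              ≤⟨ ∑-≥-∈ (λ P → ∑ (allFin h) (is (at i w) ∘ place P)) (∈-lookup {xs = ps} i) ⟩
        ∑ ps (λ P → ∑ (allFin h) (is (at i w) ∘ place P)) ≤⟨ at-most-once (at i w) ⟩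
        1 ∎))
        where open ≤-Reasoning

      at-disjoint : ∀ i j → i ≢ j → ∀ u w → at i u ≢ at j w
      at-disjoint i j i≢j u w e = <⇒≱ (s≤s (s≤s z≤n)) (begin
        2                                              ≤⟨ +-mono-≤ (hits (at j w) i u e) (hits (at j w) j w refl) ⟩
        ∑ (allFin h) (is (at j w) ∘ at i) + ∑ (allFin h) (is (at j w) ∘ at j)
          ≤⟨ ∑-two (λ i → ∑ (allFin h) (is (at j w) ∘ at i)) i j i≢j ⟩
        ∑ (allFin (length ps)) (λ i → ∑ (allFin h) (is (at j w) ∘ at i)) ≡⟨ ∑-lookup ps (λ P → ∑ (allFin h) (is (at j w) ∘ place P)) ⟩
        ∑ ps (λ P → ∑ (allFin h) (is (at j w) ∘ place P)) ≤⟨ at-most-once (at j w) ⟩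
        1 ∎)
        where open ≤-Reasoning

      covered? : ∀ v → Dec (∃ λ i → ∃ λ u → at i u ≡ v)
      covered? v = any? (λ i → any? (λ u → at i u ≟ᶠ v))

    tiling : Tiling H G
    tiling = record
      { size     = length ps
      ; copy     = λ i → at i , at-injective i , preserves (lookup ps i)
      ; disjoint = at-disjoint }

    missed : Fin n → Bool
    missed v = not (does (covered? v))

    missed-uncovered : ∀ v → ¬ Covered tiling v → missed v ≡ true
    missed-uncovered v ¬cov = cong not (dec-false (covered? v) ¬cov)

    -- `fits` applied to the indicator of the covered set: each of the copies contributes its full
    -- `h`.
    missed-count : countᵇ missed + length ps * h ≤ n
    missed-count = begin
      countᵇ missed + length ps * h
        ≡⟨ cong₂ _+_ (sym (∑≡sum (allFin n) _)) (sym (trans (∑-cong-∈ ps all-covered) (∑-const ps h))) ⟩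
      # missed (allFin n) + ∑ ps (λ P → ∑ (allFin h) (λ u → ⟦ does (covered? (place P u)) ⟧))
        ≤⟨ +-monoʳ-≤ (# missed (allFin n)) (fits (λ v → ⟦ does (covered? v) ⟧)) ⟩
      # missed (allFin n) + # (λ v → does (covered? v)) (allFin n)
        ≡⟨ trans (+-comm (# missed (allFin n)) _) (#-+-not (λ v → does (covered? v)) (allFin n)) ⟩
      length (allFin n) ≡⟨ length-allFin n ⟩
      n ∎
      where
      open ≤-Reasoning
      all-covered : ∀ {P} → P ∈ ps → ∑ (allFin h) (λ u → ⟦ does (covered? (place P u)) ⟧) ≡ h
      all-covered {P} P∈ = trans (∑-cong (allFin h) (λ u → cong ⟦_⟧ (dec-true (covered? (place P u))
          (index P∈ , u , cong (λ P → place P u) (sym (lookup-index P∈))))))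
        (trans (∑-allFin-const h 1) (*-identityʳ h))

-- Choice of constants and conclusion

module Assembly where
  open import Data.Nat using (_<_)

  open import Data.Rational as ℚ using (ℚ; 0ℚ; 1ℚ; ↧ₙ_)
  import Data.Rational.Properties as ℚₚ
  open Sums
  open Arith
  open Width
  open Rationals

  ∑-classSize : ∀ {h k} (c : Fin h → Fin k) → ∑ (allFin k) (classSize c) ≤ h
  ∑-classSize {h} {k} c = begin
    ∑ (allFin k) (classSize c)
      ≡⟨ ∑-cong (allFin k) (λ j → sym (∑≡sum (allFin h) _)) ⟩
    ∑ (allFin k) (λ j → # (λ u → does (c u ≟ᶠ j)) (allFin h))
      ≡⟨ ∑-swap (allFin k) (allFin h) (λ j u → ⟦ does (c u ≟ᶠ j) ⟧) ⟩
    ∑ (allFin h) (λ u → # (λ j → does (c u ≟ᶠ j)) (allFin k))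
      ≤⟨ ∑-mono (allFin h) (λ u → #-atMostOne (λ j → does (c u ≟ᶠ j)) (allFin⁺ k)
           (λ {x} {y} p q → trans (sym (≡true (c u ≟ᶠ x) p)) (≡true (c u ≟ᶠ y) q))) ⟩
    ∑ (allFin h) (λ _ → 1)  ≡⟨ trans (∑-allFin-const h 1) (*-identityʳ h) ⟩
    h ∎
    where open ≤-Reasoning

  module Main {h : ℕ} (H : Graph h) (p σ : ℕ)
    (c : Fin h → Fin (2 + p)) (proper : ProperColouring H (2 + p) c) (j₀ : Fin (2 + p)) (c-size : classSize c j₀ ≡ σ)
    (0<σ : 0 < σ) (rσ≤h : (2 + p) * σ ≤ h)
    (η : ℚ) (0<η : 0ℚ ℚ.< η) (E₀ : ℕ) (0<E₀ : 0 < E₀) (1≤ηE₀ : 1ℚ ℚ.≤ η ℚ.* ℕ→ℚ E₀)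
    where

    b₀ a₀ m₀ a b m E e ρ δ α N Kc : ℕ
    b₀ = h ∸ σ
    a₀ = suc p * σ
    m₀ = a₀ + (1 + p) * b₀
    a = 4 * E₀ * a₀
    b = 1 + 4 * E₀ * b₀
    m = a + suc p * b
    E = 4 * E₀
    e = 8 * E
    ρ = e * (a + p * b)
    δ = b ∸ a
    α = δ * (suc p * b + a)
    N = e * (1 + m * ρ + (b + α)) * (8 * E * b)
    Kc = 2 * E₀

    bound₁ bound₂ n₀ : ℕ
    bound₁ = Kc * (2 * (m * cost e p (b * ρ ^ suc N)))
    bound₂ = Kc * (16 * m * E * ((b + α) * ρ ^ suc N * 2 ^ (m * ρ ^ suc N + m * ρ ^ suc N)))
    -- `1` makes `n` positive, `m₀` and `2 * E₀` control the rounding at the end of the range, and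
    -- the two bounds supply the pigeonhole arguments at the largest scale.
    n₀ = 1 + (m₀ + (2 * E₀ + (bound₁ + bound₂)))

    σ≤h : σ ≤ h
    σ≤h = ≤-trans (m≤m+n σ (suc p * σ)) rσ≤h

    a₀≤b₀ : a₀ ≤ b₀
    a₀≤b₀ = +-cancelˡ-≤ σ _ _ (≤-trans rσ≤h (≤-reflexive (sym (m+[n∸m]≡n σ≤h))))

    0<a₀ : 0 < a₀
    0<a₀ = ≤-trans 0<σ (m≤m+n σ (p * σ))

    0<b₀ : 0 < b₀
    0<b₀ = ≤-trans 0<a₀ a₀≤b₀

    m₀≡ : m₀ ≡ suc p * h
    m₀≡ = trans (sym (*-distribˡ-+ (suc p) σ b₀)) (cong (suc p *_) (m+[n∸m]≡n σ≤h))

    0<h : 0 < h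
    0<h = ≤-trans 0<σ σ≤h

    a<b : a < b
    a<b = s≤s (*-monoʳ-≤ (4 * E₀) a₀≤b₀)

    0<E : 0 < E
    0<E = *-mono-< (s≤s (z≤n {3})) 0<E₀

    0<a : 0 < a
    0<a = *-mono-< 0<E 0<a₀

    0<u : 0 < a + p * b
    0<u = ≤-trans 0<a (m≤m+n a (p * b))

    0<ρ : 0 < ρ
    0<ρ = *-mono-< (*-mono-< (s≤s (z≤n {7})) 0<E) 0<u

    u≤ρ : a + p * b ≤ ρ
    u≤ρ = ≤-trans (≤-reflexive (sym (*-identityˡ _))) (*-monoˡ-≤ (a + p * b) (*-mono-< (s≤s (z≤n {7})) 0<E))

    0<α : 0 < α
    0<α = *-mono-< (m<n⇒0<n∸m a<b) (≤-trans 0<a (m≤n+m a (suc p * b)))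

    -- `α` solves the size equation of `weave`; its factor `b - a` shows that it is positive because
    -- the perturbed ratio is strict.
    αa : α + a * (a + p * b) ≡ suc p * (b * b)
    αa = subst (λ b → δ * (suc p * b + a) + a * (a + p * b) ≡ suc p * (b * b)) (m+[n∸m]≡n (<⇒≤ a<b)) (lemma a δ p)
      where
      lemma : ∀ a d p → d * ((1 + p) * (a + d) + a) + a * (a + p * (a + d)) ≡ (1 + p) * ((a + d) * (a + d))
      lemma = solve-∀

    ω : ℚ
    ω = ℕ→ℚ b₀ ÷₀ ℕ→ℚ (suc p)

    ω-eq : ω ℚ.* ℕ→ℚ (suc p) ≡ ℕ→ℚ b₀
    ω-eq = ÷₀-* (ℕ→ℚ b₀) (ℕ→ℚ (suc p)) (pos⇒≢0 (0<⇒pos {suc p} (s≤s z≤n)))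

    ω≢0 : ω ≢ 0ℚ
    ω≢0 ω≡0 = pos⇒≢0 (0<⇒pos 0<b₀) (trans (sym ω-eq) (trans (cong (ℚ._* ℕ→ℚ (suc p)) ω≡0) (ℚₚ.*-zeroˡ (ℕ→ℚ (suc p)))))

    h≢0 : ℕ→ℚ h ≢ 0ℚ
    h≢0 = pos⇒≢0 (0<⇒pos 0<h)

    neck-count : length (Copies.neckVertices {h} H H p c proper j₀) ≡ σ
    neck-count = trans (∑-filter-length (λ u → c u ≟ᶠ j₀) (allFin h)) (trans (∑≡sum (allFin h) _) c-size)

    body-count : length (Copies.bodyVertices {h} H H p c proper j₀) ≡ b₀
    body-count = trans (∑-filter-length _ (allFin h)) (+-cancelˡ-≡ σ _ _ (begin
      σ + # (not ∘ λ u → does (c u ≟ᶠ j₀)) (allFin h)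
        ≡⟨ cong (_+ # (not ∘ λ u → does (c u ≟ᶠ j₀)) (allFin h)) (trans (∑≡sum (allFin h) _) c-size) ⟨
      # (λ u → does (c u ≟ᶠ j₀)) (allFin h) + # (not ∘ λ u → does (c u ≟ᶠ j₀)) (allFin h)
        ≡⟨ #-+-not (λ u → does (c u ≟ᶠ j₀)) (allFin h) ⟩
      length (allFin h) ≡⟨ trans (length-allFin h) (sym (m+[n∸m]≡n σ≤h)) ⟩
      σ + b₀ ∎))
      where open ≡-Reasoning

    module Host {n : ℕ} (n₀≤n : n₀ ≤ n) (G : Graph n) (condition : DegreeCondition G η ω h σ) where

      open Placements G H

      ord : Fin n → Fin n
      ord = proj₁ condition

      module R = Ranks G ord (proj₁ (proj₁ (proj₂ condition)))

      integral : ∀ i → m₀ * suc (toℕ i) ≤ b₀ * n →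
        E₀ * (p * b₀ * (b₀ * n) + a₀ * (m₀ * suc (toℕ i))) + m₀ * (b₀ * n) ≤ E₀ * (m₀ * (b₀ * degree G (ord i)))
      integral i in-range = clear-arith a₀ b₀ p E₀ n (suc (toℕ i)) (degree G (ord i))
        (subst (λ m → E₀ * (m * (b₀ * n)) + E₀ * (m * (a₀ * suc (toℕ i))) + m * (b₀ * n)
                    ≤ E₀ * (m * (b₀ * degree G (ord i))) + E₀ * (b₀ * ((b₀ + a₀) * n))) (sym m₀≡)
          (cleared (proj₂ (proj₂ condition) i (inRange (*-mono-< (s≤s (z≤n {p})) 0<h)
            (subst (λ m → m * suc (toℕ i) ≤ b₀ * n) m₀≡ in-range)))))
        where
        open Clear η E₀ 1≤ηE₀ (suc p) h σ b₀ n (suc (toℕ i)) (degree G (ord i))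
          ω ((ω ℚ.+ ℕ→ℚ σ) ÷₀ ℕ→ℚ h) (ℕ→ℚ σ ÷₀ ω) ((ω ℚ.* ℕ→ℚ n) ÷₀ ℕ→ℚ h)
          ω-eq (÷₀-* _ _ h≢0) (÷₀-* _ _ ω≢0) (÷₀-* _ _ h≢0)

      rest≤n : m₀ + (2 * E₀ + (bound₁ + bound₂)) ≤ n
      rest≤n = ≤-trans (n≤1+n _) n₀≤n

      0<n : 0 < n
      0<n = ≤-trans (s≤s z≤n) n₀≤n

      bounds≤n : 2 * E₀ + (bound₁ + bound₂) ≤ n
      bounds≤n = ≤-trans (m≤n+m _ m₀) rest≤n

      μ : Fin n → ℕ
      μ = R.cappedRank m (b * n)

      solved : Phases.Solved G p a b E μ ρ Kc
      solved = Phases.almostTiling G p a b E μ ρ 0<n 0<ρ 0<E 0<a (<⇒≤ a<b) (λ x → m⊓n≤n (m * R.rank x) (b * n))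
        {ρ ∸ 1} {ρ ∸ (a + p * b)} (sym (m+[n∸m]≡n 0<ρ)) (sym (m+[n∸m]≡n u≤ρ)) ≤-refl {α} 0<α αa
        (R.degree-perturbed (proj₂ (proj₁ (proj₂ condition))) p a₀ b₀ E₀ 0<a₀ a₀≤b₀ integral
          (≤-trans (m≤m+n m₀ _) rest≤n) (≤-trans (m≤m+n (2 * E₀) _) bounds≤n))
        (λ c y → R.cappedRank-count m (b * n) c y)
        Kc N refl
        (≤-trans (≤-trans (m≤m+n bound₁ bound₂) (m≤n+m _ (2 * E₀))) bounds≤n)
        (≤-trans (≤-trans (m≤n+m bound₂ bound₁) (m≤n+m _ (2 * E₀))) bounds≤n)

      module _ (t : ℕ) (S : Phases.Phase.State G p a b E μ ρ t) (small : Kc * length (Phases.Phase.uncovered S) ≤ n) where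

        open Phases.Phase G p a b E μ ρ t hiding (m; e)
        open Bottles G p a b using (∑∑)

        neck-size : ∀ s → a * s ≡ 4 * E₀ * s * (suc p * length (Copies.neckVertices G H p c proper j₀))
        neck-size s = trans (lemma E₀ p σ s) (cong (λ z → 4 * E₀ * s * (suc p * z)) (sym neck-count))
          where
          lemma : ∀ E₀ p σ s → 4 * E₀ * ((1 + p) * σ) * s ≡ 4 * E₀ * s * ((1 + p) * σ)
          lemma = solve-∀

        -- Each body leaves `s` positions free, the ones added by the perturbation; the neck, in
        -- contrast, is filled exactly.
        body-size : ∀ s → 4 * E₀ * s * length (Copies.bodyVertices G H p c proper j₀) ≤ b * s
        body-size s = ≤-trans (≤-reflexive (trans (cong (4 * E₀ * s *_) body-count) (lemma E₀ s b₀))) (m≤n+m (4 * E₀ * b₀ * s) s)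
          where
          lemma : ∀ E₀ s b₀ → 4 * E₀ * s * b₀ ≡ 4 * E₀ * b₀ * s
          lemma = solve-∀

        Placed : List Tile → Set
        Placed tiles = Σ (List Placement) λ ps →
          length ps * h ≡ 4 * E₀ * m₀ * ∑ tiles scale
          × (∀ F → ∑ ps (λ P → ∑ (allFin h) (F ∘ place P)) ≤ ∑ tiles (λ K → ∑∑ (shape K) F))

        placeAll : ∀ tiles → All Valid tiles → Placed tiles
        placeAll [] [] = [] , sym (*-zeroʳ (4 * E₀ * m₀)) , λ F → z≤n
        placeAll (K ∷ tiles) (BK ∷ valid) = append (placeAll tiles valid)
          where
          M : ℕ
          M = 4 * E₀ * scale K
          ps : List Placement
          ps = Copies.placements G H p c proper j₀ BK M (neck-size (scale K)) (body-size (scale K))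
          append : Placed tiles → Placed (K ∷ tiles)
          append (qs , q-length , q-fit) = ps ++ qs , total , λ F → ≤-trans (≤-reflexive (∑-++ ps qs _))
            (+-mono-≤ (Copies.placements-fit G H p c proper j₀ BK M (neck-size (scale K)) (body-size (scale K)) F) (q-fit F))
            where
            total : length (ps ++ qs) * h ≡ 4 * E₀ * m₀ * (scale K + ∑ tiles scale)
            total = begin
              length (ps ++ qs) * h             ≡⟨ trans (cong (_* h) (length-++ ps)) (*-distribʳ-+ h (length ps) (length qs)) ⟩
              length ps * h + length qs * h     ≡⟨ cong₂ _+_ (cong (_* h) (Copies.placements-length G H p c proper j₀ BK M (neck-size (scale K)) (body-size (scale K)))) q-length ⟩
              M * suc p * h + 4 * E₀ * m₀ * ∑ tiles scale ≡⟨ cong (_+ 4 * E₀ * m₀ * ∑ tiles scale) (trans (lemma E₀ (scale K) p h) (cong (λ z → 4 * E₀ * z * scale K) (sym m₀≡))) ⟩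
              4 * E₀ * m₀ * scale K + 4 * E₀ * m₀ * ∑ tiles scale ≡⟨ *-distribˡ-+ (4 * E₀ * m₀) (scale K) _ ⟨
              4 * E₀ * m₀ * (scale K + ∑ tiles scale) ∎
              where
              open ≡-Reasoning
              lemma : ∀ E₀ s p h → 4 * E₀ * s * (1 + p) * h ≡ 4 * E₀ * ((1 + p) * h) * s
              lemma = solve-∀

        weights : m * ∑ (tiles S) scale + length (uncovered S) ≡ n
        weights = trans (cong (_+ length (uncovered S)) (sym (∑-*ˡ (tiles S) m scale))) (totalWeight+ℓ S)

        conclude : Placed (tiles S) → Σ (Tiling H G) λ T → CoversAllBut T (η ℚ.* ℕ→ℚ n)
        conclude (ps , p-length , p-fit) = tiling , missed , missed-uncovered , few-missed
          where
          open Covering G H using (module Tiled)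
          open Tiled ps (λ F → ≤-trans (p-fit F) (≤-trans (m≤m+n _ _) (≤-reflexive (partition S F))))
          bound : E₀ * countᵇ missed ≤ n
          bound = *-cancelˡ-≤ 2 (leftover-arith a₀ b₀ p E₀ n (countᵇ missed) (∑ (tiles S) scale) (length (uncovered S))
            (subst (λ z → countᵇ missed + z ≤ n) p-length missed-count)
            (≤-reflexive (sym weights)) small (≤-reflexive weights) 0<b₀)
          few-missed : ℕ→ℚ (countᵇ missed) ℚ.≤ η ℚ.* ℕ→ℚ n
          few-missed = scaleDown η 0<η E₀ 1≤ηE₀ (countᵇ missed) n bound

      result : Σ (Tiling H G) λ T → CoversAllBut T (η ℚ.* ℕ→ℚ n)
      result = let t , _ , S , small = solved in
        conclude t S small (placeAll t S small (Phases.Phase.tiles S) (Phases.Phase.valid S))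

  ¬Colourable-0 : ∀ {h} {H : Graph h} → HasEdge H → ¬ Colourable H 0
  ¬Colourable-0 (u , _) (c , _) = case c u of λ ()

  ¬Colourable-1 : ∀ {h} {H : Graph h} → HasEdge H → ¬ Colourable H 1
  ¬Colourable-1 (u , v , uv) (c , proper) = proper u v uv (fin1 (c u) (c v))
    where
    fin1 : ∀ (x y : Fin 1) → x ≡ y
    fin1 Fin.zero Fin.zero = refl

  emptyClass⇒colourable : ∀ {h k} {H : Graph h} (c : Fin h → Fin (suc k)) → ProperColouring H (suc k) c →
                          ∀ j → classSize c j ≡ 0 → Colourable H k
  emptyClass⇒colourable {h} c proper j empty =
    (λ u → punchOut (avoid u)) , λ u v uv e → proper u v uv (punchOut-injective (avoid u) (avoid v) e)
    where
    avoid : ∀ u → j ≢ c u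
    avoid u j≡cu = <⇒≱ (s≤s z≤n) (begin
      1                                          ≡⟨ cong ⟦_⟧ (dec-true (c u ≟ᶠ j) (sym j≡cu)) ⟨
      ⟦ does (c u ≟ᶠ j) ⟧                        ≤⟨ ∑-≥-∈ (λ u → ⟦ does (c u ≟ᶠ j) ⟧) (∈-allFin u) ⟩
      # (λ u → does (c u ≟ᶠ j)) (allFin h)       ≡⟨ trans (∑≡sum (allFin h) _) empty ⟩
      0                                          ∎)
      where open ≤-Reasoning

  -- An empty colour class could be deleted, contradicting the minimality of the chromatic number.
  -- Positivity gives the bottles a neck.
  σ-positive : ∀ {h p σ} {H : Graph h} → ChromaticNumber H (suc p) → IsSigma H (suc p) σ → 0 < σ
  σ-positive {p = p} {H = H} (_ , minimal) ((c , proper , j , c-size) , _) = n≢0⇒n>0 λ σ≡0 →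
    minimal p (n<1+n p) (emptyClass⇒colourable {H = H} c proper j (trans c-size σ≡0))

  -- The `r` classes of one optimal colouring are disjoint and each has at least `σ` vertices. This
  -- amounts to `σ ≤ ω`: the neck is no larger than a body.
  r*σ≤h : ∀ {h r σ} {H : Graph h} → IsSigma H r σ → r * σ ≤ h
  r*σ≤h {r = r} {σ} ((c , proper , _) , smallest) = ≤-trans (≤-reflexive (sym (∑-allFin-const r σ)))
    (≤-trans (∑-mono (allFin r) (smallest c proper)) (∑-classSize c))

open Assembly
open Rationals using (1≤*denominator)
open import Data.Rational using (ℚ; 0ℚ; _<_; ↧ₙ_)

theorem4p1 : (η : ℚ) → 0ℚ < η →
    (h : ℕ) (H : Graph h) → HasEdge H →
    (r : ℕ) → ChromaticNumber H r →
    (σ : ℕ) → IsSigma H r σ →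
    let ω = ℕ→ℚ (h ∸ σ) ÷₀ ℕ→ℚ (r ∸ 1) in
    ∃ λ (n₀ : ℕ) → ∀ (n : ℕ) → n ≥ n₀ → (G : Graph n) →
    DegreeCondition G η ω h σ →
    Σ (Tiling H G) λ T → CoversAllBut T (η Data.Rational.* ℕ→ℚ n)
theorem4p1 η 0<η h H edge 0 (col , _) σ _ = ⊥-elim (¬Colourable-0 {H = H} edge col)
theorem4p1 η 0<η h H edge 1 (col , _) σ _ = ⊥-elim (¬Colourable-1 {H = H} edge col)
theorem4p1 η 0<η h H edge (suc (suc p)) χ σ isσ@((c , proper , j , c-size) , _) =
  n₀ , λ n n₀≤n G condition → Host.result n₀≤n G condition
  where open Main H p σ c proper j c-size (σ-positive {H = H} χ isσ) (r*σ≤h {H = H} isσ) η 0<η (↧ₙ η) (s≤s z≤n) (1≤*denominator η 0<η)
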